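{- There is a computable age $\mathbb K$ (in some countable language), which is the canonical computable age of some (computable) structure, such that $\mathbb K$ has the cofinal amalgamation property (CAP) but, for every Turing degree $\mathfrak s$, if $\mathbb K$ has the $\mathfrak s$-computable cofinal amalgamation property $\mathfrak s$-(cCAP), then $\mathbf{0''}\leq_{\mathrm T}\mathfrak s$.
   Context: Languages and structures. $\mathcal{L}$ is a countable (possibly infinite) language with a computable representation: relation symbols $R_n$ (of positive arity) and function symbols $F_m$ are indexed bijectively by disjoint computable subsets of $\omega$, with arity computable from the index. An $\mathcal{L}$-structure $\mathcal{M}$ is c.e. if its underlying set $M$ is a c.e. subset of $\omega$ and the sets $\{(n,\mathbf a): \mathcal M\models R_n(\mathbf a)\}$, $\{(n,\mathbf a): \mathcal M\models \neg R_n(\mathbf a)\}$, $\{(m,\mathbf a,b): \mathcal M\models F_m(\mathbf a)=b\}$ are c.e.; it is computable if moreover $M$ is computable. Tuples are finite; $\mathrm{cl}_{\mathcal M}(\mathbf a)$ is the smallest substructure of $\mathcal M$ containing $\mathbf a$. For $\mathbf a\in\mathcal A$, $\mathbf b\in\mathcal B$ of the same length, $\mathbf a\simeq\mathbf b$ means that for every atomic $\mathcal L$-formula $\varphi$, $\mathcal A\models\varphi(\mathbf a)$ iff $\mathcal B\models\varphi(\mathbf b)$; equivalently $\mathbf a\mapsto\mathbf b$ extends to an isomorphism $\mathrm{cl}(\mathbf a)\to\mathrm{cl}(\mathbf b)$. $\mathbf{0''}$ is the double Turing jump of the least Turing degree. Ages. An age is a collection of finitely generated $\mathcal L$-structures closed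 under isomorphism. A computable age (computable representation of an age $\mathcal K$) is a c.e. set $\mathbb K$ of triples $(\mathbf a,\mathcal A,i)$ (computable structures being given by indices), with exactly one triple for each $i\in\omega$, written $\mathbb I(i)=(\mathbf a_i,\mathcal A_i,i)$, such that each $\mathcal A_i$ is a computable $\mathcal L$-structure in $\mathcal K$ with $\mathcal A_i=\mathrm{cl}_{\mathcal A_i}(\mathbf a_i)$, and every $\mathcal B\in\mathcal K$ is isomorphic to some $\mathcal A_i$. $\mathbb K$ is said to have a property of ages if $\mathcal K$ does. For a computable structure $\mathcal M$, a canonical computable age of $\mathcal M$ is the sequence $(\mathbf a_i,\mathrm{cl}_{\mathcal M}(\mathbf a_i),i)_{i\in\omega}$, where $(\mathbf a_i)_{i\in\omega}$ is a computable enumeration of all finite tuples in $\mathcal M$ in which every tuple appears infinitely often (any two are computably isomorphic); it represents the age of $\mathcal M$, i.e. the collection of structures isomorphic to a finitely generated substructure of $\mathcal M$. Embeddings and amalgamation diagrams. A potential embedding in $\mathbb K$ is a triple $F=(\mathbb I(i),\mathbb I(j),\mathbf c)$ with $\mathbf c\in\mathcal A_j$; $\mathrm{dom}(F)=\mathbb I(i)$, $\mathrm{codom}(F)=\mathbb I(j)$. It is an embedding if $\mathbf a_i\simeq\mathbf c$ (it then encodes the embedding $\mathcal A_i\to\mathcal A_j$ sending $\mathbf a_i$ to $\mathbf c$); composition of embeddings is composition of the encoded maps, and an isomorphism is an embedding whose encoded map is onto. A potential span is a pair $(F_0,F_1)$ of potential embeddings with $\mathrm{dom}(F_0)=\mathrm{dom}(F_1)$;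 it is a span if both are embeddings. An amalgamation diagram over a potential span $(F_0,F_1)$ is a pair $(G_0,G_1)$ with $G_0$ an embedding, $G_1$ a potential embedding, $\mathrm{dom}(G_i)=\mathrm{codom}(F_i)$ for $i\in\{0,1\}$, $\mathrm{codom}(G_0)=\mathrm{codom}(G_1)$, and such that if $(F_0,F_1)$ is a span then $G_1$ is an embedding and $G_0\circ F_0=G_1\circ F_1$. Cofinal amalgamation. An amalgamation base is an $\mathcal A'\in\mathcal K$ such that whenever $\mathcal B,\mathcal C\in\mathcal K$ and $f_{\mathcal B}:\mathcal A'\to\mathcal B$, $f_{\mathcal C}:\mathcal A'\to\mathcal C$ are embeddings, there are $\mathcal D\in\mathcal K$ and embeddings $\alpha_{\mathcal B}:\mathcal B\to\mathcal D$, $\alpha_{\mathcal C}:\mathcal C\to\mathcal D$ with $\alpha_{\mathcal B}\circ f_{\mathcal B}=\alpha_{\mathcal C}\circ f_{\mathcal C}$. (CAP): every $\mathcal A\in\mathcal K$ embeds into some amalgamation base in $\mathcal K$. A collection of distinguished extensions is a collection of embeddings in $\mathbb K$ closed under pre- and post-composition with isomorphisms between elements of $\mathbb K$ and such that every $\mathbb I(i)$ is the domain of some member. A witness to (CAP) is a pair $(\mathrm{AB},f)$ where $\mathrm{AB}$ is a collection of distinguished extensions each of whose members has an amalgamation base as codomain, and $f$ takes each tuple $(F,G_0,G_1)$ with $F\in\mathrm{AB}$, $(G_0,G_1)$ a potential span and $\mathrm{dom}(G_0)=\mathrm{dom}(G_1)=\mathrm{codom}(F)$ to an amalgamation diagram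 over $(G_0,G_1)$. It is $\mathfrak s$-computable if $\mathrm{AB}$ is $\mathfrak s$-c.e. and $f$ is an $\mathfrak s$-computable partial function. $\mathbb K$ has $\mathfrak s$-(cCAP) if it has an $\mathfrak s$-computable witness to (CAP). -}

module Defs where

open import Level using (0ℓ)
open import Data.Bool using (Bool; T)
open import Data.Fin as Fin using (Fin)
open import Data.List as List using (List; []; _∷_)
open import Data.Nat using (ℕ; zero; suc; _+_; _≤_; _<_; NonZero)
open import Data.Product using (Σ; Σ-syntax; ∃; ∃-syntax; _×_; _,_; proj₁; proj₂)
open import Data.Sum using (_⊎_)
open import Data.Vec as Vec using (Vec; []; _∷_)
open import Data.Vec.Relation.Binary.Pointwise.Inductive as Pointwise using (Pointwise; []; _∷_)
open import Data.Vec.Relation.Unary.All as All using (All; []; _∷_)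
open import Function.Bundles using (_⇔_; mk⇔; Equivalence)
open import Relation.Binary.Bundles using (Setoid)
import Relation.Binary.Construct.On as On
open import Relation.Binary.PropositionalEquality as ≡ using (_≡_)
open import Relation.Nullary using (¬_)
open import Relation.Unary using (Pred; ∅)

triangle : ℕ → ℕ
triangle zero    = 0
triangle (suc n) = suc n + triangle n

-- Cantor's pairing bijection ℕ × ℕ → ℕ.
⟨_,_⟩ : ℕ → ℕ → ℕ
⟨ x , y ⟩ = triangle (x + y) + y

-- A bijection between finite tuples of numbers and ℕ.
⌈_⌉ : List ℕ → ℕ
⌈ [] ⌉     = 0
⌈ x ∷ xs ⌉ = suc ⟨ x , ⌈ xs ⌉ ⟩

-- Partial recursive functions with an oracle; several arguments are passed
-- to a program as one number by means of ⟨_,_⟩.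
data Program : Set where
  zeroᵖ succᵖ leftᵖ rightᵖ oracleᵖ : Program
  pairᵖ compᵖ recᵖ                 : Program → Program → Program
  minᵖ                             : Program → Program

infix 4 _⊢_[_]⇓_

-- S ⊢ p [ x ]⇓ y : with the characteristic function of S as oracle, p halts
-- on input x with output y.
data _⊢_[_]⇓_ (S : Pred ℕ 0ℓ) : Program → ℕ → ℕ → Set where
  zero⇓  : ∀ {x} → S ⊢ zeroᵖ [ x ]⇓ 0
  succ⇓  : ∀ {x} → S ⊢ succᵖ [ x ]⇓ suc x
  left⇓  : ∀ {x y} → S ⊢ leftᵖ [ ⟨ x , y ⟩ ]⇓ x
  right⇓ : ∀ {x y} → S ⊢ rightᵖ [ ⟨ x , y ⟩ ]⇓ y
  yes⇓   : ∀ {x} → S x → S ⊢ oracleᵖ [ x ]⇓ 1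
  no⇓    : ∀ {x} → ¬ S x → S ⊢ oracleᵖ [ x ]⇓ 0
  pair⇓  : ∀ {p q x y z} → S ⊢ p [ x ]⇓ y → S ⊢ q [ x ]⇓ z →
           S ⊢ pairᵖ p q [ x ]⇓ ⟨ y , z ⟩
  comp⇓  : ∀ {p q x y z} → S ⊢ q [ x ]⇓ y → S ⊢ p [ y ]⇓ z →
           S ⊢ compᵖ p q [ x ]⇓ z
  rec0⇓  : ∀ {p q x y} → S ⊢ p [ x ]⇓ y → S ⊢ recᵖ p q [ ⟨ x , 0 ⟩ ]⇓ y
  recS⇓  : ∀ {p q x n y z} → S ⊢ recᵖ p q [ ⟨ x , n ⟩ ]⇓ y →
           S ⊢ q [ ⟨ x , ⟨ n , y ⟩ ⟩ ]⇓ z → S ⊢ recᵖ p q [ ⟨ x , suc n ⟩ ]⇓ z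
  min⇓   : ∀ {p x n} → S ⊢ p [ ⟨ x , n ⟩ ]⇓ 0 →
           (∀ k → k < n → ∃[ v ] S ⊢ p [ ⟨ x , k ⟩ ]⇓ suc v) →
           S ⊢ minᵖ p [ x ]⇓ n

⌜_⌝ : Program → ℕ
⌜ zeroᵖ ⌝     = ⟨ 0 , 0 ⟩
⌜ succᵖ ⌝     = ⟨ 1 , 0 ⟩
⌜ leftᵖ ⌝     = ⟨ 2 , 0 ⟩
⌜ rightᵖ ⌝    = ⟨ 3 , 0 ⟩
⌜ oracleᵖ ⌝   = ⟨ 4 , 0 ⟩
⌜ pairᵖ p q ⌝ = ⟨ 5 , ⟨ ⌜ p ⌝ , ⌜ q ⌝ ⟩ ⟩
⌜ compᵖ p q ⌝ = ⟨ 6 , ⟨ ⌜ p ⌝ , ⌜ q ⌝ ⟩ ⟩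
⌜ recᵖ p q ⌝  = ⟨ 7 , ⟨ ⌜ p ⌝ , ⌜ q ⌝ ⟩ ⟩
⌜ minᵖ p ⌝    = ⟨ 8 , ⌜ p ⌝ ⟩

_⊢_Decides_ : Pred ℕ 0ℓ → Program → Pred ℕ 0ℓ → Set
S ⊢ p Decides A = ∀ x → (A x → S ⊢ p [ x ]⇓ 1) × (¬ A x → S ⊢ p [ x ]⇓ 0)

_⊢_Enumerates_ : Pred ℕ 0ℓ → Program → Pred ℕ 0ℓ → Set
S ⊢ p Enumerates A = ∀ x → A x ⇔ (∃[ y ] S ⊢ p [ x ]⇓ y)

infix 4 _≤ᵀ_

_≤ᵀ_ : Pred ℕ 0ℓ → Pred ℕ 0ℓ → Set
A ≤ᵀ S = ∃[ p ] S ⊢ p Decides A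

_-CE_ : Pred ℕ 0ℓ → Pred ℕ 0ℓ → Set
S -CE A = ∃[ p ] S ⊢ p Enumerates A

Computable CE : Pred ℕ 0ℓ → Set
Computable A = A ≤ᵀ ∅
CE A = ∅ -CE A

TotalComputable : (ℕ → ℕ) → Set
TotalComputable f = ∃[ p ] (∀ x → ∅ ⊢ p [ x ]⇓ f x)

-- A partial function is given by its graph.
_-PartialComputable_ : Pred ℕ 0ℓ → (ℕ → ℕ → Set) → Set
S -PartialComputable f = ∃[ p ] (∀ x y → f x y ⇔ S ⊢ p [ x ]⇓ y)

infix 10 _′

_′ : Pred ℕ 0ℓ → Pred ℕ 0ℓ
(S ′) n = ∃[ p ] n ≡ ⌜ p ⌝ × (∃[ y ] S ⊢ p [ n ]⇓ y)

record Language : Set where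
  field
    isRel isFun : ℕ → Bool
    -- Only the values of arity at indices of symbols matter.
    arity       : ℕ → ℕ
    disjoint    : ∀ n → ¬ (T (isRel n) × T (isFun n))
    positive    : ∀ n → T (isRel n) → NonZero (arity n)
    rel-computable   : Computable (λ n → T (isRel n))
    fun-computable   : Computable (λ n → T (isFun n))
    arity-computable : ∃[ p ] (∀ n → T (isRel n) ⊎ T (isFun n) → ∅ ⊢ p [ n ]⇓ arity n)

  RelSym FunSym : Set
  RelSym = ∃[ n ] T (isRel n)
  FunSym = ∃[ n ] T (isFun n)

  relArity : RelSym → ℕ
  relArity R = arity (proj₁ R)

  funArity : FunSym → ℕ
  funArity F = arity (proj₁ F)

open Language using (RelSym; FunSym; relArity; funArity)

record Interpretation (L : Language) (X : Setoid 0ℓ 0ℓ) : Set₁ where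
  open Setoid X using (Carrier; _≈_)
  field
    rel : (R : RelSym L) → Vec Carrier (relArity L R) → Set
    fun : (F : FunSym L) → Vec Carrier (funArity L F) → Carrier
    rel-cong : ∀ R {xs ys} → Pointwise _≈_ xs ys → rel R xs → rel R ys
    fun-cong : ∀ F {xs ys} → Pointwise _≈_ xs ys → fun F xs ≈ fun F ys

record Structure (L : Language) : Set₁ where
  field
    setoid         : Setoid 0ℓ 0ℓ
    interpretation : Interpretation L setoid
  open Setoid setoid public using (Carrier; _≈_)
  open Interpretation interpretation public
  module Eq = Setoid setoid

-- A subset of ω as a setoid: membership proofs are disregarded.
subset : Pred ℕ 0ℓ → Setoid 0ℓ 0ℓ
subset D = On.setoid {B = ∃ D} (≡.setoid ℕ) proj₁

record ωStructure (L : Language) : Set₁ where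
  field
    Dom            : Pred ℕ 0ℓ
    interpretation : Interpretation L (subset Dom)
  structure : Structure L
  structure = record { setoid = subset Dom ; interpretation = interpretation }
  open Structure structure public hiding (interpretation)

values : {D : Pred ℕ 0ℓ} → List (∃ D) → List ℕ
values = List.map proj₁

module _ {L : Language} where

  open Structure

  record Embedding (A B : Structure L) : Set where
    field
      map       : Carrier A → Carrier B
      cong      : ∀ {x y} → _≈_ A x y → _≈_ B (map x) (map y)
      injective : ∀ {x y} → _≈_ B (map x) (map y) → _≈_ A x y
      onRel     : ∀ R xs → rel A R xs ⇔ rel B R (Vec.map map xs)
      onFun     : ∀ F xs → _≈_ B (map (fun A F xs)) (fun B F (Vec.map map xs))

  Surjective : {A B : Structure L} → Embedding A B → Set
  Surjective {A} {B} f = ∀ y → ∃[ x ] _≈_ B (Embedding.map f x) y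

  infix 4 _≅_

  _≅_ : Structure L → Structure L → Set
  A ≅ B = Σ[ f ∈ Embedding A B ] Surjective f

  -- The least subset containing a and closed under the functions, i.e. the
  -- underlying set of cl(a).
  data Cl (A : Structure L) (a : List (Carrier A)) : Carrier A → Set where
    gen  : ∀ i → Cl A a (List.lookup a i)
    app  : ∀ F {xs} → All (Cl A a) xs → Cl A a (fun A F xs)
    resp : ∀ {x y} → _≈_ A x y → Cl A a x → Cl A a y

  Generates : (A : Structure L) → List (Carrier A) → Set
  Generates A a = ∀ x → Cl A a x

  FinitelyGenerated : Structure L → Set
  FinitelyGenerated A = ∃[ a ] Generates A a

  data Term (n : ℕ) : Set where
    var : Fin n → Term n
    app : (F : FunSym L) → Vec (Term n) (funArity L F) → Term n

  infix 5 _≐_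

  data Atomic (n : ℕ) : Set where
    _≐_ : Term n → Term n → Atomic n
    atom : (R : RelSym L) → Vec (Term n) (relArity L R) → Atomic n

  module _ (A : Structure L) {n : ℕ} (ρ : Fin n → Carrier A) where
    mutual
      eval : Term n → Carrier A
      eval (var i)    = ρ i
      eval (app F ts) = fun A F (evals ts)

      evals : ∀ {m} → Vec (Term n) m → Vec (Carrier A) m
      evals []       = []
      evals (t ∷ ts) = eval t ∷ evals ts

  infix 4 _⊨_[_]

  _⊨_[_] : (A : Structure L) → ∀ {n} → Atomic n → (Fin n → Carrier A) → Set
  A ⊨ s ≐ t    [ ρ ] = _≈_ A (eval A ρ s) (eval A ρ t)
  A ⊨ atom R ts [ ρ ] = rel A R (evals A ρ ts)

  -- a ≃ b, for tuples a in A and b in B.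
  SameAtomicType : (A B : Structure L) → List (Carrier A) → List (Carrier B) → Set
  SameAtomicType A B a b =
    Σ[ eq ∈ List.length a ≡ List.length b ]
      (∀ φ → A ⊨ φ [ List.lookup a ] ⇔ B ⊨ φ [ (λ i → List.lookup b (Fin.cast eq i)) ])

  -- If a generates A and a ≃ b, then a ↦ b extends to an embedding of A into B.
  module Extend {A B : Structure L} {a : List (Carrier A)} {b : List (Carrier B)}
                (generates : Generates A a) (a≃b : SameAtomicType A B a b) where

    ρ : Fin (List.length a) → Carrier A
    ρ = List.lookup a

    σ : Fin (List.length a) → Carrier B
    σ i = List.lookup b (Fin.cast (proj₁ a≃b) i)

    transfer : ∀ φ → A ⊨ φ [ ρ ] ⇔ B ⊨ φ [ σ ]
    transfer = proj₂ a≃b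

    to : ∀ φ → A ⊨ φ [ ρ ] → B ⊨ φ [ σ ]
    to φ = Equivalence.to (transfer φ)

    from : ∀ φ → B ⊨ φ [ σ ] → A ⊨ φ [ ρ ]
    from φ = Equivalence.from (transfer φ)

    mutual
      term : ∀ {x} → Cl A a x → Term (List.length a)
      term (gen i)    = var i
      term (app F cs) = app F (terms cs)
      term (resp _ c) = term c

      terms : ∀ {m} {xs : Vec (Carrier A) m} → All (Cl A a) xs → Vec (Term (List.length a)) m
      terms []       = []
      terms (c ∷ cs) = term c ∷ terms cs

    mutual
      term-eval : ∀ {x} (c : Cl A a x) → _≈_ A (eval A ρ (term c)) x
      term-eval (gen i)    = Eq.refl A
      term-eval (app F cs) = fun-cong A F (terms-eval cs)
      term-eval (resp e c) = Eq.trans A (term-eval c) e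

      terms-eval : ∀ {m} {xs : Vec (Carrier A) m} (cs : All (Cl A a) xs) →
                   Pointwise (_≈_ A) (evals A ρ (terms cs)) xs
      terms-eval []       = []
      terms-eval (c ∷ cs) = term-eval c ∷ terms-eval cs

    ⌊_⌋ : Carrier A → Term (List.length a)
    ⌊ x ⌋ = term (generates x)

    eval⌊_⌋ : ∀ x → _≈_ A (eval A ρ ⌊ x ⌋) x
    eval⌊ x ⌋ = term-eval (generates x)

    h : Carrier A → Carrier B
    h x = eval B σ ⌊ x ⌋

    evals⌊_⌋ : ∀ {m} (xs : Vec (Carrier A) m) →
               Pointwise (_≈_ A) (evals A ρ (Vec.map ⌊_⌋ xs)) xs
    evals⌊ [] ⌋     = []
    evals⌊ x ∷ xs ⌋ = eval⌊ x ⌋ ∷ evals⌊ xs ⌋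

    evals-h : ∀ {m} (xs : Vec (Carrier A) m) → evals B σ (Vec.map ⌊_⌋ xs) ≡ Vec.map h xs
    evals-h []       = ≡.refl
    evals-h (x ∷ xs) = ≡.cong (h x ∷_) (evals-h xs)

    h-eval : ∀ {x} t → _≈_ A x (eval A ρ t) → _≈_ B (h x) (eval B σ t)
    h-eval {x} t e = to (⌊ x ⌋ ≐ t) (Eq.trans A eval⌊ x ⌋ e)

    extension : Embedding A B
    extension = record
      { map       = h
      ; cong      = λ {x} {y} e → h-eval ⌊ y ⌋ (Eq.trans A e (Eq.sym A eval⌊ y ⌋))
      ; injective = λ {x} {y} e →
          Eq.trans A (Eq.sym A eval⌊ x ⌋) (Eq.trans A (from (⌊ x ⌋ ≐ ⌊ y ⌋) e) eval⌊ y ⌋)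
      ; onRel     = λ R xs → mk⇔
          (λ r → ≡.subst (rel B R) (evals-h xs)
                   (to (atom R (Vec.map ⌊_⌋ xs))
                     (rel-cong A R (Pointwise.sym (Eq.sym A) evals⌊ xs ⌋) r)))
          (λ r → rel-cong A R evals⌊ xs ⌋
                   (from (atom R (Vec.map ⌊_⌋ xs)) (≡.subst (rel B R) (≡.sym (evals-h xs)) r)))
      ; onFun     = λ F xs →
          ≡.subst (λ ys → _≈_ B (h (fun A F xs)) (fun B F ys)) (evals-h xs)
            (h-eval (app F (Vec.map ⌊_⌋ xs))
              (fun-cong A F (Pointwise.sym (Eq.sym A) evals⌊ xs ⌋)))
      }

    extends : ∀ i → _≈_ B (h (List.lookup a i)) (List.lookup b (Fin.cast (proj₁ a≃b) i))
    extends i = h-eval (var i) (Eq.refl A)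

module _ {L : Language} where

  -- cl_M(a) as a structure on its underlying subset of ω.
  cl : (M : ωStructure L) → List (ωStructure.Carrier M) → ωStructure L
  cl M a = record
    { Dom            = Dom′
    ; interpretation = record
      { rel      = λ R xs → rel R (Vec.map incl xs)
      ; fun      = λ F xs → let y = fun F (Vec.map incl xs) in
                            proj₁ y , proj₂ y , app F (inCl xs)
      ; rel-cong = λ R es → rel-cong R (Pointwise.map⁺ (λ e → e) es)
      ; fun-cong = λ F es → fun-cong F (Pointwise.map⁺ (λ e → e) es)
      }
    }
    where
    open ωStructure M

    Dom′ : Pred ℕ 0ℓ
    Dom′ x = Σ[ x∈M ∈ Dom x ] Cl structure a (x , x∈M)

    incl : ∃ Dom′ → ∃ Dom
    incl (x , x∈M , _) = x , x∈M

    inCl : ∀ {n} (xs : Vec (∃ Dom′) n) → All (Cl structure a) (Vec.map incl xs)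
    inCl []                 = []
    inCl ((_ , _ , c) ∷ xs) = c ∷ inCl xs

  module _ (M : ωStructure L) where
    open ωStructure M

    PosDiagram NegDiagram FunGraph : Pred ℕ 0ℓ
    PosDiagram z = ∃[ R ] ∃[ a ] z ≡ ⟨ proj₁ R , ⌈ values (Vec.toList a) ⌉ ⟩ × rel R a
    NegDiagram z = ∃[ R ] ∃[ a ] z ≡ ⟨ proj₁ R , ⌈ values (Vec.toList a) ⌉ ⟩ × ¬ rel R a
    FunGraph z =
      ∃[ F ] ∃[ a ] z ≡ ⟨ proj₁ F , ⟨ ⌈ values (Vec.toList a) ⌉ , proj₁ (fun F a) ⟩ ⟩

    -- An index of M packs programs for the domain, the two diagrams and the
    -- graphs of the functions.
    IsIndex : ℕ → Set
    IsIndex e =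
      ∃[ d ] ∃[ p ] ∃[ n ] ∃[ g ]
        e ≡ ⟨ ⌜ d ⌝ , ⟨ ⌜ p ⌝ , ⟨ ⌜ n ⌝ , ⌜ g ⌝ ⟩ ⟩ ⟩
        × ∅ ⊢ d Decides Dom
        × ∅ ⊢ p Enumerates PosDiagram
        × ∅ ⊢ n Enumerates NegDiagram
        × ∅ ⊢ g Enumerates FunGraph

    ComputableStructure : Set
    ComputableStructure = ∃[ e ] IsIndex e

record Age (L : Language) : Set₁ where
  field
    Member            : Structure L → Set
    finitelyGenerated : ∀ {A} → Member A → FinitelyGenerated A
    closed            : ∀ {A B} → A ≅ B → Member A → Member B

record ComputableAge {L : Language} (𝒦 : Age L) : Set₁ where
  open Age 𝒦
  field
    𝒜     : ℕ → ωStructure L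
    index : ℕ → ℕ
    𝐚     : ∀ i → List (ωStructure.Carrier (𝒜 i))
    isIndex   : ∀ i → IsIndex (𝒜 i) (index i)
    generated : ∀ i → Generates (ωStructure.structure (𝒜 i)) (𝐚 i)

  𝕂 : Pred ℕ 0ℓ
  𝕂 z = ∃[ i ] z ≡ ⟨ ⌈ values (𝐚 i) ⌉ , ⟨ index i , i ⟩ ⟩

  field
    enumerable : CE 𝕂
    member     : ∀ i → Member (ωStructure.structure (𝒜 i))
    complete   : ∀ B → Member B → ∃[ i ] B ≅ ωStructure.structure (𝒜 i)

-- The last field says that the i-th structure is cl_M(enum i), since an index
-- determines the structure it is an index of.
record IsCanonicalAge {L : Language} {𝒦 : Age L}
                      (M : ωStructure L) (K : ComputableAge 𝒦) : Set where
  open ComputableAge K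
  field
    enum            : ℕ → List (ωStructure.Carrier M)
    enum-computable : TotalComputable (λ i → ⌈ values (enum i) ⌉)
    recurrent       : ∀ (t : List (ωStructure.Carrier M)) n →
                      ∃[ i ] n ≤ i × values (enum i) ≡ values t
    tuples          : ∀ i → values (𝐚 i) ≡ values (enum i)
    structures      : ∀ i → IsIndex (cl M (enum i)) (index i)

module _ {L : Language} (𝒦 : Age L) where
  open Age 𝒦

  AmalgamationBase : Structure L → Set₁
  AmalgamationBase A =
    Member A ×
    (∀ B C → Member B → Member C → (f : Embedding A B) (g : Embedding A C) →
      ∃[ D ] Member D ×
        (Σ[ α ∈ Embedding B D ] Σ[ β ∈ Embedding C D ]
          (∀ x → Structure._≈_ D (Embedding.map α (Embedding.map f x))
                                 (Embedding.map β (Embedding.map g x)))))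

  CAP : Set₁
  CAP = ∀ A → Member A → ∃[ A′ ] AmalgamationBase A′ × Embedding A A′

module _ {L : Language} {𝒦 : Age L} (K : ComputableAge 𝒦) where
  open ComputableAge K

  private
    str : ℕ → Structure L
    str i = ωStructure.structure (𝒜 i)

  -- The triple (𝕀(i), 𝕀(j), c); the length of c is not constrained.
  record PotentialEmbedding (i j : ℕ) : Set where
    constructor potential
    field tuple : List (ωStructure.Carrier (𝒜 j))

  open PotentialEmbedding

  -- i and j stand for the triples 𝕀(i) and 𝕀(j), which are computable from them.
  code : ∀ {i j} → PotentialEmbedding i j → ℕ
  code {i} {j} F = ⟨ i , ⟨ j , ⌈ values (tuple F) ⌉ ⟩ ⟩

  record IsEmbedding {i j : ℕ} (F : PotentialEmbedding i j) : Set where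
    constructor isEmbedding
    field sameAtomicType : SameAtomicType (str i) (str j) (𝐚 i) (tuple F)

  encoded : ∀ {i j} {F : PotentialEmbedding i j} → IsEmbedding F → Embedding (str i) (str j)
  encoded {i} {j} {F} (isEmbedding e) =
    Extend.extension {A = str i} {B = str j} {a = 𝐚 i} {b = tuple F} (generated i) e

  infixr 9 _∘ᴾ_

  -- The potential embedding that encodes the composition G ∘ F.
  _∘ᴾ_ : ∀ {i j k} {G : PotentialEmbedding j k} →
         IsEmbedding G → PotentialEmbedding i j → PotentialEmbedding i k
  g ∘ᴾ F = potential (List.map (Embedding.map (encoded g)) (tuple F))

  IsIsomorphism : ∀ {i j} {F : PotentialEmbedding i j} → IsEmbedding F → Set
  IsIsomorphism f = Surjective (encoded f)

  IsAmalgamationDiagram : ∀ {i j k m} →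
    PotentialEmbedding i j → PotentialEmbedding i k →
    PotentialEmbedding j m → PotentialEmbedding k m → Set
  IsAmalgamationDiagram {m = m} F₀ F₁ G₀ G₁ =
    Σ[ g₀ ∈ IsEmbedding G₀ ]
      ((f₀ : IsEmbedding F₀) (f₁ : IsEmbedding F₁) →
        Σ[ g₁ ∈ IsEmbedding G₁ ]
          (∀ x → ωStructure._≈_ (𝒜 m)
                   (Embedding.map (encoded g₀) (Embedding.map (encoded f₀) x))
                   (Embedding.map (encoded g₁) (Embedding.map (encoded f₁) x))))

  -- A collection of potential embeddings is given by the set of their codes.
  record IsDistinguished (AB : Pred ℕ 0ℓ) : Set where
    field
      embeddings : ∀ {z} → AB z →
        Σ[ i ∈ ℕ ] Σ[ j ∈ ℕ ] Σ[ F ∈ PotentialEmbedding i j ] z ≡ code F × IsEmbedding F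
      post : ∀ {i j k} {F : PotentialEmbedding i j} {G : PotentialEmbedding j k}
             (g : IsEmbedding G) → IsIsomorphism g → AB (code F) → AB (code (g ∘ᴾ F))
      pre  : ∀ {h i j} {F : PotentialEmbedding i j} {G : PotentialEmbedding h i}
             (g : IsEmbedding G) → IsIsomorphism g →
             (f : IsEmbedding F) → AB (code F) → AB (code (f ∘ᴾ G))
      total : ∀ i → Σ[ j ∈ ℕ ] Σ[ F ∈ PotentialEmbedding i j ] AB (code F)

  record CAPWitness : Set₁ where
    field
      AB            : Pred ℕ 0ℓ
      distinguished : IsDistinguished AB
      bases         : ∀ {i j} {F : PotentialEmbedding i j} → AB (code F) → AmalgamationBase 𝒦 (str j)
      f             : ℕ → ℕ → Set
      functional    : ∀ {x y z} → f x y → f x z → y ≡ z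
      amalgamates   : ∀ {i j k l} (F : PotentialEmbedding i j)
        (G₀ : PotentialEmbedding j k) (G₁ : PotentialEmbedding j l) → AB (code F) →
        Σ[ m ∈ ℕ ] Σ[ H₀ ∈ PotentialEmbedding k m ] Σ[ H₁ ∈ PotentialEmbedding l m ]
          f ⟨ code F , ⟨ code G₀ , code G₁ ⟩ ⟩ ⟨ code H₀ , code H₁ ⟩
          × IsAmalgamationDiagram G₀ G₁ H₀ H₁

  -- A degree enters through a set S of that degree.
  cCAP : Pred ℕ 0ℓ → Set₁
  cCAP S = Σ[ w ∈ CAPWitness ] S -CE (CAPWitness.AB w) × S -PartialComputable (CAPWitness.f w)

-- A structure of the age is a finite disjoint union of components.  Each has a
-- kind and a colour, and its elements have distinct labels, so that an amalgam
-- must identify elements with equal labels.  Such a structure is an amalgamation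
-- base iff each component has an element whose label occurs in one colour only,
-- or else all labels of its kind eventually occur in all colours.
--
-- Write n ∈ ∅″ as ∃ t ∀ d R(n,t,d) and call t good for n if R(n,t′,d) holds for
-- some t′ ≤ t and all d.  In components of kind ⟨n, 0⟩ it is the labels with a
-- good number that determine the colour.  In components of kind ⟨n, suc k⟩ it is
-- those which only occur from the stage on by which k is seen not to be good.
-- Elements of the j-th structure are numbers less than j.  Hence if the structures
-- with numbers j and j′ are bases which extend a one-point structure of kind
-- ⟨n, 0⟩ and one of kind ⟨n, suc j⟩, respectively, then n ∈ ∅″ iff j is good for
-- n iff j is not seen not to be good by stage j′.  From a witness to 𝔰-(cCAP), such
-- j and j′ are found by enumerating AB.

module Submission where

open import Defs
open import Level using (0ℓ)
open import Axiom.ExcludedMiddle using (ExcludedMiddle)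
open import Data.Bool using (true; false)
open import Data.Empty using (⊥; ⊥-elim)
open import Data.Fin using (Fin; zero; suc)
open import Data.List as List using (List; []; _∷_; _++_; drop)
open import Data.List.Membership.Propositional using (_∈_)
open import Data.List.Membership.Propositional.Properties using (∈-++⁺ˡ; ∈-++⁺ʳ; ∈-++⁻; ∈-lookup; ∈-map⁺; ∈-map⁻)
open import Data.List.Relation.Unary.Any as Any using (here; there)
open import Data.List.Relation.Unary.Any.Properties using (lookup-index)
open import Data.Nat using (ℕ; zero; suc; pred; _+_; _*_; _∸_; _≤_; _<_; _⊔_; z≤n; s≤s; _≟_)
open import Data.Nat.Properties
open import Data.Product using (∃; ∃-syntax; Σ-syntax; _×_; _,_; proj₁; proj₂)
open import Data.Sum using (_⊎_; inj₁; inj₂)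
open import Data.Unit using (⊤; tt)
open import Data.Vec using (Vec; []; _∷_; lookup; tabulate)
open import Data.Vec.Properties using (tabulate∘lookup)
open import Data.Vec.Relation.Binary.Pointwise.Inductive using ([]; _∷_)
open import Function.Bundles using (_⇔_; mk⇔; Equivalence)
open import Function.Construct.Composition using (_⇔-∘_)
open import Function.Construct.Symmetry using (⇔-sym)
open import Relation.Binary.Definitions using (tri<; tri≈; tri>)
import Relation.Binary.Construct.On as On
open import Relation.Binary.PropositionalEquality hiding (resp)
open import Relation.Nullary using (¬_; Dec; yes; no)
open import Relation.Nullary.Decidable using (decidable-stable)
open import Relation.Unary using (Pred; ∅)

open Equivalence using (to; from)

-- One base over a point yields one number, and this bounds a witness for the outer quantifier of a
-- two-quantifier statement but leaves the inner one open. The second family of kinds is there for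
-- the inner question: its bases must carry a stage by which a refutation has happened, if it ever
-- happens. Only upper bounds can be read off, so goodness is made upward closed in `t`, and being
-- refuted upward closed in the stage.
--
-- No relation of the language mentions the colour. It belongs to a position in `𝕄`, and embeddings
-- of one structure may choose different colours when its labels permit both; this freedom is what a
-- base must not have. The stage is part of the name of a component so that membership in `𝕄` is
-- decidable although labels are revealed over time.
--
-- The matrix R has to be decidable, but computations from `∅ ′` have no decidable record. Hence `t`
-- is a derivation whose negative oracle answers are taken on trust, and `d` a derivation over `∅`
-- that exposes one of them as false.

-- Pairing and programs

-- The successor of a pair along the anti-diagonals enumerated by ⟨_,_⟩.
step : ℕ × ℕ → ℕ × ℕ
step (zero  , y) = suc y , 0
step (suc x , y) = x , suc y

unpair : ℕ → ℕ × ℕ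
unpair zero    = 0 , 0
unpair (suc z) = step (unpair z)

π₁ π₂ : ℕ → ℕ
π₁ z = proj₁ (unpair z)
π₂ z = proj₂ (unpair z)

⟨⟩-step : ∀ p → ⟨ proj₁ (step p) , proj₂ (step p) ⟩ ≡ suc ⟨ proj₁ p , proj₂ p ⟩
⟨⟩-step (zero , y) = cong suc (begin
  y + 0 + triangle (y + 0) + 0 ≡⟨ +-identityʳ _ ⟩
  y + 0 + triangle (y + 0)     ≡⟨ cong (λ k → k + triangle k) (+-identityʳ y) ⟩
  y + triangle y               ≡⟨ +-comm y (triangle y) ⟩
  triangle y + y               ∎)
  where open ≡-Reasoning
⟨⟩-step (suc x , y) = begin
  triangle (x + suc y) + suc y   ≡⟨ +-suc (triangle (x + suc y)) y ⟩
  suc (triangle (x + suc y) + y) ≡⟨ cong (λ k → suc (triangle k + y)) (+-suc x y) ⟩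
  suc (triangle (suc (x + y)) + y) ∎
  where open ≡-Reasoning

⟨⟩-unpair : ∀ z → ⟨ π₁ z , π₂ z ⟩ ≡ z
⟨⟩-unpair zero    = refl
⟨⟩-unpair (suc z) = trans (⟨⟩-step (unpair z)) (cong suc (⟨⟩-unpair z))

n≤triangle : ∀ n → n ≤ triangle n
n≤triangle zero    = z≤n
n≤triangle (suc n) = m≤m+n (suc n) (triangle n)

proj₁≤⟨⟩ : ∀ x y → x ≤ ⟨ x , y ⟩
proj₁≤⟨⟩ x y = ≤-trans (m≤m+n x y) (≤-trans (n≤triangle (x + y)) (m≤m+n _ y))

proj₂≤⟨⟩ : ∀ x y → y ≤ ⟨ x , y ⟩
proj₂≤⟨⟩ x y = m≤n+m y (triangle (x + y))

-- Recursion is on the value `z`, because the predecessor of a pair in the anti-diagonal order need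
-- not be structurally smaller.
unpair-⟨⟩′ : ∀ z x y → ⟨ x , y ⟩ ≡ z → unpair z ≡ (x , y)
unpair-⟨⟩′ zero x y e with n≤0⇒n≡0 (subst (x ≤_) e (proj₁≤⟨⟩ x y))
                        | n≤0⇒n≡0 (subst (y ≤_) e (proj₂≤⟨⟩ x y))
... | refl | refl = refl
unpair-⟨⟩′ (suc z) x (suc y) e =
  cong step (unpair-⟨⟩′ z (suc x) y (suc-injective (trans (sym (⟨⟩-step (suc x , y))) e)))
unpair-⟨⟩′ (suc z) (suc x) zero e =
  cong step (unpair-⟨⟩′ z zero x (suc-injective (trans (sym (⟨⟩-step (zero , x))) e)))

π₁-⟨⟩ : ∀ x y → π₁ ⟨ x , y ⟩ ≡ x
π₁-⟨⟩ x y = cong proj₁ (unpair-⟨⟩′ _ x y refl)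

π₂-⟨⟩ : ∀ x y → π₂ ⟨ x , y ⟩ ≡ y
π₂-⟨⟩ x y = cong proj₂ (unpair-⟨⟩′ _ x y refl)

⟨⟩-injective : ∀ {x y x′ y′} → ⟨ x , y ⟩ ≡ ⟨ x′ , y′ ⟩ → x ≡ x′ × y ≡ y′
⟨⟩-injective {x} {y} {x′} {y′} e =
  trans (sym (π₁-⟨⟩ x y)) (trans (cong π₁ e) (π₁-⟨⟩ x′ y′)) ,
  trans (sym (π₂-⟨⟩ x y)) (trans (cong π₂ e) (π₂-⟨⟩ x′ y′))

π₁≤ : ∀ z → π₁ z ≤ z
π₁≤ z = subst (π₁ z ≤_) (⟨⟩-unpair z) (proj₁≤⟨⟩ (π₁ z) (π₂ z))

π₂≤ : ∀ z → π₂ z ≤ z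
π₂≤ z = subst (π₂ z ≤_) (⟨⟩-unpair z) (proj₂≤⟨⟩ (π₁ z) (π₂ z))

decode′ : ∀ b v → v ≤ b → ∃[ xs ] ⌈ xs ⌉ ≡ v
decode′ b       zero    _       = [] , refl
decode′ (suc b) (suc v) (s≤s l) with decode′ b (π₂ v) (≤-trans (π₂≤ v) l)
... | xs , e = π₁ v ∷ xs , cong suc (trans (cong ⟨ π₁ v ,_⟩ e) (⟨⟩-unpair v))

decode : ℕ → List ℕ
decode v = proj₁ (decode′ v v ≤-refl)

⌈decode⌉ : ∀ v → ⌈ decode v ⌉ ≡ v
⌈decode⌉ v = proj₂ (decode′ v v ≤-refl)

⌈⌉-injective : ∀ {xs ys} → ⌈ xs ⌉ ≡ ⌈ ys ⌉ → xs ≡ ys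
⌈⌉-injective {[]}     {[]}     e = refl
⌈⌉-injective {x ∷ xs} {y ∷ ys} e with ⟨⟩-injective {x} {⌈ xs ⌉} {y} {⌈ ys ⌉} (suc-injective e)
... | refl , e′ = cong (x ∷_) (⌈⌉-injective e′)

decode-⌈⌉ : ∀ xs → decode ⌈ xs ⌉ ≡ xs
decode-⌈⌉ xs = ⌈⌉-injective (⌈decode⌉ ⌈ xs ⌉)

∈⇒<⌈⌉ : ∀ {x xs} → x ∈ xs → x < ⌈ xs ⌉
∈⇒<⌈⌉ {xs = y ∷ ys} (here refl) = s≤s (proj₁≤⟨⟩ y ⌈ ys ⌉)
∈⇒<⌈⌉ {xs = y ∷ ys} (there x∈)  = m≤n⇒m≤1+n (≤-trans (∈⇒<⌈⌉ x∈) (proj₂≤⟨⟩ y ⌈ ys ⌉))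

module _ {S : Pred ℕ 0ℓ} where

  left⇓′ : ∀ z → S ⊢ leftᵖ [ z ]⇓ π₁ z
  left⇓′ z = subst (λ w → S ⊢ leftᵖ [ w ]⇓ π₁ z) (⟨⟩-unpair z) (left⇓ {x = π₁ z} {π₂ z})

  right⇓′ : ∀ z → S ⊢ rightᵖ [ z ]⇓ π₂ z
  right⇓′ z = subst (λ w → S ⊢ rightᵖ [ w ]⇓ π₂ z) (⟨⟩-unpair z) (right⇓ {x = π₁ z} {π₂ z})

  left⁻¹ : ∀ {z w} → S ⊢ leftᵖ [ z ]⇓ w → w ≡ π₁ z
  left⁻¹ (left⇓ {x} {y}) = sym (π₁-⟨⟩ x y)

  right⁻¹ : ∀ {z w} → S ⊢ rightᵖ [ z ]⇓ w → w ≡ π₂ z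
  right⁻¹ (right⇓ {x} {y}) = sym (π₂-⟨⟩ x y)

  -- The input in `rec0⇓` and `recS⇓` is a value of the function `⟨_,_⟩`, which unification cannot
  -- take apart. With a variable `z` and an equation, both rules can be matched.
  rec⁻¹ : ∀ {p q z w} → S ⊢ recᵖ p q [ z ]⇓ w → ∀ {x n} → z ≡ ⟨ x , n ⟩ →
          (n ≡ 0 × S ⊢ p [ x ]⇓ w) ⊎
          (∃[ m ] ∃[ y ] n ≡ suc m × S ⊢ recᵖ p q [ ⟨ x , m ⟩ ]⇓ y × S ⊢ q [ ⟨ x , ⟨ m , y ⟩ ⟩ ]⇓ w)
  rec⁻¹ (rec0⇓ {x = x₀} d) {x} {n} e with ⟨⟩-injective {x₀} {0} {x} {n} e
  ... | refl , refl = inj₁ (refl , d)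
  rec⁻¹ (recS⇓ {x = x₀} {n = m} d d′) {x} {n} e with ⟨⟩-injective {x₀} {suc m} {x} {n} e
  ... | refl , refl = inj₂ (m , _ , refl , d , d′)

  ⇓-deterministic : ∀ {p x y z} → S ⊢ p [ x ]⇓ y → S ⊢ p [ x ]⇓ z → y ≡ z
  ⇓-deterministic zero⇓ zero⇓ = refl
  ⇓-deterministic succ⇓ succ⇓ = refl
  ⇓-deterministic (left⇓ {x} {y}) d = trans (sym (π₁-⟨⟩ x y)) (sym (left⁻¹ d))
  ⇓-deterministic (right⇓ {x} {y}) d = trans (sym (π₂-⟨⟩ x y)) (sym (right⁻¹ d))
  ⇓-deterministic (yes⇓ _) (yes⇓ _) = refl
  ⇓-deterministic (yes⇓ s) (no⇓ ¬s) = ⊥-elim (¬s s)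
  ⇓-deterministic (no⇓ ¬s) (yes⇓ s) = ⊥-elim (¬s s)
  ⇓-deterministic (no⇓ _) (no⇓ _) = refl
  ⇓-deterministic (pair⇓ d e) (pair⇓ d′ e′) =
    cong₂ ⟨_,_⟩ (⇓-deterministic d d′) (⇓-deterministic e e′)
  ⇓-deterministic (comp⇓ d e) (comp⇓ d′ e′) with refl ← ⇓-deterministic d d′ =
    ⇓-deterministic e e′
  ⇓-deterministic (rec0⇓ {x = x} d) d′ with rec⁻¹ d′ {x} {0} refl
  ... | inj₁ (_ , e) = ⇓-deterministic d e
  ⇓-deterministic (recS⇓ {x = x} {n = n} d e) d′ with rec⁻¹ d′ {x} {suc n} refl
  ... | inj₂ (_ , _ , refl , f , g) with refl ← ⇓-deterministic d f = ⇓-deterministic e g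
  ⇓-deterministic (min⇓ {n = n} d b) (min⇓ {n = m} d′ b′) with <-cmp n m
  ... | tri≈ _ n≡m _ = n≡m
  ... | tri< n<m _ _ = ⊥-elim (0≢1+n (⇓-deterministic d (proj₂ (b′ n n<m))))
  ... | tri> _ _ m<n = ⊥-elim (1+n≢0 (⇓-deterministic (proj₂ (b m m<n)) d′))

idᵖ : Program
idᵖ = pairᵖ leftᵖ rightᵖ

id⇓ : ∀ {S : Pred ℕ 0ℓ} x → S ⊢ idᵖ [ x ]⇓ x
id⇓ {S} x = subst (S ⊢ idᵖ [ x ]⇓_) (⟨⟩-unpair x) (pair⇓ (left⇓′ x) (right⇓′ x))

constᵖ : ℕ → Program
constᵖ zero    = zeroᵖ
constᵖ (suc k) = compᵖ succᵖ (constᵖ k)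

const⇓ : ∀ {S : Pred ℕ 0ℓ} k {x} → S ⊢ constᵖ k [ x ]⇓ k
const⇓ zero    = zero⇓
const⇓ (suc k) = comp⇓ (const⇓ k) succ⇓

-- A language of primitive recursive terms and decidable formulas

-- With `O` empty a term asks no questions and so runs with every oracle; with `O` the unit type it
-- may ask. `call` takes the place of weakening and substitution.
data Tm (O : Set) (n : ℕ) : Set where
  var         : Fin n → Tm O n
  lit         : ℕ → Tm O n
  sucᵗ fst snd : Tm O n → Tm O n
  pair        : Tm O n → Tm O n → Tm O n
  -- In the step, variable 0 is the accumulator and variable 1 the index.
  natrec      : Tm O n → Tm O (2 + n) → Tm O n → Tm O n
  ask         : O → Tm O n → Tm O n
  call        : ∀ {k} → Tm O k → Vec (Tm O n) k → Tm O n

iter : ℕ → (ℕ → ℕ → ℕ) → ℕ → ℕ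
iter b s zero    = b
iter b s (suc k) = s k (iter b s k)

encode : ∀ {n} → Vec ℕ n → ℕ
encode []      = 0
encode (x ∷ ρ) = ⟨ x , encode ρ ⟩

varᵖ : ∀ {n} → Fin n → Program
varᵖ zero    = leftᵖ
varᵖ (suc i) = compᵖ (varᵖ i) rightᵖ

module _ {O : Set} where
  mutual
    compile : ∀ {n} → Tm O n → Program
    compile (var i)        = varᵖ i
    compile (lit k)        = constᵖ k
    compile (sucᵗ t)       = compᵖ succᵖ (compile t)
    compile (fst t)        = compᵖ leftᵖ (compile t)
    compile (snd t)        = compᵖ rightᵖ (compile t)
    compile (pair t u)     = pairᵖ (compile t) (compile u)
    compile (natrec b s c) =
      compᵖ (recᵖ (compile b)
                  (compᵖ (compile s)
                         (pairᵖ (compᵖ rightᵖ rightᵖ) (pairᵖ (compᵖ leftᵖ rightᵖ) leftᵖ))))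
            (pairᵖ idᵖ (compile c))
    compile (ask _ t)      = compᵖ oracleᵖ (compile t)
    compile (call t us)    = compᵖ (compile t) (compiles us)

    compiles : ∀ {n k} → Vec (Tm O n) k → Program
    compiles []       = zeroᵖ
    compiles (t ∷ ts) = pairᵖ (compile t) (compiles ts)

-- Truth values are coded so that 0 is true: then ∧ is +, ∨ is *.
data Fm (O : Set) (n : ℕ) : Set where
  _≐ᶠ_    : Tm O n → Tm O n → Fm O n
  _∧_ _∨_ : Fm O n → Fm O n → Fm O n
  neg     : Fm O n → Fm O n
  ex all  : Tm O n → Fm O (suc n) → Fm O n
  at      : ∀ {k} → Fm O k → Vec (Tm O n) k → Fm O n

infix  7 _≐ᶠ_
infixr 6 _∧_
infixr 5 _∨_

pattern v0 = var zero
pattern v1 = var (suc zero)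
pattern v2 = var (suc (suc zero))
pattern v3 = var (suc (suc (suc zero)))

module _ {O : Set} where

  predᵗ notᵗ : ∀ {n} → Tm O n → Tm O n
  predᵗ t = call (natrec (lit 0) v1 v0) (t ∷ [])
  notᵗ  t = call (natrec (lit 1) (lit 0) v0) (t ∷ [])

  _+ᵗ_ _∸ᵗ_ _*ᵗ_ : ∀ {n} → Tm O n → Tm O n → Tm O n
  t +ᵗ u = call (natrec v0 (sucᵗ v0) v1) (t ∷ u ∷ [])
  t ∸ᵗ u = call (natrec v0 (predᵗ v0) v1) (t ∷ u ∷ [])
  t *ᵗ u = call (natrec (lit 0) (v0 +ᵗ v2) v1) (t ∷ u ∷ [])

  below : ∀ {n} → Vec (Tm O (2 + n)) n
  below = tabulate (λ i → var (suc (suc i)))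

  test : ∀ {n} → Fm O n → Tm O n
  instantiate exStep allStep : ∀ {n} → Fm O (suc n) → Tm O (2 + n)

  test (t ≐ᶠ u)  = (t ∸ᵗ u) +ᵗ (u ∸ᵗ t)
  test (φ ∧ ψ)   = test φ +ᵗ test ψ
  test (φ ∨ ψ)   = test φ *ᵗ test ψ
  test (neg φ)   = notᵗ (test φ)
  test (ex t φ)  = natrec (lit 1) (exStep φ) t
  test (all t φ) = natrec (lit 0) (allStep φ) t
  test (at φ ts) = call (test φ) ts

  instantiate φ = call (test φ) (v1 ∷ below)
  exStep φ      = v0 *ᵗ instantiate φ
  allStep φ     = v0 +ᵗ instantiate φ

  -- A false test has a nonzero value, so the step runs at least once, and it ignores the
  -- accumulator and the index.
  if_then_else_ : ∀ {n} → Fm O n → Tm O n → Tm O n → Tm O n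
  if φ then t else u = natrec t (call u below) (test φ)

module Semantics (O : Set) (o : ℕ → ℕ) where
  mutual
    ⟦_⟧ : ∀ {n} → Tm O n → Vec ℕ n → ℕ
    ⟦ var i ⟧ ρ        = lookup ρ i
    ⟦ lit k ⟧ ρ        = k
    ⟦ sucᵗ t ⟧ ρ       = suc (⟦ t ⟧ ρ)
    ⟦ fst t ⟧ ρ        = π₁ (⟦ t ⟧ ρ)
    ⟦ snd t ⟧ ρ        = π₂ (⟦ t ⟧ ρ)
    ⟦ pair t u ⟧ ρ     = ⟨ ⟦ t ⟧ ρ , ⟦ u ⟧ ρ ⟩
    ⟦ natrec b s c ⟧ ρ = iter (⟦ b ⟧ ρ) (λ k a → ⟦ s ⟧ (a ∷ k ∷ ρ)) (⟦ c ⟧ ρ)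
    ⟦ ask _ t ⟧ ρ      = o (⟦ t ⟧ ρ)
    ⟦ call t us ⟧ ρ    = ⟦ t ⟧ (⟦ us ⟧s ρ)

    ⟦_⟧s : ∀ {n k} → Vec (Tm O n) k → Vec ℕ n → Vec ℕ k
    ⟦ [] ⟧s     ρ = []
    ⟦ t ∷ ts ⟧s ρ = ⟦ t ⟧ ρ ∷ ⟦ ts ⟧s ρ

  ⟦_⟧ᵢ : ∀ {n} → Tm O (2 + n) → ℕ → ℕ → Vec ℕ n → ℕ
  ⟦ s ⟧ᵢ b k ρ = iter b (λ k a → ⟦ s ⟧ (a ∷ k ∷ ρ)) k

  ⟪_⟫ : ∀ {n} → Fm O n → Vec ℕ n → Set
  ⟪ t ≐ᶠ u ⟫ ρ  = ⟦ t ⟧ ρ ≡ ⟦ u ⟧ ρ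
  ⟪ φ ∧ ψ ⟫ ρ   = ⟪ φ ⟫ ρ × ⟪ ψ ⟫ ρ
  ⟪ φ ∨ ψ ⟫ ρ   = ⟪ φ ⟫ ρ ⊎ ⟪ ψ ⟫ ρ
  ⟪ neg φ ⟫ ρ   = ¬ ⟪ φ ⟫ ρ
  ⟪ ex t φ ⟫ ρ  = ∃[ k ] k < ⟦ t ⟧ ρ × ⟪ φ ⟫ (k ∷ ρ)
  ⟪ all t φ ⟫ ρ = ∀ k → k < ⟦ t ⟧ ρ → ⟪ φ ⟫ (k ∷ ρ)
  ⟪ at φ ts ⟫ ρ = ⟪ φ ⟫ (⟦ ts ⟧s ρ)

  module _ {S : Pred ℕ 0ℓ} (oracle : O → ∀ x → S ⊢ oracleᵖ [ x ]⇓ o x) where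

    var⇓ : ∀ {n} (i : Fin n) ρ → S ⊢ varᵖ i [ encode ρ ]⇓ lookup ρ i
    var⇓ zero    (x ∷ ρ) = left⇓ {x = x} {encode ρ}
    var⇓ (suc i) (x ∷ ρ) = comp⇓ (right⇓ {x = x} {encode ρ}) (var⇓ i ρ)

    mutual
      compile⇓ : ∀ {n} (t : Tm O n) ρ → S ⊢ compile t [ encode ρ ]⇓ ⟦ t ⟧ ρ
      compile⇓ (var i) ρ = var⇓ i ρ
      compile⇓ (lit k) ρ = const⇓ k
      compile⇓ (sucᵗ t) ρ = comp⇓ (compile⇓ t ρ) succ⇓
      compile⇓ (fst t) ρ = comp⇓ (compile⇓ t ρ) (left⇓′ _)
      compile⇓ (snd t) ρ = comp⇓ (compile⇓ t ρ) (right⇓′ _)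
      compile⇓ (pair t u) ρ = pair⇓ (compile⇓ t ρ) (compile⇓ u ρ)
      compile⇓ (natrec b s c) ρ = comp⇓ (pair⇓ (id⇓ _) (compile⇓ c ρ)) (rec⇓ (⟦ c ⟧ ρ))
        where
        rec⇓ : ∀ k → S ⊢ recᵖ (compile b) _ [ ⟨ encode ρ , k ⟩ ]⇓
                         iter (⟦ b ⟧ ρ) (λ k a → ⟦ s ⟧ (a ∷ k ∷ ρ)) k
        rec⇓ zero    = rec0⇓ {x = encode ρ} (compile⇓ b ρ)
        rec⇓ (suc k) = recS⇓ {x = encode ρ} {n = k} (rec⇓ k)
          (comp⇓ (pair⇓ (comp⇓ (right⇓ {x = x}) (right⇓ {x = k}))
                        (pair⇓ (comp⇓ (right⇓ {x = x}) (left⇓ {x = k} {a})) (left⇓ {x = x} {⟨ k , a ⟩})))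
                 (compile⇓ s (a ∷ k ∷ ρ)))
          where
          x = encode ρ
          a = iter (⟦ b ⟧ ρ) (λ k a → ⟦ s ⟧ (a ∷ k ∷ ρ)) k
      compile⇓ (ask i t) ρ = comp⇓ (compile⇓ t ρ) (oracle i _)
      compile⇓ (call t us) ρ = comp⇓ (compiles⇓ us ρ) (compile⇓ t (⟦ us ⟧s ρ))

      compiles⇓ : ∀ {n k} (ts : Vec (Tm O n) k) ρ → S ⊢ compiles ts [ encode ρ ]⇓ encode (⟦ ts ⟧s ρ)
      compiles⇓ []       ρ = zero⇓
      compiles⇓ (t ∷ ts) ρ = pair⇓ (compile⇓ t ρ) (compiles⇓ ts ρ)

  pred-spec : ∀ x → iter 0 (λ k _ → k) x ≡ pred x
  pred-spec zero    = refl
  pred-spec (suc x) = refl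

  ⟦+⟧ : ∀ {n} (t u : Tm O n) ρ → ⟦ t +ᵗ u ⟧ ρ ≡ ⟦ t ⟧ ρ + ⟦ u ⟧ ρ
  ⟦+⟧ t u ρ = go (⟦ t ⟧ ρ) (⟦ u ⟧ ρ)
    where
    go : ∀ x y → iter x (λ _ a → suc a) y ≡ x + y
    go x zero    = sym (+-identityʳ x)
    go x (suc y) = trans (cong suc (go x y)) (sym (+-suc x y))

  ⟦∸⟧ : ∀ {n} (t u : Tm O n) ρ → ⟦ t ∸ᵗ u ⟧ ρ ≡ ⟦ t ⟧ ρ ∸ ⟦ u ⟧ ρ
  ⟦∸⟧ t u ρ = go (⟦ t ⟧ ρ) (⟦ u ⟧ ρ)
    where
    go : ∀ x y → iter x (λ _ a → iter 0 (λ k _ → k) a) y ≡ x ∸ y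
    go x zero    = refl
    go x (suc y) = trans (pred-spec (iter x (λ _ a → iter 0 (λ k _ → k) a) y))
                         (trans (cong pred (go x y)) (pred[m∸n]≡m∸[1+n] x y))

  ⟦*⟧ : ∀ {n} (t u : Tm O n) ρ → ⟦ t *ᵗ u ⟧ ρ ≡ ⟦ u ⟧ ρ * ⟦ t ⟧ ρ
  ⟦*⟧ t u ρ = go (⟦ t ⟧ ρ) (⟦ u ⟧ ρ)
    where
    go : ∀ x y → ⟦ v0 *ᵗ v1 ⟧ (x ∷ y ∷ []) ≡ y * x
    go x zero    = refl
    go x (suc y) = trans (⟦+⟧ v0 v1 (⟦ v0 *ᵗ v1 ⟧ (x ∷ y ∷ []) ∷ x ∷ []))
                         (trans (cong (_+ x) (go x y)) (+-comm (y * x) x))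

  below-spec : ∀ {n} a k (ρ : Vec ℕ n) → ⟦ below ⟧s (a ∷ k ∷ ρ) ≡ ρ
  below-spec a k ρ = trans (tabulates (λ i → var (suc (suc i)))) (tabulate∘lookup ρ)
    where
    tabulates : ∀ {m n} (f : Fin m → Tm O n) {σ} → ⟦ tabulate f ⟧s σ ≡ tabulate (λ i → ⟦ f i ⟧ σ)
    tabulates {zero}  f = refl
    tabulates {suc m} f = cong (⟦ f zero ⟧ _ ∷_) (tabulates (λ i → f (suc i)))

  instantiate-spec : ∀ {n} (φ : Fm O (suc n)) a k ρ →
                     ⟦ instantiate φ ⟧ (a ∷ k ∷ ρ) ≡ ⟦ test φ ⟧ (k ∷ ρ)
  instantiate-spec φ a k ρ = cong (λ σ → ⟦ test φ ⟧ (k ∷ σ)) (below-spec a k ρ)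

  ⟦≐⟧ : ∀ {n} (t u : Tm O n) ρ → ⟦ test (t ≐ᶠ u) ⟧ ρ ≡ (⟦ t ⟧ ρ ∸ ⟦ u ⟧ ρ) + (⟦ u ⟧ ρ ∸ ⟦ t ⟧ ρ)
  ⟦≐⟧ t u ρ = trans (⟦+⟧ (t ∸ᵗ u) (u ∸ᵗ t) ρ) (cong₂ _+_ (⟦∸⟧ t u ρ) (⟦∸⟧ u t ρ))

  mutual
    test⇒ : ∀ {n} (φ : Fm O n) ρ → ⟦ test φ ⟧ ρ ≡ 0 → ⟪ φ ⟫ ρ
    test⇒ (t ≐ᶠ u) ρ e =
      ≤-antisym (m∸n≡0⇒m≤n (m+n≡0⇒m≡0 _ e′)) (m∸n≡0⇒m≤n (m+n≡0⇒n≡0 (⟦ t ⟧ ρ ∸ ⟦ u ⟧ ρ) e′))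
      where e′ = trans (sym (⟦≐⟧ t u ρ)) e
    test⇒ (φ ∧ ψ) ρ e = test⇒ φ ρ (m+n≡0⇒m≡0 _ e′) , test⇒ ψ ρ (m+n≡0⇒n≡0 (⟦ test φ ⟧ ρ) e′)
      where e′ = trans (sym (⟦+⟧ (test φ) (test ψ) ρ)) e
    test⇒ (φ ∨ ψ) ρ e
      with m*n≡0⇒m≡0∨n≡0 (⟦ test ψ ⟧ ρ) (trans (sym (⟦*⟧ (test φ) (test ψ) ρ)) e)
    ... | inj₁ e′ = inj₂ (test⇒ ψ ρ e′)
    ... | inj₂ e′ = inj₁ (test⇒ φ ρ e′)
    test⇒ (neg φ) ρ e h = 1+n≢0 (trans (sym (cong (iter 1 (λ _ _ → 0)) (test⇐ φ ρ h))) e)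
    test⇒ (ex t φ) ρ e = go (⟦ t ⟧ ρ) e
      where
      go : ∀ n → ⟦ exStep φ ⟧ᵢ 1 n ρ ≡ 0 → ∃[ k ] k < n × ⟪ φ ⟫ (k ∷ ρ)
      go (suc n) e with m*n≡0⇒m≡0∨n≡0 (⟦ instantiate φ ⟧ σ) (trans (sym (⟦*⟧ v0 (instantiate φ) σ)) e)
        where σ = ⟦ exStep φ ⟧ᵢ 1 n ρ ∷ n ∷ ρ
      ... | inj₁ e′ = n , ≤-refl , test⇒ φ (n ∷ ρ) (trans (sym (instantiate-spec φ _ n ρ)) e′)
      ... | inj₂ e′ with go n e′
      ... | k , k<n , h = k , m<n⇒m<1+n k<n , h
    test⇒ (all t φ) ρ e = go (⟦ t ⟧ ρ) e
      where
      go : ∀ n → ⟦ allStep φ ⟧ᵢ 0 n ρ ≡ 0 → ∀ k → k < n → ⟪ φ ⟫ (k ∷ ρ)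
      go (suc n) e k k<1+n with m≤n⇒m<n∨m≡n (≤-pred k<1+n)
        | trans (sym (⟦+⟧ v0 (instantiate φ) (⟦ allStep φ ⟧ᵢ 0 n ρ ∷ n ∷ ρ))) e
      ... | inj₁ k<n  | e′ = go n (m+n≡0⇒m≡0 _ e′) k k<n
      ... | inj₂ refl | e′ = test⇒ φ (k ∷ ρ)
        (trans (sym (instantiate-spec φ _ k ρ)) (m+n≡0⇒n≡0 (⟦ allStep φ ⟧ᵢ 0 k ρ) e′))
    test⇒ (at φ ts) ρ e = test⇒ φ (⟦ ts ⟧s ρ) e

    test⇐ : ∀ {n} (φ : Fm O n) ρ → ⟪ φ ⟫ ρ → ⟦ test φ ⟧ ρ ≡ 0
    test⇐ (t ≐ᶠ u) ρ e = trans (⟦≐⟧ t u ρ)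
      (cong₂ _+_ (m≤n⇒m∸n≡0 (≤-reflexive e)) (m≤n⇒m∸n≡0 (≤-reflexive (sym e))))
    test⇐ (φ ∧ ψ) ρ (h , h′) =
      trans (⟦+⟧ (test φ) (test ψ) ρ) (cong₂ _+_ (test⇐ φ ρ h) (test⇐ ψ ρ h′))
    test⇐ (φ ∨ ψ) ρ (inj₁ h) = trans (⟦*⟧ (test φ) (test ψ) ρ)
      (trans (cong (⟦ test ψ ⟧ ρ *_) (test⇐ φ ρ h)) (*-zeroʳ (⟦ test ψ ⟧ ρ)))
    test⇐ (φ ∨ ψ) ρ (inj₂ h) =
      trans (⟦*⟧ (test φ) (test ψ) ρ) (cong (_* ⟦ test φ ⟧ ρ) (test⇐ ψ ρ h))
    test⇐ (neg φ) ρ h with ⟦ test φ ⟧ ρ in e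
    ... | zero  = ⊥-elim (h (test⇒ φ ρ e))
    ... | suc _ = refl
    test⇐ (ex t φ) ρ (k , k<n , h) = go (⟦ t ⟧ ρ) k<n
      where
      go : ∀ n → k < n → ⟦ exStep φ ⟧ᵢ 1 n ρ ≡ 0
      go (suc n) k<1+n with m≤n⇒m<n∨m≡n (≤-pred k<1+n)
        | ⟦*⟧ v0 (instantiate φ) (⟦ exStep φ ⟧ᵢ 1 n ρ ∷ n ∷ ρ)
      ... | inj₁ k<n  | e = trans e (trans (cong (⟦ instantiate φ ⟧ σ *_) (go n k<n))
                                           (*-zeroʳ (⟦ instantiate φ ⟧ σ)))
        where σ = ⟦ exStep φ ⟧ᵢ 1 n ρ ∷ n ∷ ρ
      ... | inj₂ refl | e = trans e (cong (_* ⟦ exStep φ ⟧ᵢ 1 k ρ)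
                                      (trans (instantiate-spec φ _ k ρ) (test⇐ φ (k ∷ ρ) h)))
    test⇐ (all t φ) ρ h = go (⟦ t ⟧ ρ) h
      where
      go : ∀ n → (∀ k → k < n → ⟪ φ ⟫ (k ∷ ρ)) → ⟦ allStep φ ⟧ᵢ 0 n ρ ≡ 0
      go zero    h = refl
      go (suc n) h = trans (⟦+⟧ v0 (instantiate φ) (⟦ allStep φ ⟧ᵢ 0 n ρ ∷ n ∷ ρ))
        (cong₂ _+_ (go n (λ k k<n → h k (m<n⇒m<1+n k<n)))
          (trans (instantiate-spec φ (⟦ allStep φ ⟧ᵢ 0 n ρ) n ρ) (test⇐ φ (n ∷ ρ) (h n ≤-refl))))
    test⇐ (at φ ts) ρ h = test⇐ φ (⟦ ts ⟧s ρ) h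

  holds? : ∀ {n} (φ : Fm O n) ρ → Dec (⟪ φ ⟫ ρ)
  holds? φ ρ with ⟦ test φ ⟧ ρ in e
  ... | zero  = yes (test⇒ φ ρ e)
  ... | suc _ = no (λ h → 1+n≢0 (trans (sym e) (test⇐ φ ρ h)))

  if-true : ∀ {n} (φ : Fm O n) t u ρ → ⟪ φ ⟫ ρ → ⟦ if φ then t else u ⟧ ρ ≡ ⟦ t ⟧ ρ
  if-true φ t u ρ h = cong (iter (⟦ t ⟧ ρ) _) (test⇐ φ ρ h)

  if-false : ∀ {n} (φ : Fm O n) t u ρ → ¬ ⟪ φ ⟫ ρ → ⟦ if φ then t else u ⟧ ρ ≡ ⟦ u ⟧ ρ
  if-false φ t u ρ h with ⟦ test φ ⟧ ρ in e
  ... | zero  = ⊥-elim (h (test⇒ φ ρ e))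
  ... | suc k = cong ⟦ u ⟧ (below-spec (iter (⟦ t ⟧ ρ) (λ k a → ⟦ call u below ⟧ (a ∷ k ∷ ρ)) k) k ρ)

-- Coded derivations and the normal form of the double jump

shape : ℕ → Program → Program → Program → Program
shape 0 _ _ _ = zeroᵖ
shape 1 _ _ _ = succᵖ
shape 2 _ _ _ = leftᵖ
shape 3 _ _ _ = rightᵖ
shape 4 _ _ _ = oracleᵖ
shape 5 p q _ = pairᵖ p q
shape 6 p q _ = compᵖ p q
shape 7 p q _ = recᵖ p q
shape _ _ _ r = minᵖ r

-- A left inverse of `⌜_⌝` once the fuel `f` reaches the depth of the program. It gives injectivity
-- of the coding without comparing constructors in pairs.
parse : ℕ → ℕ → Program
parse zero    c = zeroᵖ
parse (suc f) c = shape (π₁ c) (parse f (π₁ (π₂ c))) (parse f (π₂ (π₂ c))) (parse f (π₂ c))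

depth : Program → ℕ
depth (pairᵖ p q) = suc (depth p ⊔ depth q)
depth (compᵖ p q) = suc (depth p ⊔ depth q)
depth (recᵖ p q)  = suc (depth p ⊔ depth q)
depth (minᵖ p)    = suc (depth p)
depth _           = 1

parse-step : ∀ f t c → parse (suc f) ⟨ t , c ⟩ ≡
             shape t (parse f (π₁ c)) (parse f (π₂ c)) (parse f c)
parse-step f t c = cong₂ (λ t c → shape t (parse f (π₁ c)) (parse f (π₂ c)) (parse f c))
                         (π₁-⟨⟩ t c) (π₂-⟨⟩ t c)

parse-⌜⌝ : ∀ f p → depth p ≤ f → parse f ⌜ p ⌝ ≡ p
parse-⌜⌝₂ : ∀ f p q → depth p ⊔ depth q ≤ f → ∀ t →
            parse (suc f) ⟨ t , ⟨ ⌜ p ⌝ , ⌜ q ⌝ ⟩ ⟩ ≡ shape t p q (parse f ⟨ ⌜ p ⌝ , ⌜ q ⌝ ⟩)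
parse-⌜⌝₂ f p q l t = trans (parse-step f t ⟨ ⌜ p ⌝ , ⌜ q ⌝ ⟩)
  (cong₂ (λ p′ q′ → shape t p′ q′ (parse f ⟨ ⌜ p ⌝ , ⌜ q ⌝ ⟩))
    (trans (cong (parse f) (π₁-⟨⟩ ⌜ p ⌝ ⌜ q ⌝)) (parse-⌜⌝ f p (≤-trans (m≤m⊔n (depth p) (depth q)) l)))
    (trans (cong (parse f) (π₂-⟨⟩ ⌜ p ⌝ ⌜ q ⌝)) (parse-⌜⌝ f q (≤-trans (m≤n⊔m (depth p) (depth q)) l))))

parse-⌜⌝ (suc f) zeroᵖ       l       = parse-step f 0 0
parse-⌜⌝ (suc f) succᵖ       l       = parse-step f 1 0
parse-⌜⌝ (suc f) leftᵖ       l       = parse-step f 2 0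
parse-⌜⌝ (suc f) rightᵖ      l       = parse-step f 3 0
parse-⌜⌝ (suc f) oracleᵖ     l       = parse-step f 4 0
parse-⌜⌝ (suc f) (pairᵖ p q) (s≤s l) = parse-⌜⌝₂ f p q l 5
parse-⌜⌝ (suc f) (compᵖ p q) (s≤s l) = parse-⌜⌝₂ f p q l 6
parse-⌜⌝ (suc f) (recᵖ p q)  (s≤s l) = parse-⌜⌝₂ f p q l 7
parse-⌜⌝ (suc f) (minᵖ p)    (s≤s l) = trans (parse-step f 8 ⌜ p ⌝) (cong minᵖ (parse-⌜⌝ f p l))

⌜⌝-injective : ∀ p q → ⌜ p ⌝ ≡ ⌜ q ⌝ → p ≡ q
⌜⌝-injective p q e = trans (sym (parse-⌜⌝ d p (m≤m+n (depth p) (depth q))))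
                     (trans (cong (parse d) e) (parse-⌜⌝ d q (m≤n+m (depth q) (depth p))))
  where d = depth p + depth q

-- Membership in coded lists

drop-tail : ∀ {x : ℕ} {ys} k xs → drop k xs ≡ x ∷ ys → drop (suc k) xs ≡ ys
drop-tail zero    (x ∷ xs) refl = refl
drop-tail (suc k) (x ∷ xs) e    = drop-tail k xs e

drop-[] : ∀ k (xs : List ℕ) → drop k xs ≡ [] → drop (suc k) xs ≡ []
drop-[] zero    []       e = refl
drop-[] (suc k) []       e = refl
drop-[] (suc k) (x ∷ xs) e = drop-[] k xs e

drop⇒∈ : ∀ {x : ℕ} {ys} k xs → drop k xs ≡ x ∷ ys → x ∈ xs
drop⇒∈ zero    (x ∷ xs) refl = here refl
drop⇒∈ (suc k) (x ∷ xs) e    = there (drop⇒∈ k xs e)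

∈⇒drop : ∀ {x : ℕ} {xs} → x ∈ xs → ∃[ k ] ∃[ ys ] k < ⌈ xs ⌉ × drop k xs ≡ x ∷ ys
∈⇒drop {xs = y ∷ ys} (here refl) = 0 , ys , s≤s z≤n , refl
∈⇒drop {xs = y ∷ ys} (there x∈) with ∈⇒drop x∈
... | k , zs , k< , e = suc k , zs , s≤s (≤-trans k< (proj₂≤⟨⟩ y ⌈ ys ⌉)) , e

module _ {O : Set} where

  head tail : ∀ {n} → Tm O n → Tm O n
  head t = fst (predᵗ t)
  tail t = snd (predᵗ t)

  dropᵗ : ∀ {n} → Tm O n → Tm O n → Tm O n
  dropᵗ t k = call (natrec v0 (tail v0) v1) (t ∷ k ∷ [])

  opaque
    -- The code of a list exceeds its length and hence bounds the position sought.
    memberF : Fm O 2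
    memberF = ex v1 (dropᵗ v2 v0 ≐ᶠ sucᵗ (pair v1 (tail (dropᵗ v2 v0))))

    tailsF : Fm O 2 → Fm O 1
    tailsF φ = all v0 (dropᵗ v1 v0 ≐ᶠ lit 0 ∨ at φ (head (dropᵗ v1 v0) ∷ tail (dropᵗ v1 v0) ∷ []))

  _∈ᶠ_ : ∀ {n} → Tm O n → Tm O n → Fm O n
  t ∈ᶠ l = at memberF (t ∷ l ∷ [])

  -- φ relates each entry of the list to the entries after it.
  tails : ∀ {n} → Fm O 2 → Tm O n → Fm O n
  tails φ l = at (tailsF φ) (l ∷ [])

module ListSemantics (O : Set) (o : ℕ → ℕ) where
  open Semantics O o

  ⟦drop⟧ : ∀ xs k → ⟦ dropᵗ v0 v1 ⟧ (⌈ xs ⌉ ∷ k ∷ []) ≡ ⌈ drop k xs ⌉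
  ⟦drop⟧ xs zero = refl
  ⟦drop⟧ xs (suc k) with drop k xs in e
                       | trans (cong (λ v → π₂ (⟦ predᵗ v0 ⟧ (v ∷ []))) (⟦drop⟧ xs k)) refl
  -- Past the end the tail stays empty, because `pred 0` and `π₂ 0` are 0.
  ... | []     | e′ = trans e′ (cong ⌈_⌉ (sym (drop-[] k xs e)))
  ... | y ∷ ys | e′ = trans e′ (trans (π₂-⟨⟩ y ⌈ ys ⌉) (cong ⌈_⌉ (sym (drop-tail k xs e))))

  infix 4 _∈ᶜ_
  _∈ᶜ_ : ℕ → ℕ → Set
  x ∈ᶜ v = ⟪ v0 ∈ᶠ v1 ⟫ (x ∷ v ∷ [])

  opaque
    unfolding memberF

    ∈ᶜ⇒∈ : ∀ {x} xs → x ∈ᶜ ⌈ xs ⌉ → x ∈ xs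
    ∈ᶜ⇒∈ {x} xs (k , _ , e) with drop k xs in e₁ | trans (sym (⟦drop⟧ xs k)) e
    ... | y ∷ ys | e₂ = drop⇒∈ k xs (trans e₁ (cong (_∷ ys)
      (proj₁ (⟨⟩-injective {y} {⌈ ys ⌉} {x} (suc-injective e₂)))))

    ∈⇒∈ᶜ : ∀ {x xs} → x ∈ xs → x ∈ᶜ ⌈ xs ⌉
    ∈⇒∈ᶜ {x} {xs} x∈ with ∈⇒drop x∈
    ... | k , ys , k< , e = k , k< , trans e₁ (cong (λ t → suc ⟨ x , t ⟩)
        (sym (trans (cong (λ v → π₂ (⟦ predᵗ v0 ⟧ (v ∷ []))) e₁) (π₂-⟨⟩ x ⌈ ys ⌉))))
      where
      e₁ : ⟦ dropᵗ v0 v1 ⟧ (⌈ xs ⌉ ∷ k ∷ []) ≡ suc ⟨ x , ⌈ ys ⌉ ⟩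
      e₁ = trans (⟦drop⟧ xs k) (cong ⌈_⌉ e)

  module _ (φ : Fm O 2) where

    Tails : List ℕ → Set
    Tails []       = ⊤
    Tails (x ∷ xs) = ⟪ φ ⟫ (x ∷ ⌈ xs ⌉ ∷ []) × Tails xs

    Split : ℕ → Set
    Split v = v ≡ 0 ⊎ ⟪ φ ⟫ (π₁ (⟦ predᵗ v0 ⟧ (v ∷ [])) ∷ π₂ (⟦ predᵗ v0 ⟧ (v ∷ [])) ∷ [])

    tails⇒ : ∀ xs → (∀ k → k < ⌈ xs ⌉ → Split ⌈ drop k xs ⌉) → Tails xs
    tails⇒ []       h = tt
    tails⇒ (x ∷ xs) h with h 0 (s≤s z≤n)
    ... | inj₂ h₀ = subst₂ (λ y v → ⟪ φ ⟫ (y ∷ v ∷ [])) (π₁-⟨⟩ x ⌈ xs ⌉) (π₂-⟨⟩ x ⌈ xs ⌉) h₀ ,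
                    tails⇒ xs (λ k k< → h (suc k) (s≤s (≤-trans k< (proj₂≤⟨⟩ x ⌈ xs ⌉))))

    tails⇐ : ∀ xs → Tails xs → ∀ k → Split ⌈ drop k xs ⌉
    tails⇐ []       h       zero    = inj₁ refl
    tails⇐ []       h       (suc k) = inj₁ refl
    tails⇐ (x ∷ xs) (h , _) zero    = inj₂
      (subst₂ (λ y v → ⟪ φ ⟫ (y ∷ v ∷ [])) (sym (π₁-⟨⟩ x ⌈ xs ⌉)) (sym (π₂-⟨⟩ x ⌈ xs ⌉)) h)
    tails⇐ (x ∷ xs) (_ , h) (suc k) = tails⇐ xs h k

    opaque
      unfolding tailsF

      ⟪tails⟫⇒ : ∀ xs → ⟪ tails φ v0 ⟫ (⌈ xs ⌉ ∷ []) → Tails xs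
      ⟪tails⟫⇒ xs h = tails⇒ xs (λ k k< → subst Split (⟦drop⟧ xs k) (h k k<))

      ⟪tails⟫⇐ : ∀ xs → Tails xs → ⟪ tails φ v0 ⟫ (⌈ xs ⌉ ∷ [])
      ⟪tails⟫⇐ xs h k _ = subst Split (sym (⟦drop⟧ xs k)) (tails⇐ xs h k)

-- Derivations of halting with the oracles `A` and `A ′`

pattern v4 = var (suc (suc (suc (suc zero))))
pattern v5 = var (suc (suc (suc (suc (suc zero)))))
pattern v6 = var (suc (suc (suc (suc (suc (suc zero))))))
pattern v7 = var (suc (suc (suc (suc (suc (suc (suc zero)))))))
pattern v8 = var (suc (suc (suc (suc (suc (suc (suc (suc zero))))))))

-- Entries ⟨t, ⟨c, ⟨x, y⟩⟩⟩ of a coded derivation.  Tag 0 asserts that c is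
-- the code of a program, tag 1 that the program c maps x to y with oracle A,
-- and tag 2 the same with oracle A ′.
entry : ℕ → ℕ → ℕ → ℕ → ℕ
entry t c x y = ⟨ t , ⟨ c , ⟨ x , y ⟩ ⟩ ⟩

module _ {O : Set} where

  entryᵗ : ∀ {n} → Tm O n → Tm O n → Tm O n → Tm O n → Tm O n
  entryᵗ t c x y = pair t (pair c (pair x y))

  isCode : ∀ {n} → Tm O n → Tm O n → Fm O n
  isCode c l = entryᵗ (lit 0) c (lit 0) (lit 0) ∈ᶠ l

  -- Variables: the tag, k, a and b with code c = ⟨k, ⟨a, b⟩⟩, x, y and the
  -- list of the premises; χ is the characteristic function of A.
  module Rules (χ : Tm O 1) where
    atomic : ℕ → Fm O 7
    atomic j = v1 ≐ᶠ lit j ∧ v2 ≐ᶠ lit 0 ∧ v3 ≐ᶠ lit 0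

    codeAtomF codeBinF codeMinF zeroF succF leftF rightF ask₁F no₂F yes₂F pairF compF rec0F recSF minF
      evalF justF : Fm O 7
    codeAtomF = ex (lit 5) (v2 ≐ᶠ v0) ∧ v2 ≐ᶠ lit 0 ∧ v3 ≐ᶠ lit 0
    codeBinF  = (v1 ≐ᶠ lit 5 ∨ v1 ≐ᶠ lit 6 ∨ v1 ≐ᶠ lit 7) ∧ isCode v2 v6 ∧ isCode v3 v6
    codeMinF  = v1 ≐ᶠ lit 8 ∧ isCode (pair v2 v3) v6
    zeroF  = atomic 0 ∧ v5 ≐ᶠ lit 0
    succF  = atomic 1 ∧ v5 ≐ᶠ sucᵗ v4
    leftF  = atomic 2 ∧ v5 ≐ᶠ fst v4
    rightF = atomic 3 ∧ v5 ≐ᶠ snd v4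
    ask₁F  = atomic 4 ∧ v0 ≐ᶠ lit 1 ∧ v5 ≐ᶠ call χ (v4 ∷ [])
    -- A negative answer of `A ′` has no finite evidence, so the rule demands none; `Clean` and the
    -- `negs` hypotheses keep track of such answers.
    no₂F   = atomic 4 ∧ v0 ≐ᶠ lit 2 ∧ v5 ≐ᶠ lit 0
    yes₂F  = atomic 4 ∧ v0 ≐ᶠ lit 2 ∧ v5 ≐ᶠ lit 1 ∧ ex v6 (entryᵗ (lit 1) v5 v5 v0 ∈ᶠ v7)
    pairF  = v1 ≐ᶠ lit 5 ∧ entryᵗ v0 v2 v4 (fst v5) ∈ᶠ v6 ∧ entryᵗ v0 v3 v4 (snd v5) ∈ᶠ v6
    compF  = v1 ≐ᶠ lit 6 ∧ ex v6 (entryᵗ v1 v4 v5 v0 ∈ᶠ v7 ∧ entryᵗ v1 v3 v0 v6 ∈ᶠ v7)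
    -- For recursion index 0 the step program is never run, so a separate premise must certify that
    -- it has a code.
    rec0F  = v1 ≐ᶠ lit 7 ∧ snd v4 ≐ᶠ lit 0 ∧ entryᵗ v0 v2 (fst v4) v5 ∈ᶠ v6 ∧ isCode v3 v6
    recSF  = v1 ≐ᶠ lit 7 ∧ ex v4 (snd v5 ≐ᶠ sucᵗ v0 ∧
               ex v7 (entryᵗ v2 (pair (lit 7) (pair v4 v5)) (pair (fst v6) v1) v0 ∈ᶠ v8 ∧
                      entryᵗ v2 v5 (pair (fst v6) (pair v1 v0)) v7 ∈ᶠ v8))
    minF   = v1 ≐ᶠ lit 8 ∧ entryᵗ v0 (pair v2 v3) (pair v4 v5) (lit 0) ∈ᶠ v6 ∧
             all v5 (ex v7 (entryᵗ v2 (pair v4 v5) (pair v6 v1) (sucᵗ v0) ∈ᶠ v8))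
    evalF  = zeroF ∨ succF ∨ leftF ∨ rightF ∨ ask₁F ∨ no₂F ∨ yes₂F ∨ pairF ∨ compF ∨ rec0F ∨ recSF ∨ minF
    justF  = (v0 ≐ᶠ lit 0 ∧ (codeAtomF ∨ codeBinF ∨ codeMinF)) ∨ (neg (v0 ≐ᶠ lit 0) ∧ evalF)

    entryF : Fm O 2
    entryF = at justF (fst v0 ∷ fst (fst (snd v0)) ∷ fst (snd (fst (snd v0))) ∷
      snd (snd (fst (snd v0))) ∷ fst (snd (snd v0)) ∷ snd (snd (snd v0)) ∷ v1 ∷ [])

    validF : ∀ {n} → Tm O n → Fm O n
    validF = tails entryF

pattern codeAtomR h = inj₁ (refl , inj₁ h)
pattern codeBinR  h = inj₁ (refl , inj₂ (inj₁ h))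
pattern codeMinR  h = inj₁ (refl , inj₂ (inj₂ h))
pattern zeroR  t h = inj₂ (t , inj₁ h)
pattern succR  t h = inj₂ (t , inj₂ (inj₁ h))
pattern leftR  t h = inj₂ (t , inj₂ (inj₂ (inj₁ h)))
pattern rightR t h = inj₂ (t , inj₂ (inj₂ (inj₂ (inj₁ h))))
pattern ask₁R  t h = inj₂ (t , inj₂ (inj₂ (inj₂ (inj₂ (inj₁ h)))))
pattern no₂R   t h = inj₂ (t , inj₂ (inj₂ (inj₂ (inj₂ (inj₂ (inj₁ h))))))
pattern yes₂R  t h = inj₂ (t , inj₂ (inj₂ (inj₂ (inj₂ (inj₂ (inj₂ (inj₁ h)))))))
pattern pairR  t h = inj₂ (t , inj₂ (inj₂ (inj₂ (inj₂ (inj₂ (inj₂ (inj₂ (inj₁ h))))))))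
pattern compR  t h = inj₂ (t , inj₂ (inj₂ (inj₂ (inj₂ (inj₂ (inj₂ (inj₂ (inj₂ (inj₁ h)))))))))
pattern rec0R  t h = inj₂ (t , inj₂ (inj₂ (inj₂ (inj₂ (inj₂ (inj₂ (inj₂ (inj₂ (inj₂ (inj₁ h))))))))))
pattern recSR  t h = inj₂ (t , inj₂ (inj₂ (inj₂ (inj₂ (inj₂ (inj₂ (inj₂ (inj₂ (inj₂ (inj₂ (inj₁ h)))))))))))
pattern minR   t h = inj₂ (t , inj₂ (inj₂ (inj₂ (inj₂ (inj₂ (inj₂ (inj₂ (inj₂ (inj₂ (inj₂ (inj₂ h)))))))))))

⟨⟩-reassemble : ∀ c → ⟨ π₁ c , ⟨ π₁ (π₂ c) , π₂ (π₂ c) ⟩ ⟩ ≡ c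
⟨⟩-reassemble c = trans (cong ⟨ π₁ c ,_⟩ (⟨⟩-unpair (π₂ c))) (⟨⟩-unpair c)

entry-η : ∀ e → entry (π₁ e) (π₁ (π₂ e)) (π₁ (π₂ (π₂ e))) (π₂ (π₂ (π₂ e))) ≡ e
entry-η e = trans (cong (λ z → ⟨ π₁ e , ⟨ π₁ (π₂ e) , z ⟩ ⟩) (⟨⟩-unpair (π₂ (π₂ e))))
                  (⟨⟩-reassemble e)

entry-≡ : ∀ e {t c y} → π₁ e ≡ t → π₁ (π₂ e) ≡ c → π₂ (π₂ (π₂ e)) ≡ y →
          entry t c (π₁ (π₂ (π₂ e))) y ≡ e
entry-≡ e refl refl refl = entry-η e

entry-fields : ∀ (P : ℕ → ℕ → ℕ → ℕ → Set) {t c x y} → let e = entry t c x y in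
  P (π₁ e) (π₁ (π₂ e)) (π₁ (π₂ (π₂ e))) (π₂ (π₂ (π₂ e))) ≡ P t c x y
entry-fields P {t} {c} {x} {y}
  rewrite π₁-⟨⟩ t ⟨ c , ⟨ x , y ⟩ ⟩ | π₂-⟨⟩ t ⟨ c , ⟨ x , y ⟩ ⟩
        | π₁-⟨⟩ c ⟨ x , y ⟩ | π₂-⟨⟩ c ⟨ x , y ⟩ | π₁-⟨⟩ x y | π₂-⟨⟩ x y = refl

module Derivations (O : Set) (o : ℕ → ℕ) (χ : Tm O 1) (A : Pred ℕ 0ℓ)
  (χ-yes : ∀ {x} → A x → Semantics.⟦_⟧ O o χ (x ∷ []) ≡ 1)
  (χ-no  : ∀ {x} → ¬ A x → Semantics.⟦_⟧ O o χ (x ∷ []) ≡ 0)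
  (em : ExcludedMiddle 0ℓ) where

  open Semantics O o
  open ListSemantics O o
  open Rules χ

  Just : ℕ → ℕ → ℕ → ℕ → ℕ → ℕ → ℕ → Set
  Just t k a b x y l = ⟪ justF ⟫ (t ∷ k ∷ a ∷ b ∷ x ∷ y ∷ l ∷ [])

  JustEntry : ℕ → ℕ → Set
  JustEntry e l = Just (π₁ e) (π₁ (π₁ (π₂ e))) (π₁ (π₂ (π₁ (π₂ e)))) (π₂ (π₂ (π₁ (π₂ e))))
                       (π₁ (π₂ (π₂ e))) (π₂ (π₂ (π₂ e))) l

  Valid : List ℕ → Set
  Valid = Tails entryF

  oracleOf : ℕ → Pred ℕ 0ℓ
  oracleOf zero    = A
  oracleOf (suc _) = A ′

  module Soundness (H : Set) where

    -- H is the assumption that the negative answers of the oracle A ′ used in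
    -- the derivation are correct; entries with tag 1 do not depend on it.
    Assuming : ℕ → Set
    Assuming zero    = ⊤
    Assuming (suc _) = H

    Holds : ℕ → ℕ → ℕ → ℕ → Set
    Holds zero    c x y = ∃[ p ] c ≡ ⌜ p ⌝
    Holds (suc t) c x y = Assuming t → ∃[ p ] c ≡ ⌜ p ⌝ × oracleOf t ⊢ p [ x ]⇓ y

    module _ {l : ℕ} (ih : ∀ t c x y → entry t c x y ∈ᶜ l → Holds t c x y) where

      sound-code : ∀ {k a b x y} → Just 0 k a b x y l → ∃[ p ] ⟨ k , ⟨ a , b ⟩ ⟩ ≡ ⌜ p ⌝
      sound-code (codeAtomR ((0 , _ , refl) , refl , refl)) = zeroᵖ , refl
      sound-code (codeAtomR ((1 , _ , refl) , refl , refl)) = succᵖ , refl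
      sound-code (codeAtomR ((2 , _ , refl) , refl , refl)) = leftᵖ , refl
      sound-code (codeAtomR ((3 , _ , refl) , refl , refl)) = rightᵖ , refl
      sound-code (codeAtomR ((4 , _ , refl) , refl , refl)) = oracleᵖ , refl
      sound-code (codeAtomR ((suc (suc (suc (suc (suc _)))) , s≤s (s≤s (s≤s (s≤s (s≤s ())))) , _) , _))
      sound-code {a = a} {b} (codeBinR (h , ca , cb)) with ih 0 a 0 0 ca | ih 0 b 0 0 cb | h
      ... | p , e | q , e′ | inj₁ refl        = pairᵖ p q , cong₂ (λ a b → ⟨ 5 , ⟨ a , b ⟩ ⟩) e e′
      ... | p , e | q , e′ | inj₂ (inj₁ refl) = compᵖ p q , cong₂ (λ a b → ⟨ 6 , ⟨ a , b ⟩ ⟩) e e′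
      ... | p , e | q , e′ | inj₂ (inj₂ refl) = recᵖ p q , cong₂ (λ a b → ⟨ 7 , ⟨ a , b ⟩ ⟩) e e′
      sound-code {a = a} {b} (codeMinR (refl , c)) with ih 0 ⟨ a , b ⟩ 0 0 c
      ... | p , e = minᵖ p , cong ⟨ 8 ,_⟩ e
      sound-code (inj₂ (t≢0 , _)) = ⊥-elim (t≢0 refl)

      sound-eval : ∀ {t k a b x y} → (t ≡ 1 → ⟨ k , ⟨ a , b ⟩ ⟩ ≡ ⌜ oracleᵖ ⌝ → y ≡ 0 → H → ¬ (A ′) x) →
                   Just (suc t) k a b x y l → Assuming t →
                   ∃[ p ] ⟨ k , ⟨ a , b ⟩ ⟩ ≡ ⌜ p ⌝ × oracleOf t ⊢ p [ x ]⇓ y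
      sound-eval negs (zeroR _ ((refl , refl , refl) , refl)) _ = zeroᵖ , refl , zero⇓
      sound-eval negs (succR _ ((refl , refl , refl) , refl)) _ = succᵖ , refl , succ⇓
      sound-eval {x = x} negs (leftR _ ((refl , refl , refl) , refl)) _ = leftᵖ , refl , left⇓′ x
      sound-eval {x = x} negs (rightR _ ((refl , refl , refl) , refl)) _ = rightᵖ , refl , right⇓′ x
      sound-eval {x = x} negs (ask₁R _ ((refl , refl , refl) , refl , refl)) _ with em {P = A x}
      ... | yes h = oracleᵖ , refl , subst (A ⊢ oracleᵖ [ x ]⇓_) (sym (χ-yes h)) (yes⇓ h)
      ... | no ¬h = oracleᵖ , refl , subst (A ⊢ oracleᵖ [ x ]⇓_) (sym (χ-no ¬h)) (no⇓ ¬h)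
      sound-eval negs (no₂R _ ((refl , refl , refl) , refl , refl)) h =
        oracleᵖ , refl , no⇓ (negs refl refl refl h)
      sound-eval {x = x} negs (yes₂R _ ((refl , refl , refl) , refl , refl , v , _ , m)) _
        with ih 1 x x v m tt
      ... | p , e , d = oracleᵖ , refl , yes⇓ (p , e , v , d)
      sound-eval {t} {a = a} {b} {x} {y} negs (pairR _ (refl , m , m′)) h
        with ih (suc t) a x (π₁ y) m h | ih (suc t) b x (π₂ y) m′ h
      ... | p , e , d | q , e′ , d′ = pairᵖ p q , cong₂ (λ a b → ⟨ 5 , ⟨ a , b ⟩ ⟩) e e′ ,
        subst (oracleOf t ⊢ pairᵖ p q [ x ]⇓_) (⟨⟩-unpair y) (pair⇓ d d′)
      sound-eval {t} {a = a} {b} {x} {y} negs (compR _ (refl , v , _ , m , m′)) h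
        with ih (suc t) b x v m h | ih (suc t) a v y m′ h
      ... | q , e , d | p , e′ , d′ = compᵖ p q , cong₂ (λ a b → ⟨ 6 , ⟨ a , b ⟩ ⟩) e′ e , comp⇓ d d′
      sound-eval {t} {a = a} {b} {x} {y} negs (rec0R _ (refl , e , m , m′)) h
        with ih (suc t) a (π₁ x) y m h | ih 0 b 0 0 m′
      ... | p , e₁ , d | q , e₂ = recᵖ p q , cong₂ (λ a b → ⟨ 7 , ⟨ a , b ⟩ ⟩) e₁ e₂ ,
        subst (λ z → oracleOf t ⊢ recᵖ p q [ z ]⇓ y)
              (trans (cong ⟨ π₁ x ,_⟩ (sym e)) (⟨⟩-unpair x)) (rec0⇓ {x = π₁ x} d)
      sound-eval {t} {a = a} {b} {x} {y} negs (recSR _ (refl , m , _ , e , v , _ , m₁ , m₂)) h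
        with ih (suc t) ⟨ 7 , ⟨ a , b ⟩ ⟩ ⟨ π₁ x , m ⟩ v m₁ h | ih (suc t) b ⟨ π₁ x , ⟨ m , v ⟩ ⟩ y m₂ h
      ... | r , e₁ , d | q , e₂ , d′ = r , e₁ , run r≡rec d
        where
        f = depth r + depth q
        -- The premise about the earlier value gives a program `r` with the right code, but not its
        -- form. Parsing that code shows that `r` is a recursion with step program `q`.
        r≡rec : r ≡ recᵖ (parse f (π₁ ⟨ a , b ⟩)) q
        r≡rec = begin
          r                                        ≡⟨ sym (parse-⌜⌝ (suc f) r (m≤n⇒m≤1+n (m≤m+n (depth r) (depth q)))) ⟩
          parse (suc f) ⌜ r ⌝                      ≡⟨ cong (parse (suc f)) (sym e₁) ⟩
          parse (suc f) ⟨ 7 , ⟨ a , b ⟩ ⟩          ≡⟨ parse-step f 7 ⟨ a , b ⟩ ⟩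
          recᵖ (parse f (π₁ ⟨ a , b ⟩)) (parse f (π₂ ⟨ a , b ⟩))
            ≡⟨ cong (λ c → recᵖ (parse f (π₁ ⟨ a , b ⟩)) (parse f c)) (trans (π₂-⟨⟩ a b) e₂) ⟩
          recᵖ (parse f (π₁ ⟨ a , b ⟩)) (parse f ⌜ q ⌝)
            ≡⟨ cong (recᵖ (parse f (π₁ ⟨ a , b ⟩))) (parse-⌜⌝ f q (m≤n+m (depth q) (depth r))) ⟩
          recᵖ (parse f (π₁ ⟨ a , b ⟩)) q ∎
          where open ≡-Reasoning
        run : ∀ {p} → r ≡ recᵖ p q → oracleOf t ⊢ r [ ⟨ π₁ x , m ⟩ ]⇓ v → oracleOf t ⊢ r [ x ]⇓ y
        run {p} refl d = subst (λ z → oracleOf t ⊢ recᵖ p q [ z ]⇓ y)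
          (trans (cong ⟨ π₁ x ,_⟩ (sym e)) (⟨⟩-unpair x)) (recS⇓ {x = π₁ x} {n = m} d d′)
      sound-eval {t} {a = a} {b} {x} {y} negs (minR _ (refl , m , f)) h
        with ih (suc t) ⟨ a , b ⟩ ⟨ x , y ⟩ 0 m h
      ... | p , e , d = minᵖ p , cong ⟨ 8 ,_⟩ e , min⇓ d below-y
        where
        below-y : ∀ k → k < y → ∃[ v ] oracleOf t ⊢ p [ ⟨ x , k ⟩ ]⇓ suc v
        below-y k k<y with f k k<y
        ... | v , _ , m′ with ih (suc t) ⟨ a , b ⟩ ⟨ x , k ⟩ (suc v) m′ h
        -- Each premise brings its own program; that it is `p` follows from the equality of the
        -- codes.
        ... | p′ , e′ , d′ with refl ← ⌜⌝-injective p p′ (trans (sym e) e′) = v , d′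

      sound-rule : ∀ t k a b x y →
        (t ≡ 2 → ⟨ k , ⟨ a , b ⟩ ⟩ ≡ ⌜ oracleᵖ ⌝ → y ≡ 0 → H → ¬ (A ′) x) →
        Just t k a b x y l → Holds t ⟨ k , ⟨ a , b ⟩ ⟩ x y
      sound-rule zero    k a b x y negs j = sound-code j
      sound-rule (suc t) k a b x y negs j = sound-eval (λ e → negs (cong suc e)) j

    HoldsEntry : ℕ → Set
    HoldsEntry e = Holds (π₁ e) (π₁ (π₂ e)) (π₁ (π₂ (π₂ e))) (π₂ (π₂ (π₂ e)))

    HoldsEntry⇒ : ∀ {t c x y} → HoldsEntry (entry t c x y) → Holds t c x y
    HoldsEntry⇒ {t} {c} {x} {y} = subst (λ X → X) (entry-fields Holds {t} {c} {x} {y})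

    -- The premises of an entry lie behind it in the list, so induction on the list replaces
    -- induction on a derivation tree.
    sound : ∀ xs → Valid xs → (∀ q → entry 2 ⌜ oracleᵖ ⌝ q 0 ∈ xs → H → ¬ (A ′) q) →
            ∀ e → e ∈ xs → HoldsEntry e
    sound (e ∷ xs) (j , v) negs e′ (there e′∈) = sound xs v (λ q m → negs q (there m)) e′ e′∈
    sound (e ∷ xs) (j , v) negs .e (here refl) =
      subst (λ c → Holds (π₁ e) c x y) (⟨⟩-reassemble c)
        (sound-rule (λ t c x y m → HoldsEntry⇒ {t} {c} {x} {y}
                      (sound xs v (λ q m → negs q (there m)) (entry t c x y) (∈ᶜ⇒∈ xs m)))
          (π₁ e) (π₁ c) (π₁ (π₂ c)) (π₂ (π₂ c)) x y
          (λ e₁ e₂ e₃ → negs x (here (entry-≡ e e₁ (trans (sym (⟨⟩-reassemble c)) e₂) e₃)))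
          j)
      where
      c = π₁ (π₂ e)
      x = π₁ (π₂ (π₂ e))
      y = π₂ (π₂ (π₂ e))

  -- This is why bounded quantifiers suffice in the rules: an intermediate value is part of some
  -- premise and hence below the code of the list of premises.
  entry-value< : ∀ t c x v {ys} → entry t c x v ∈ᶜ ⌈ ys ⌉ → v < ⌈ ys ⌉
  entry-value< t c x v {ys} m = ≤-trans (s≤s (≤-trans (proj₂≤⟨⟩ x v)
    (≤-trans (proj₂≤⟨⟩ c _) (proj₂≤⟨⟩ t _)))) (∈⇒<⌈⌉ (∈ᶜ⇒∈ ys m))

  entry-input< : ∀ t c x v {ys} → entry t c x v ∈ᶜ ⌈ ys ⌉ → x < ⌈ ys ⌉
  entry-input< t c x v {ys} m = ≤-trans (s≤s (≤-trans (proj₁≤⟨⟩ x v)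
    (≤-trans (proj₂≤⟨⟩ c _) (proj₂≤⟨⟩ t _)))) (∈⇒<⌈⌉ (∈ᶜ⇒∈ ys m))

  module _ {xs ys : List ℕ} (m : ∀ e → e ∈ᶜ ⌈ xs ⌉ → e ∈ᶜ ⌈ ys ⌉) where

    -- Premises occur only positively in the rules. The bounds on intermediate values are derived
    -- anew from membership in `ys`.
    Just-mono : ∀ t k a b x y → Just t k a b x y ⌈ xs ⌉ → Just t k a b x y ⌈ ys ⌉
    Just-mono t k a b x y (inj₁ (e , inj₁ h)) = inj₁ (e , inj₁ h)
    Just-mono t k a b x y (inj₁ (e , inj₂ (inj₁ (h , ca , cb)))) =
      inj₁ (e , inj₂ (inj₁ (h , m (entry 0 a 0 0) ca , m (entry 0 b 0 0) cb)))
    Just-mono t k a b x y (inj₁ (e , inj₂ (inj₂ (h , c)))) =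
      inj₁ (e , inj₂ (inj₂ (h , m (entry 0 ⟨ a , b ⟩ 0 0) c)))
    Just-mono t k a b x y (zeroR e h)  = zeroR e h
    Just-mono t k a b x y (succR e h)  = succR e h
    Just-mono t k a b x y (leftR e h)  = leftR e h
    Just-mono t k a b x y (rightR e h) = rightR e h
    Just-mono t k a b x y (ask₁R e h)  = ask₁R e h
    Just-mono t k a b x y (no₂R e h)   = no₂R e h
    Just-mono t k a b x y (yes₂R e (c , e₁ , e₂ , v , _ , h)) =
      yes₂R e (c , e₁ , e₂ , v , entry-value< 1 x x v h′ , h′)
      where h′ = m (entry 1 x x v) h
    Just-mono t k a b x y (pairR e (c , h₁ , h₂)) =
      pairR e (c , m (entry t a x (π₁ y)) h₁ , m (entry t b x (π₂ y)) h₂)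
    Just-mono t k a b x y (compR e (c , v , _ , h₁ , h₂)) =
      compR e (c , v , entry-value< t b x v h₁′ , h₁′ , m (entry t a v y) h₂)
      where h₁′ = m (entry t b x v) h₁
    Just-mono t k a b x y (rec0R e (c , e₁ , h₁ , h₂)) =
      rec0R e (c , e₁ , m (entry t a (π₁ x) y) h₁ , m (entry 0 b 0 0) h₂)
    Just-mono t k a b x y (recSR e (c , n , n< , e₁ , v , _ , h₁ , h₂)) =
      recSR e (c , n , n< , e₁ , v , entry-value< t ⟨ 7 , ⟨ a , b ⟩ ⟩ ⟨ π₁ x , n ⟩ v h₁′ , h₁′ ,
               m (entry t b ⟨ π₁ x , ⟨ n , v ⟩ ⟩ y) h₂)
      where h₁′ = m (entry t ⟨ 7 , ⟨ a , b ⟩ ⟩ ⟨ π₁ x , n ⟩ v) h₁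
    Just-mono t k a b x y (minR e (c , h , f)) =
      minR e (c , m (entry t ⟨ a , b ⟩ ⟨ x , y ⟩ 0) h , λ i i<y → g i (f i i<y))
      where
      g : ∀ i → ∃[ v ] v < ⌈ xs ⌉ × entry t ⟨ a , b ⟩ ⟨ x , i ⟩ (suc v) ∈ᶜ ⌈ xs ⌉ →
          ∃[ v ] v < ⌈ ys ⌉ × entry t ⟨ a , b ⟩ ⟨ x , i ⟩ (suc v) ∈ᶜ ⌈ ys ⌉
      g i (v , _ , h) = v , <-trans ≤-refl (entry-value< t ⟨ a , b ⟩ ⟨ x , i ⟩ (suc v) h′) , h′
        where h′ = m (entry t ⟨ a , b ⟩ ⟨ x , i ⟩ (suc v)) h

  Valid-++ : ∀ xs ys → Valid xs → Valid ys → Valid (xs ++ ys)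
  Valid-++ []       ys _        v′ = v′
  Valid-++ (e ∷ xs) ys (j , v)  v′ =
    Just-mono {xs} {xs ++ ys} (λ z m → ∈⇒∈ᶜ {z} (∈-++⁺ˡ (∈ᶜ⇒∈ {z} xs m))) (π₁ e) (π₁ c) (π₁ (π₂ c)) (π₂ (π₂ c)) _ _ j ,
    Valid-++ xs ys v v′
    where c = π₁ (π₂ e)

  -- Exactly what the rules leave unchecked.
  Clean : List ℕ → Set
  Clean xs = ∀ q → entry 2 ⌜ oracleᵖ ⌝ q 0 ∈ xs → ¬ (A ′) q

  Derivation : (List ℕ → Set) → Set
  Derivation P = ∃[ xs ] Valid xs × Clean xs × P xs

  Derivable : ℕ → ℕ → ℕ → ℕ → Set
  Derivable t c x y = Derivation (entry t c x y ∈_)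

  join : ∀ {P Q R : List ℕ → Set} → (∀ {xs ys} → P xs → Q ys → R (xs ++ ys)) →
         Derivation P → Derivation Q → Derivation R
  join f (xs , v , c , p) (ys , v′ , c′ , q) = xs ++ ys , Valid-++ xs ys v v′ , clean , f p q
    where
    clean : Clean (xs ++ ys)
    clean q m with ∈-++⁻ xs m
    ... | inj₁ m′ = c q m′
    ... | inj₂ m′ = c′ q m′

  join-∈ : ∀ {e e′} → Derivation (e ∈_) → Derivation (e′ ∈_) → Derivation (λ xs → e ∈ xs × e′ ∈ xs)
  join-∈ {e} {e′} = join {e ∈_} {e′ ∈_} (λ {xs} m m′ → ∈-++⁺ˡ m , ∈-++⁺ʳ xs m′)

  JustEntry⇐ : ∀ t k a b x y l → Just t k a b x y l → JustEntry (entry t ⟨ k , ⟨ a , b ⟩ ⟩ x y) l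
  JustEntry⇐ t k a b x y l j = subst (λ X → X)
    (sym (entry-fields (λ t c x y → Just t (π₁ c) (π₁ (π₂ c)) (π₂ (π₂ c)) x y l)
                       {t} {⟨ k , ⟨ a , b ⟩ ⟩} {x} {y}))
    fields
    where
    fields : Just t (π₁ ⟨ k , ⟨ a , b ⟩ ⟩) (π₁ (π₂ ⟨ k , ⟨ a , b ⟩ ⟩)) (π₂ (π₂ ⟨ k , ⟨ a , b ⟩ ⟩)) x y l
    fields rewrite π₁-⟨⟩ k ⟨ a , b ⟩ | π₂-⟨⟩ k ⟨ a , b ⟩ | π₁-⟨⟩ a b | π₂-⟨⟩ a b = j

  -- Only a conclusion that is itself a negative answer of `A ′` can spoil cleanness; all other
  -- rules discharge this hypothesis by absurdity.
  infer : ∀ t k a b x y {P : List ℕ → Set} → (t ≡ 2 → k ≡ 4 → y ≡ 0 → ¬ (A ′) x) →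
          (∀ xs → P xs → Just t k a b x y ⌈ xs ⌉) →
          Derivation P → Derivable t ⟨ k , ⟨ a , b ⟩ ⟩ x y
  infer t k a b x y negative rule (xs , v , c , p) =
    entry t ⟨ k , ⟨ a , b ⟩ ⟩ x y ∷ xs , (JustEntry⇐ t k a b x y ⌈ xs ⌉ (rule xs p) , v) , clean , here refl
    where
    clean : Clean (entry t ⟨ k , ⟨ a , b ⟩ ⟩ x y ∷ xs)
    clean q (there m) = c q m
    clean q (here e) with ⟨⟩-injective {2} {_} {t} e
    ... | e₁ , e₂ with ⟨⟩-injective {⌜ oracleᵖ ⌝} {_} {⟨ k , ⟨ a , b ⟩ ⟩} e₂
    ... | e₃ , e₄ with ⟨⟩-injective {4} {0} {k} {⟨ a , b ⟩} e₃ | ⟨⟩-injective {q} {0} {x} {y} e₄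
    ... | e₅ , _ | e₆ , e₇ = subst (λ z → ¬ (A ′) z) (sym e₆) (negative (sym e₁) (sym e₅) (sym e₇))

  axiom : Derivation (λ _ → ⊤)
  axiom = [] , tt , (λ _ ()) , tt

  derive-code : ∀ p → Derivable 0 ⌜ p ⌝ 0 0
  derive-code zeroᵖ   = infer 0 0 0 0 0 0 (λ ()) (λ _ _ → codeAtomR ((0 , s≤s z≤n , refl) , refl , refl)) axiom
  derive-code succᵖ   = infer 0 1 0 0 0 0 (λ ()) (λ _ _ → codeAtomR ((1 , s≤s (s≤s z≤n) , refl) , refl , refl)) axiom
  derive-code leftᵖ   = infer 0 2 0 0 0 0 (λ ())
    (λ _ _ → codeAtomR ((2 , s≤s (s≤s (s≤s z≤n)) , refl) , refl , refl)) axiom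
  derive-code rightᵖ  = infer 0 3 0 0 0 0 (λ ())
    (λ _ _ → codeAtomR ((3 , s≤s (s≤s (s≤s (s≤s z≤n))) , refl) , refl , refl)) axiom
  derive-code oracleᵖ = infer 0 4 0 0 0 0 (λ ()) (λ _ _ → codeAtomR ((4 , ≤-refl , refl) , refl , refl)) axiom
  derive-code (pairᵖ p q) = infer 0 5 ⌜ p ⌝ ⌜ q ⌝ 0 0 (λ ())
    (λ xs (m , m′) → codeBinR (inj₁ refl , ∈⇒∈ᶜ m , ∈⇒∈ᶜ m′))
    (join-∈ (derive-code p) (derive-code q))
  derive-code (compᵖ p q) = infer 0 6 ⌜ p ⌝ ⌜ q ⌝ 0 0 (λ ())
    (λ xs (m , m′) → codeBinR (inj₂ (inj₁ refl) , ∈⇒∈ᶜ m , ∈⇒∈ᶜ m′))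
    (join-∈ (derive-code p) (derive-code q))
  derive-code (recᵖ p q) = infer 0 7 ⌜ p ⌝ ⌜ q ⌝ 0 0 (λ ())
    (λ xs (m , m′) → codeBinR (inj₂ (inj₂ refl) , ∈⇒∈ᶜ m , ∈⇒∈ᶜ m′))
    (join-∈ (derive-code p) (derive-code q))
  -- The rules read every code as a triple, whereas the body of `minᵖ` contributes one number, which
  -- therefore is unpaired first.
  derive-code (minᵖ p) = subst (λ c → Derivable 0 ⟨ 8 , c ⟩ 0 0) (⟨⟩-unpair ⌜ p ⌝)
    (infer 0 8 (π₁ ⌜ p ⌝) (π₂ ⌜ p ⌝) 0 0 (λ ())
      (λ xs m → codeMinR (refl , ∈⇒∈ᶜ (subst (λ c → entry 0 c 0 0 ∈ xs) (sym (⟨⟩-unpair ⌜ p ⌝)) m)))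
      (derive-code p))

  module _ (t : ℕ)
    (derive-oracle : ∀ {x y} → oracleOf t ⊢ oracleᵖ [ x ]⇓ y → Derivable (suc t) ⌜ oracleᵖ ⌝ x y) where

    derive : ∀ {p x y} → oracleOf t ⊢ p [ x ]⇓ y → Derivable (suc t) ⌜ p ⌝ x y
    derive-all : ∀ {p x} n → (∀ k → k < n → ∃[ v ] oracleOf t ⊢ p [ ⟨ x , k ⟩ ]⇓ suc v) → ∀ m → m ≤ n →
      Derivation (λ xs → ∀ k → k < m → ∃[ v ] entry (suc t) ⌜ p ⌝ ⟨ x , k ⟩ (suc v) ∈ xs)

    derive {x = x} zero⇓ = infer (suc t) 0 0 0 x 0 (λ _ ()) (λ _ _ → zeroR (λ ()) ((refl , refl , refl) , refl)) axiom
    derive {x = x} succ⇓ = infer (suc t) 1 0 0 x (suc x) (λ _ ())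
      (λ _ _ → succR (λ ()) ((refl , refl , refl) , refl)) axiom
    derive (left⇓ {x} {y}) = infer (suc t) 2 0 0 ⟨ x , y ⟩ x (λ _ ())
      (λ _ _ → leftR (λ ()) ((refl , refl , refl) , sym (π₁-⟨⟩ x y))) axiom
    derive (right⇓ {x} {y}) = infer (suc t) 3 0 0 ⟨ x , y ⟩ y (λ _ ())
      (λ _ _ → rightR (λ ()) ((refl , refl , refl) , sym (π₂-⟨⟩ x y))) axiom
    derive (yes⇓ h) = derive-oracle (yes⇓ h)
    derive (no⇓ h)  = derive-oracle (no⇓ h)
    derive (pair⇓ {p} {q} {x} {y} {z} d d′) = infer (suc t) 5 ⌜ p ⌝ ⌜ q ⌝ x ⟨ y , z ⟩ (λ _ ())
      (λ xs (m , m′) → pairR (λ ()) (refl ,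
        ∈⇒∈ᶜ (subst (λ y → entry (suc t) ⌜ p ⌝ x y ∈ xs) (sym (π₁-⟨⟩ y z)) m) ,
        ∈⇒∈ᶜ (subst (λ y → entry (suc t) ⌜ q ⌝ x y ∈ xs) (sym (π₂-⟨⟩ y z)) m′)))
      (join-∈ (derive d) (derive d′))
    derive (comp⇓ {p} {q} {x} {y} {z} d d′) = infer (suc t) 6 ⌜ p ⌝ ⌜ q ⌝ x z (λ _ ())
      (λ xs (m , m′) → compR (λ ()) (refl , y , entry-value< (suc t) ⌜ q ⌝ x y (∈⇒∈ᶜ m) , ∈⇒∈ᶜ m , ∈⇒∈ᶜ m′))
      (join-∈ (derive d) (derive d′))
    derive (rec0⇓ {p} {q} {x} {y} d) = infer (suc t) 7 ⌜ p ⌝ ⌜ q ⌝ ⟨ x , 0 ⟩ y (λ _ ())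
      (λ xs (m , m′) → rec0R (λ ()) (refl , π₂-⟨⟩ x 0 ,
        ∈⇒∈ᶜ (subst (λ x → entry (suc t) ⌜ p ⌝ x y ∈ xs) (sym (π₁-⟨⟩ x 0)) m) , ∈⇒∈ᶜ m′))
      (join-∈ (derive d) (derive-code q))
    derive (recS⇓ {p} {q} {x} {n} {y} {z} d d′) = infer (suc t) 7 ⌜ p ⌝ ⌜ q ⌝ ⟨ x , suc n ⟩ z (λ _ ())
      (λ xs (m , m′) → recSR (λ ()) (refl , n , proj₂≤⟨⟩ x (suc n) , π₂-⟨⟩ x (suc n) , y ,
        entry-value< (suc t) ⌜ recᵖ p q ⌝ ⟨ x , n ⟩ y (∈⇒∈ᶜ m) ,
        ∈⇒∈ᶜ (subst (λ x → entry (suc t) ⌜ recᵖ p q ⌝ ⟨ x , n ⟩ y ∈ xs) (sym (π₁-⟨⟩ x (suc n))) m) ,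
        ∈⇒∈ᶜ (subst (λ x → entry (suc t) ⌜ q ⌝ ⟨ x , ⟨ n , y ⟩ ⟩ z ∈ xs) (sym (π₁-⟨⟩ x (suc n))) m′)))
      (join-∈ (derive d) (derive d′))
    derive (min⇓ {p} {x} {n} d b) = subst (λ c → Derivable (suc t) ⟨ 8 , c ⟩ x n) (⟨⟩-unpair ⌜ p ⌝)
      (infer (suc t) 8 (π₁ ⌜ p ⌝) (π₂ ⌜ p ⌝) x n {Both} (λ _ ())
        (λ xs (m , f) → minR (λ ()) (refl , ∈⇒∈ᶜ (fold ⟨ x , n ⟩ 0 m) ,
          λ i i<n → proj₁ (f i i<n) ,
            <-trans ≤-refl (entry-value< (suc t) ⌜ p ⌝ ⟨ x , i ⟩ (suc (proj₁ (f i i<n))) (∈⇒∈ᶜ (proj₂ (f i i<n)))) ,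
            ∈⇒∈ᶜ (fold ⟨ x , i ⟩ (suc (proj₁ (f i i<n))) (proj₂ (f i i<n)))))
        (join {entry (suc t) ⌜ p ⌝ ⟨ x , n ⟩ 0 ∈_} {Below} {Both}
              (λ {xs} m f → ∈-++⁺ˡ m , λ i i<n → proj₁ (f i i<n) , ∈-++⁺ʳ xs (proj₂ (f i i<n)))
              (derive d) (derive-all {p} {x} n b n ≤-refl)))
      where
      Below Both : List ℕ → Set
      Below xs = ∀ k → k < n → ∃[ v ] entry (suc t) ⌜ p ⌝ ⟨ x , k ⟩ (suc v) ∈ xs
      Both xs  = entry (suc t) ⌜ p ⌝ ⟨ x , n ⟩ 0 ∈ xs × Below xs
      fold : ∀ x y {xs} → entry (suc t) ⌜ p ⌝ x y ∈ xs →
             entry (suc t) ⟨ π₁ ⌜ p ⌝ , π₂ ⌜ p ⌝ ⟩ x y ∈ xs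
      fold x y {xs} = subst (λ c → entry (suc t) c x y ∈ xs) (sym (⟨⟩-unpair ⌜ p ⌝))

    derive-all n b zero    _   = [] , tt , (λ _ ()) , λ _ ()
    derive-all {p} {x} n b (suc m) m<n =
      join {entry (suc t) ⌜ p ⌝ ⟨ x , m ⟩ (suc (proj₁ (b m m<n))) ∈_} {Below m} {Below (suc m)} both
        (derive (proj₂ (b m m<n))) (derive-all {p} {x} n b m (<⇒≤ m<n))
      where
      Below : ℕ → List ℕ → Set
      Below m xs = ∀ k → k < m → ∃[ v ] entry (suc t) ⌜ p ⌝ ⟨ x , k ⟩ (suc v) ∈ xs
      both : ∀ {xs ys} → entry (suc t) ⌜ p ⌝ ⟨ x , m ⟩ (suc (proj₁ (b m m<n))) ∈ xs →
             (∀ k → k < m → ∃[ v ] entry (suc t) ⌜ p ⌝ ⟨ x , k ⟩ (suc v) ∈ ys) →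
             ∀ k → k < suc m → ∃[ v ] entry (suc t) ⌜ p ⌝ ⟨ x , k ⟩ (suc v) ∈ xs ++ ys
      both {xs} h f k k≤m with m≤n⇒m<n∨m≡n (≤-pred k≤m)
      ... | inj₁ k<m  = proj₁ (f k k<m) , ∈-++⁺ʳ xs (proj₂ (f k k<m))
      ... | inj₂ refl = _ , ∈-++⁺ˡ h

  derive₁ : ∀ {p x y} → A ⊢ p [ x ]⇓ y → Derivable 1 ⌜ p ⌝ x y
  derive₁ = derive 0 λ
    { {x} (yes⇓ h) → infer 1 4 0 0 x 1 (λ ())
        (λ _ _ → ask₁R (λ ()) ((refl , refl , refl) , refl , sym (χ-yes h))) axiom
    ; {x} (no⇓ h)  → infer 1 4 0 0 x 0 (λ ())
        (λ _ _ → ask₁R (λ ()) ((refl , refl , refl) , refl , sym (χ-no h))) axiom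
    }

  derive₂ : ∀ {p x y} → A ′ ⊢ p [ x ]⇓ y → Derivable 2 ⌜ p ⌝ x y
  derive₂ = derive 1 λ
    { {x} (yes⇓ (p , refl , v , d)) → infer 2 4 0 0 ⌜ p ⌝ 1 (λ _ _ ())
        (λ xs m → yes₂R (λ ()) ((refl , refl , refl) , refl , refl ,
          v , entry-value< 1 ⌜ p ⌝ ⌜ p ⌝ v (∈⇒∈ᶜ m) , ∈⇒∈ᶜ m))
        (derive₁ d)
    ; {x} (no⇓ h) → infer 2 4 0 0 x 0 (λ _ _ _ → h) (λ _ _ → no₂R (λ ()) ((refl , refl , refl) , refl , refl)) axiom
    }

  soundness : ∀ {H : Set} xs → Valid xs → (∀ q → entry 2 ⌜ oracleᵖ ⌝ q 0 ∈ xs → H → ¬ (A ′) q) →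
              ∀ t c x y → entry t c x y ∈ xs → Soundness.Holds H t c x y
  soundness {H} xs v negs t c x y m =
    Soundness.HoldsEntry⇒ H {t} {c} {x} {y} (Soundness.sound H xs v negs (entry t c x y) m)

  -- Entries with tag 1 never rest on answers of `A ′`. With `⊥` as the assumption the condition on
  -- negative answers is vacuous, so cleanness is not demanded.
  sound₁ : ∀ xs → Valid xs → ∀ c x y → entry 1 c x y ∈ xs → ∃[ p ] c ≡ ⌜ p ⌝ × A ⊢ p [ x ]⇓ y
  sound₁ xs v c x y m = soundness {⊥} xs v (λ _ _ ()) 1 c x y m tt

  sound₂ : ∀ xs → Valid xs → Clean xs → ∀ c x y → entry 2 c x y ∈ xs → ∃[ p ] c ≡ ⌜ p ⌝ × A ′ ⊢ p [ x ]⇓ y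
  sound₂ xs v clean c x y m = soundness {⊤} xs v (λ q m _ → clean q m) 2 c x y m tt

  valid⇒ : ∀ D → ⟪ validF v0 ⟫ (D ∷ []) → Valid (decode D)
  valid⇒ D h = ⟪tails⟫⇒ entryF (decode D) (subst (λ D → ⟪ validF v0 ⟫ (D ∷ [])) (sym (⌈decode⌉ D)) h)

  ∈decode : ∀ {e} D → e ∈ᶜ D → e ∈ decode D
  ∈decode {e} D m = ∈ᶜ⇒∈ (decode D) (subst (e ∈ᶜ_) (sym (⌈decode⌉ D)) m)

module _ {O : Set} (χ : Tm O 1) where
  open Rules χ

  opaque
    -- t codes a derivation with tag 2 and an output, and d codes a derivation
    -- with tag 1 which contradicts a negative oracle answer used in t.
    refuteF : Fm O 3
    refuteF = neg (validF (fst v1) ∧ entryᵗ (lit 2) v0 v0 (snd v1) ∈ᶠ fst v1) ∨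
              (validF v2 ∧ ex v2 (ex v3 (entryᵗ (lit 1) v1 v1 v0 ∈ᶠ v4 ∧
                                         entryᵗ (lit 2) (lit ⌜ oracleᵖ ⌝) v1 (lit 0) ∈ᶠ fst v3)))

    -- The decidable matrix of a c.e. set: `w` packs a derivation, an element and the output on it.
    -- The last conjunct selects elements with first component `i`; for codes of potential
    -- embeddings that is the domain.
    searchF : ℕ → Fm O 2
    searchF c = validF (fst v1) ∧ entryᵗ (lit 1) (lit c) (fst (snd v1)) (snd (snd v1)) ∈ᶠ fst v1 ∧
                fst (fst (snd v1)) ≐ᶠ v0

module NormalForm (O : Set) (o : ℕ → ℕ) (χ : Tm O 1) (A : Pred ℕ 0ℓ)
  (χ-yes : ∀ {x} → A x → Semantics.⟦_⟧ O o χ (x ∷ []) ≡ 1)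
  (χ-no  : ∀ {x} → ¬ A x → Semantics.⟦_⟧ O o χ (x ∷ []) ≡ 0)
  (em : ExcludedMiddle 0ℓ) where

  open Semantics O o
  open ListSemantics O o
  open Rules χ
  open Derivations O o χ A χ-yes χ-no em

  Refutes : ℕ → ℕ → ℕ → Set
  Refutes n t d = ⟪ refuteF χ ⟫ (n ∷ t ∷ d ∷ [])

  opaque
    unfolding refuteF searchF

    -- The witness is a clean derivation. A refutation would prove by `sound₁` that a trusted
    -- negative answer is wrong.
    jump⇒ : ∀ {n} → (A ′ ′) n → ∃[ t ] (∀ d → ¬ Refutes n t d)
    jump⇒ {n} (p , refl , y , r) with derive₂ r
    ... | xs , v , clean , m = ⟨ ⌈ xs ⌉ , y ⟩ , unrefuted
      where
      D≡ : π₁ ⟨ ⌈ xs ⌉ , y ⟩ ≡ ⌈ xs ⌉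
      D≡ = π₁-⟨⟩ ⌈ xs ⌉ y
      unrefuted : ∀ d → ¬ Refutes n ⟨ ⌈ xs ⌉ , y ⟩ d
      unrefuted d (inj₁ ¬ok) = ¬ok
        ( subst (λ D → ⟪ validF v0 ⟫ (D ∷ [])) (sym D≡) (⟪tails⟫⇐ entryF xs v)
        , subst₂ (λ D y → entry 2 n n y ∈ᶜ D) (sym D≡) (sym (π₂-⟨⟩ ⌈ xs ⌉ y)) (∈⇒∈ᶜ {entry 2 n n y} m))
      unrefuted d (inj₂ (v′ , q , _ , u , _ , m₁ , m₂))
        with sound₁ (decode d) (valid⇒ d v′) q q u (∈decode {entry 1 q q u} d m₁)
      ... | p′ , e , r′ = clean q
        (∈ᶜ⇒∈ {entry 2 ⌜ oracleᵖ ⌝ q 0} xs (subst (entry 2 ⌜ oracleᵖ ⌝ q 0 ∈ᶜ_) D≡ m₂)) (p′ , e , u , r′)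

    -- If a negative answer in `t` were wrong, `derive₁` would supply a refutation; so an unrefuted
    -- `t` is clean and `sound₂` applies.
    jump⇐ : ∀ {n} t → (∀ d → ¬ Refutes n t d) → (A ′ ′) n
    jump⇐ {n} t unrefuted with em {P = ⟪ validF v0 ⟫ (π₁ t ∷ []) × entry 2 n n (π₂ t) ∈ᶜ π₁ t}
    -- An ill-formed `t` is refuted by every number, in particular by 0.
    ... | no ¬ok = ⊥-elim (unrefuted 0 (inj₁ ¬ok))
    ... | yes (v , m) with sound₂ (decode (π₁ t)) (valid⇒ (π₁ t) v) clean n n (π₂ t)
                                 (∈decode {entry 2 n n (π₂ t)} (π₁ t) m)
      where
      clean : Clean (decode (π₁ t))
      clean q m′ (p , refl , u , r) with derive₁ r
      ... | xs , v′ , _ , m₁ = unrefuted ⌈ xs ⌉ (inj₂ (⟪tails⟫⇐ entryF xs v′ ,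
        q , entry-input< 1 q q u {xs} m₁′ , u , entry-value< 1 q q u {xs} m₁′ , m₁′ ,
        subst (entry 2 ⌜ oracleᵖ ⌝ q 0 ∈ᶜ_) (⌈decode⌉ (π₁ t)) (∈⇒∈ᶜ {entry 2 ⌜ oracleᵖ ⌝ q 0} m′)))
        where
        m₁′ : entry 1 q q u ∈ᶜ ⌈ xs ⌉
        m₁′ = ∈⇒∈ᶜ {entry 1 q q u} m₁
    ... | p , e , r = p , e , π₂ t , r

    search-sound : ∀ p i w → ⟪ searchF χ ⌜ p ⌝ ⟫ (i ∷ w ∷ []) →
                   (∃[ y ] A ⊢ p [ π₁ (π₂ w) ]⇓ y) × π₁ (π₁ (π₂ w)) ≡ i
    search-sound p i w (v , m , e)
      with sound₁ (decode (π₁ w)) (valid⇒ (π₁ w) v) ⌜ p ⌝ (π₁ (π₂ w)) (π₂ (π₂ w))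
                  (∈decode {entry 1 ⌜ p ⌝ (π₁ (π₂ w)) (π₂ (π₂ w))} (π₁ w) m)
    ... | p′ , e′ , r with refl ← ⌜⌝-injective p p′ e′ = (_ , r) , e

    search-complete : ∀ p z {y} → A ⊢ p [ z ]⇓ y → ∃[ w ] ⟪ searchF χ ⌜ p ⌝ ⟫ (π₁ z ∷ w ∷ [])
    search-complete p z {y} r with derive₁ r
    ... | xs , v , _ , m = w ,
      subst (λ D → ⟪ validF v0 ⟫ (D ∷ [])) (sym e₁) (⟪tails⟫⇐ entryF xs v) ,
      subst₂ (λ D zy → entry 1 ⌜ p ⌝ (π₁ zy) (π₂ zy) ∈ᶜ D) (sym e₁) (sym e₂)
        (subst₂ (λ z y → entry 1 ⌜ p ⌝ z y ∈ᶜ ⌈ xs ⌉) (sym (π₁-⟨⟩ z y)) (sym (π₂-⟨⟩ z y))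
                (∈⇒∈ᶜ {entry 1 ⌜ p ⌝ z y} m)) ,
      cong π₁ (trans (cong π₁ e₂) (π₁-⟨⟩ z y))
      where
      w : ℕ
      w = ⟨ ⌈ xs ⌉ , ⟨ z , y ⟩ ⟩
      e₁ : π₁ w ≡ ⌈ xs ⌉
      e₁ = π₁-⟨⟩ ⌈ xs ⌉ ⟨ z , y ⟩
      e₂ : π₂ w ≡ ⟨ z , y ⟩
      e₂ = π₂-⟨⟩ ⌈ xs ⌉ ⟨ z , y ⟩

-- Unbounded search and the enumeration of c.e. sets

least : (f : ℕ → ℕ) → ∀ n → f n ≡ 0 → ∃[ m ] f m ≡ 0 × (∀ k → k < m → ∃[ v ] f k ≡ suc v)
least f n e = go n 0 (λ _ ()) (subst (λ m → f m ≡ 0) (sym (+-identityʳ n)) e)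
  where
  go : ∀ j m → (∀ k → k < m → ∃[ v ] f k ≡ suc v) → f (j + m) ≡ 0 →
       ∃[ m ] f m ≡ 0 × (∀ k → k < m → ∃[ v ] f k ≡ suc v)
  go zero    m b e = m , e , b
  go (suc j) m b e with f m in fm
  ... | zero  = m , fm , b
  ... | suc v = go j (suc m) b′ (trans (cong f (+-suc j m)) e)
    where
    b′ : ∀ k → k < suc m → ∃[ v ] f k ≡ suc v
    b′ k k≤m with m≤n⇒m<n∨m≡n (≤-pred k≤m)
    ... | inj₁ k<m  = b k k<m
    ... | inj₂ refl = v , fm

module _ {O : Set} where

  searchᵖ : Fm O 2 → Program
  -- Minimisation looks for the value 0, which codes truth; the inner pairs rebuild the environment
  -- `encode (i ∷ w ∷ [])` from `⟨ i , w ⟩`.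
  searchᵖ φ = minᵖ (compᵖ (compile (test φ)) (pairᵖ leftᵖ (pairᵖ rightᵖ zeroᵖ)))

  module _ {o : ℕ → ℕ} {S : Pred ℕ 0ℓ} (oracle : O → ∀ x → S ⊢ oracleᵖ [ x ]⇓ o x) where
    open Semantics O o

    search⇓ : ∀ (φ : Fm O 2) i → ∃[ w ] ⟪ φ ⟫ (i ∷ w ∷ []) →
              ∃[ w ] ⟪ φ ⟫ (i ∷ w ∷ []) × S ⊢ searchᵖ φ [ i ]⇓ w
    search⇓ φ i (w , h) with least (λ w → ⟦ test φ ⟧ (i ∷ w ∷ [])) w (test⇐ φ (i ∷ w ∷ []) h)
    ... | m , e , b = m , test⇒ φ (i ∷ m ∷ []) e ,
      min⇓ (value m e) (λ k k<m → proj₁ (b k k<m) , value k (proj₂ (b k k<m)))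
      where
      value : ∀ k {v} → ⟦ test φ ⟧ (i ∷ k ∷ []) ≡ v →
              S ⊢ compᵖ (compile (test φ)) (pairᵖ leftᵖ (pairᵖ rightᵖ zeroᵖ)) [ ⟨ i , k ⟩ ]⇓ v
      value k refl = comp⇓ (pair⇓ (left⇓ {x = i} {k}) (pair⇓ (right⇓ {x = i} {k}) zero⇓))
                           (compile⇓ oracle (test φ) (i ∷ k ∷ []))

module Search (em : ExcludedMiddle 0ℓ) {S A : Pred ℕ 0ℓ} (ce : S -CE A) where

  characteristic : ∀ x → Dec (S x) → ℕ
  characteristic x (yes _) = 1
  characteristic x (no _)  = 0

  χ : ℕ → ℕ
  χ x = characteristic x em

  χ-yes : ∀ {x} → S x → χ x ≡ 1
  χ-yes {x} h with em {P = S x}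
  ... | yes _ = refl
  ... | no ¬h = ⊥-elim (¬h h)

  χ-no : ∀ {x} → ¬ S x → χ x ≡ 0
  χ-no {x} ¬h with em {P = S x}
  ... | yes h = ⊥-elim (¬h h)
  ... | no _  = refl

  ask⇓ : ⊤ → ∀ x → S ⊢ oracleᵖ [ x ]⇓ χ x
  ask⇓ _ x with em {P = S x}
  ... | yes h = yes⇓ h
  ... | no ¬h = no⇓ ¬h

  open Semantics ⊤ χ
  open NormalForm ⊤ χ (ask tt v0) S χ-yes χ-no em

  enumeratorF : Fm ⊤ 2
  enumeratorF = searchF (ask tt v0) ⌜ proj₁ ce ⌝

  findᵖ : Program
  findᵖ = compᵖ leftᵖ (compᵖ rightᵖ (searchᵖ enumeratorF))

  find : ∀ i → ∃[ z ] A z × π₁ z ≡ i → ∃[ z ] (A z × π₁ z ≡ i) × S ⊢ findᵖ [ i ]⇓ z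
  find i (z₀ , a₀ , e₀) with to (proj₂ ce z₀) a₀
  ... | y , r with search-complete (proj₁ ce) z₀ r
  ... | w₀ , h₀ with search⇓ ask⇓ enumeratorF i (w₀ , subst (λ i → ⟪ enumeratorF ⟫ (i ∷ w₀ ∷ [])) e₀ h₀)
  ... | w , h , run with search-sound (proj₁ ce) i w h
  ... | halts , i≡ = π₁ (π₂ w) , (from (proj₂ ce (π₁ (π₂ w))) halts , i≡) ,
    comp⇓ (comp⇓ run (right⇓′ w)) (left⇓′ (π₂ w))

-- Structures of coloured components and their amalgamation

-- Every number is a binary relation symbol, later read as a sort by `Rel`. Without functions the
-- closure of a tuple consists of its entries, and finitely generated means finite.
𝓛 : Language
𝓛 = record
  { isRel = λ _ → true
  ; isFun = λ _ → false
  ; arity = λ _ → 2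
  ; disjoint = λ _ ()
  ; positive = λ _ _ → _
  ; rel-computable = constᵖ 1 , λ _ → (λ _ → const⇓ 1) , λ ¬t → ⊥-elim (¬t tt)
  ; fun-computable = zeroᵖ , λ _ → (λ ()) , λ _ → zero⇓
  ; arity-computable = constᵖ 2 , λ _ _ → const⇓ 2
  }

open Structure
open Embedding renaming (cong to map-cong; injective to map-injective)

pairRel : (A : Structure 𝓛) → ℕ → Carrier A → Carrier A → Set
pairRel A k x y = rel A (k , tt) (x ∷ y ∷ [])

embedding : (A B : Structure 𝓛) (h : Carrier A → Carrier B) →
            (∀ {x y} → _≈_ A x y → _≈_ B (h x) (h y)) →
            (∀ {x y} → _≈_ B (h x) (h y) → _≈_ A x y) →
            (∀ k x y → pairRel A k x y ⇔ pairRel B k (h x) (h y)) → Embedding A B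
embedding A B h h-cong h-injective h-rel = record
  { map       = h
  ; cong      = h-cong
  ; injective = h-injective
  ; onRel     = λ { (k , _) (x ∷ y ∷ []) → h-rel k x y }
  ; onFun     = λ { (_ , ()) _ }
  }

_∘ᴱ_ : {A B C : Structure 𝓛} → Embedding B C → Embedding A B → Embedding A C
_∘ᴱ_ {A} {B} {C} g f = embedding A C (λ x → map g (map f x)) (λ e → map-cong g (map-cong f e))
  (λ e → map-injective f (map-injective g e))
  (λ k x y → onRel g (k , tt) (map f x ∷ map f y ∷ []) ⇔-∘ onRel f (k , tt) (x ∷ y ∷ []))

inverse : {A B : Structure 𝓛} → A ≅ B → Embedding B A
inverse {A} {B} (f , surj) = embedding B A inv
  (λ {x} {y} e → map-injective f (Eq.trans B (proj₂ (surj x)) (Eq.trans B e (Eq.sym B (proj₂ (surj y))))))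
  (λ {x} {y} e → Eq.trans B (Eq.sym B (proj₂ (surj x))) (Eq.trans B (map-cong f e) (proj₂ (surj y))))
  (λ k x y → ⇔-sym (onRel f (k , tt) (inv x ∷ inv y ∷ []) ) ⇔-∘
    mk⇔ (rel-cong B (k , tt) (Eq.sym B (proj₂ (surj x)) ∷ Eq.sym B (proj₂ (surj y)) ∷ []))
        (rel-cong B (k , tt) (proj₂ (surj x) ∷ proj₂ (surj y) ∷ [])))
  where
  inv : Carrier B → Carrier A
  inv y = proj₁ (surj y)

Covers : (A : Structure 𝓛) → List (Carrier A) → Set
Covers A xs = ∀ x → ∃[ y ] y ∈ xs × _≈_ A y x

≈∈⇒Cl : (A : Structure 𝓛) → ∀ {xs x y} → y ∈ xs → _≈_ A y x → Cl A xs x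
≈∈⇒Cl A {x = x} y∈ e = resp (subst (λ z → _≈_ A z x) (lookup-index y∈) e) (gen (Any.index y∈))

Cl⇒≈∈ : (A : Structure 𝓛) → ∀ {xs x} → Cl A xs x → ∃[ y ] y ∈ xs × _≈_ A y x
Cl⇒≈∈ A {xs} (gen i) = List.lookup xs i , ∈-lookup i , Eq.refl A
Cl⇒≈∈ A (app (_ , ()) _)
Cl⇒≈∈ A (resp e c) with Cl⇒≈∈ A c
... | y , y∈ , e′ = y , y∈ , Eq.trans A e′ e

covers⇒generates : (A : Structure 𝓛) → ∀ {xs} → Covers A xs → Generates A xs
covers⇒generates A c x = let (y , y∈ , e) = c x in ≈∈⇒Cl A y∈ e

generates⇒covers : (A : Structure 𝓛) → ∀ {xs} → Generates A xs → Covers A xs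
generates⇒covers A g x = Cl⇒≈∈ A (g x)

-- Finiteness of structures enters the constructions through this: one stage serves all generators.
uniformly : {X : Set} {P : X → ℕ → Set} → (∀ {x s s′} → s ≤ s′ → P x s → P x s′) →
            (∀ x → ∃[ s ] P x s) → ∀ xs → ∃[ s ] (∀ {x} → x ∈ xs → P x s)
uniformly mono exists [] = 0 , λ ()
uniformly mono exists (x ∷ xs) with exists x | uniformly mono exists xs
... | s , p | s′ , ps = s ⊔ s′ , λ { (here refl) → mono (m≤m⊔n s s′) p
                                   ; (there x∈)  → mono (m≤n⊔m s s′) (ps x∈) }

-- Elements are numbers ⟨l, κ⟩ with a label l and a component
-- κ = ⟨q, ⟨c, ⟨s, u⟩⟩⟩ of kind q, colour c and stage s (u tells copies apart).
label component kind colour stage copy sort : ℕ → ℕ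
label x     = π₁ x
component x = π₂ x
kind κ      = π₁ κ
colour κ    = π₁ (π₂ κ)
stage κ     = π₁ (π₂ (π₂ κ))
copy κ      = π₂ (π₂ (π₂ κ))
sort x      = ⟨ kind (component x) , label x ⟩

mkComponent : ℕ → ℕ → ℕ → ℕ → ℕ
mkComponent q c s u = ⟨ q , ⟨ c , ⟨ s , u ⟩ ⟩ ⟩

module _ (q c s u : ℕ) where
  kind-mk : kind (mkComponent q c s u) ≡ q
  kind-mk = π₁-⟨⟩ q ⟨ c , ⟨ s , u ⟩ ⟩

  colour-mk : colour (mkComponent q c s u) ≡ c
  colour-mk = trans (cong π₁ (π₂-⟨⟩ q ⟨ c , ⟨ s , u ⟩ ⟩)) (π₁-⟨⟩ c ⟨ s , u ⟩)

  stage-mk : stage (mkComponent q c s u) ≡ s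
  stage-mk = trans (cong (λ z → π₁ (π₂ z)) (π₂-⟨⟩ q ⟨ c , ⟨ s , u ⟩ ⟩))
             (trans (cong π₁ (π₂-⟨⟩ c ⟨ s , u ⟩)) (π₁-⟨⟩ s u))

  copy-mk : copy (mkComponent q c s u) ≡ u
  copy-mk = trans (cong (λ z → π₂ (π₂ z)) (π₂-⟨⟩ q ⟨ c , ⟨ s , u ⟩ ⟩))
             (trans (cong π₂ (π₂-⟨⟩ c ⟨ s , u ⟩)) (π₂-⟨⟩ s u))

mk-η : ∀ κ → mkComponent (kind κ) (colour κ) (stage κ) (copy κ) ≡ κ
mk-η κ = trans (cong (λ z → ⟨ kind κ , ⟨ colour κ , z ⟩ ⟩) (⟨⟩-unpair (π₂ (π₂ κ))))
         (trans (cong ⟨ kind κ ,_⟩ (⟨⟩-unpair (π₂ κ))) (⟨⟩-unpair κ))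

-- The later stage makes room for further labels, and `u` renames copies so that components from
-- different sources stay apart.
shift : ℕ → (ℕ → ℕ) → ℕ → ℕ
shift T u κ = mkComponent (kind κ) (colour κ) (stage κ + T) (u (copy κ))

shift-injective : ∀ T u → (∀ {m n} → u m ≡ u n → m ≡ n) →
                  ∀ κ κ′ → shift T u κ ≡ shift T u κ′ → κ ≡ κ′
shift-injective T u u-injective κ κ′ e =
  trans (sym (mk-η κ)) (trans (go (field₄ kind kind-mk) (field₄ colour colour-mk)
    (+-cancelʳ-≡ T (stage κ) (stage κ′) (field₄ stage stage-mk)) (u-injective (field₄ copy copy-mk))) (mk-η κ′))
  where
  field₄ : ∀ (f : ℕ → ℕ) {g : ℕ → ℕ → ℕ → ℕ → ℕ} → (∀ q c s v → f (mkComponent q c s v) ≡ g q c s v) →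
           g (kind κ) (colour κ) (stage κ + T) (u (copy κ)) ≡ g (kind κ′) (colour κ′) (stage κ′ + T) (u (copy κ′))
  field₄ f f-mk = trans (sym (f-mk _ _ _ _)) (trans (cong f e) (f-mk _ _ _ _))
  go : ∀ {q c s v q′ c′ s′ v′} → q ≡ q′ → c ≡ c′ → s ≡ s′ → v ≡ v′ →
       mkComponent q c s v ≡ mkComponent q′ c′ s′ v′
  go refl refl refl refl = refl

double odd : ℕ → ℕ
double u = 2 * u
odd u    = suc (2 * u)

double-injective : ∀ {m n} → double m ≡ double n → m ≡ n
double-injective {m} {n} = *-cancelˡ-≡ m n 2

odd-injective : ∀ {m n} → odd m ≡ odd n → m ≡ n
odd-injective e = double-injective (suc-injective e)

double≢odd : ∀ T κ κ′ → shift T double κ ≢ shift T odd κ′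
double≢odd T κ κ′ e = even≢odd (copy κ) (copy κ′) (begin
  double (copy κ)           ≡⟨ sym (copy-mk (kind κ) (colour κ) (stage κ + T) (double (copy κ))) ⟩
  copy (shift T double κ)   ≡⟨ cong copy e ⟩
  copy (shift T odd κ′)     ≡⟨ copy-mk (kind κ′) (colour κ′) (stage κ′ + T) (odd (copy κ′)) ⟩
  odd (copy κ′)             ∎)
  where open ≡-Reasoning

-- On the diagonal this reveals the sort of an element, and off it whether two elements share a
-- component. Colour, stage and copy remain invisible.
Rel : ℕ → ℕ → ℕ → Set
Rel k x y = component x ≡ component y × sort x ≡ k

element-≡ : ∀ {x y} → component x ≡ component y → sort x ≡ sort y → x ≡ y
element-≡ {x} {y} e e′ = trans (sym (⟨⟩-unpair x)) (trans
  (cong₂ ⟨_,_⟩ (proj₂ (⟨⟩-injective {kind (component x)} {_} {kind (component y)} e′)) e) (⟨⟩-unpair y))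

-- Present q c s l: a component of kind q, colour c and stage s has an element
-- with label l.  A free label eventually occurs in every colour, whereas
-- another label determines the colour.
module Components
  (Present : ℕ → ℕ → ℕ → ℕ → Set)
  (present-monotone : ∀ q c l {s s′} → s ≤ s′ → Present q c s l → Present q c s′ l) where

  present-mono : ∀ {q c s s′ l} → s ≤ s′ → Present q c s l → Present q c s′ l
  present-mono {q} {c} {l = l} = present-monotone q c l

  Free : ℕ → ℕ → Set
  Free q l = ∀ c → ∃[ s ] Present q c s l

  Only : ℕ → ℕ → ℕ → Set
  Only q c l = ∀ c′ s → Present q c′ s l → c′ ≡ c

  -- In a neutral kind every finite component can be recoloured at a late enough stage; in a
  -- decisive kind every component can be extended so that its colour is fixed.
  Neutral Decisive : ℕ → Set
  Neutral q  = ∀ c s l → Present q c s l → Free q l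
  Decisive q = ∀ c → ∃[ l ] ∃[ s ] Present q c s l × Only q c l

  InDomain : ℕ → ℕ → Set
  InDomain κ l = Present (kind κ) (colour κ) (stage κ) l

  𝓓 : Pred ℕ 0ℓ
  𝓓 x = InDomain (component x) (label x)

  𝓜 : ωStructure 𝓛
  𝓜 = record
    { Dom = 𝓓
    ; interpretation = record
      { rel = λ { (k , _) (x ∷ y ∷ []) → Rel k (proj₁ x) (proj₁ y) }
      ; fun = λ { (_ , ()) _ }
      ; rel-cong = λ { (k , _) (refl ∷ refl ∷ []) r → r }
      ; fun-cong = λ { (_ , ()) _ }
      }
    }

  𝕄 : Structure 𝓛
  𝕄 = ωStructure.structure 𝓜

  element : ∀ l κ → InDomain κ l → ∃ 𝓓
  element l κ d = ⟨ l , κ ⟩ , subst₂ InDomain (sym (π₂-⟨⟩ l κ)) (sym (π₁-⟨⟩ l κ)) d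

  inComponent : ∀ {q c s} u {l} → Present q c s l → InDomain (mkComponent q c s u) l
  inComponent {q} {c} {s} u {l} p = subst (λ q → Present q (colour κ) (stage κ) l) (sym (kind-mk q c s u))
    (subst₂ (λ c s → Present q c s l) (sym (colour-mk q c s u)) (sym (stage-mk q c s u)) p)
    where κ = mkComponent q c s u

  -- Equality is pulled back as well, so `m` need not be injective: elements with the same image are
  -- identified without forming a quotient.
  pull : (X : Set) → (X → ∃ 𝓓) → Structure 𝓛
  pull X m = record
    { setoid = On.setoid (Structure.setoid 𝕄) m
    ; interpretation = record
      { rel = λ { (k , _) (x ∷ y ∷ []) → Rel k (proj₁ (m x)) (proj₁ (m y)) }
      ; fun = λ { (_ , ()) _ }
      ; rel-cong = λ { (k , _) (e ∷ e′ ∷ []) r → subst₂ (Rel k) e e′ r }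
      ; fun-cong = λ { (_ , ()) _ }
      }
    }

  pull-embedding : ∀ X m → Embedding (pull X m) 𝕄
  pull-embedding X m = embedding (pull X m) 𝕄 m (λ e → e) (λ e → e) (λ k x y → mk⇔ (λ r → r) (λ r → r))

  module _ (A : Structure 𝓛) (ι : Embedding A 𝕄) where
    value : Carrier A → ℕ
    value x = proj₁ (map ι x)

    component-at sort-at : Carrier A → ℕ
    component-at x = component (value x)
    sort-at x      = sort (value x)

    pairRel⇔ : ∀ k x y → pairRel A k x y ⇔ Rel k (value x) (value y)
    pairRel⇔ k x y = onRel ι (k , tt) (x ∷ y ∷ [])

    into-pull : ∀ {X} (m : X → ∃ 𝓓) (h : Carrier A → X) →
      (∀ x → sort (proj₁ (m (h x))) ≡ sort-at x) →
      (∀ x y → component (proj₁ (m (h x))) ≡ component (proj₁ (m (h y))) ⇔ component-at x ≡ component-at y) →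
      Embedding A (pull X m)
    into-pull {X} m h sorts components = embedding A (pull X m) h
      (λ {x} {y} e → let e′ = map-cong ι e in
        element-≡ (from (components x y) (cong component e′))
                  (trans (sorts x) (trans (cong sort e′) (sym (sorts y)))))
      (λ {x} {y} e → map-injective ι (element-≡ (to (components x y) (cong component e))
                  (trans (sym (sorts x)) (trans (cong sort e) (sorts y)))))
      (λ k x y → mk⇔
        (λ r → let (e , e′) = to (pairRel⇔ k x y) r in from (components x y) e , trans (sorts x) e′)
        (λ (e , e′) → from (pairRel⇔ k x y) (to (components x y) e , trans (sym (sorts x)) e′)))

  module _ {A B : Structure 𝓛} (ιA : Embedding A 𝕄) (ιB : Embedding B 𝕄) (f : Embedding A B) where

    -- Relation `k` holds of the pair of an element with itself only if `k` is its sort.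
    sort-preserved : ∀ x → sort-at B ιB (map f x) ≡ sort-at A ιA x
    sort-preserved x = proj₂ (to (pairRel⇔ B ιB k (map f x) (map f x))
      (to (onRel f (k , tt) (x ∷ x ∷ [])) (from (pairRel⇔ A ιA k x x) (refl , refl))))
      where k = sort-at A ιA x

    component-preserved : ∀ x y → component-at B ιB (map f x) ≡ component-at B ιB (map f y) ⇔
                                  component-at A ιA x ≡ component-at A ιA y
    component-preserved x y = mk⇔
      (λ e → proj₁ (to (pairRel⇔ A ιA k x y) (from (onRel f (k , tt) (x ∷ y ∷ []))
               (from (pairRel⇔ B ιB k (map f x) (map f y)) (e , sort-preserved x)))))
      (λ e → proj₁ (to (pairRel⇔ B ιB k (map f x) (map f y)) (to (onRel f (k , tt) (x ∷ y ∷ []))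
               (from (pairRel⇔ A ιA k x y) (e , refl)))))
      where k = sort-at A ιA x

    kind-preserved : ∀ x → kind (component-at B ιB (map f x)) ≡ kind (component-at A ιA x)
    kind-preserved x = proj₁ (⟨⟩-injective (sort-preserved x))

    label-preserved : ∀ x → label (value B ιB (map f x)) ≡ label (value A ιA x)
    label-preserved x = proj₂ (⟨⟩-injective {kind (component-at B ιB (map f x))} {_}
                                            {kind (component-at A ιA x)} (sort-preserved x))

  𝓚 : Age 𝓛
  𝓚 = record
    { Member            = λ A → FinitelyGenerated A × Embedding A 𝕄
    ; finitelyGenerated = proj₁
    ; closed            = λ {A} {B} i ((xs , g) , ι) →
        let (f , surj) = i in
        (List.map (map f) xs , covers⇒generates B λ y →
          let (x , x∈ , e) = generates⇒covers A g (proj₁ (surj y)) in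
          map f x , ∈-map⁺ (map f) x∈ , Eq.trans B (map-cong f e) (proj₂ (surj y))) ,
        ι ∘ᴱ inverse i
    }

  module _ (em : ExcludedMiddle 0ℓ) where

    sort-⟨⟩ : ∀ l κ → sort ⟨ l , κ ⟩ ≡ ⟨ kind κ , l ⟩
    sort-⟨⟩ l κ = cong₂ (λ κ l → ⟨ kind κ , l ⟩) (π₂-⟨⟩ l κ) (π₁-⟨⟩ l κ)

    sort-shift : ∀ T u l κ → sort ⟨ l , shift T u κ ⟩ ≡ ⟨ kind κ , l ⟩
    sort-shift T u l κ = trans (sort-⟨⟩ l (shift T u κ))
      (cong ⟨_, l ⟩ (kind-mk (kind κ) (colour κ) (stage κ + T) (u (copy κ))))

    inDomain-shift : ∀ T u κ {l} → Present (kind κ) (colour κ) (stage κ + T) l → InDomain (shift T u κ) l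
    inDomain-shift T u κ = inComponent {kind κ} {colour κ} {stage κ + T} (u (copy κ))

    present-later : ∀ {q c s T l} → Present q c T l → Present q c (s + T) l
    present-later {s = s} {T} = present-mono (m≤n+m T s)

    pull-finitelyGenerated : ∀ X m xs → (∀ x → ∃[ y ] y ∈ xs × proj₁ (m y) ≡ proj₁ (m x)) →
                             FinitelyGenerated (pull X m)
    pull-finitelyGenerated X m xs c = xs , covers⇒generates (pull X m) c

    -- Amalgamation bases

    SettledAt : (A : Structure 𝓛) (ι : Embedding A 𝕄) → Carrier A → Set
    SettledAt A ι x = let κ = component-at A ι x in
      Neutral (kind κ) ⊎
      (∃[ y ] ∃[ c ] component-at A ι y ≡ κ × Only (kind κ) c (label (value A ι y)))

    Settled : (A : Structure 𝓛) → Embedding A 𝕄 → Set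
    Settled A ι = ∀ x → SettledAt A ι x

    -- All of `B` moves to even copies at later stages. A component of `C` that meets the image of
    -- `A` is absorbed by the matching component of `B`; the others move to odd copies. Absorption
    -- is possible because the labels concerned are present in the colour used by `B` from stage `T`
    -- on.
    module Amalgam {A B C : Structure 𝓛} (ιA : Embedding A 𝕄) (settled : Settled A ιA)
                   (mB : Age.Member 𝓚 B) (mC : Age.Member 𝓚 C) (f : Embedding A B) (g : Embedding A C) where

      bs : List (Carrier B)
      bs = proj₁ (proj₁ mB)

      cs : List (Carrier C)
      cs = proj₁ (proj₁ mC)

      ιB : Embedding B 𝕄
      ιB = proj₂ mB

      ιC : Embedding C 𝕄
      ιC = proj₂ mC

      valueB : Carrier B → ℕ
      valueB = value B ιB
      κB : Carrier B → ℕ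
      κB = component-at B ιB

      valueC : Carrier C → ℕ
      valueC = value C ιC
      κC : Carrier C → ℕ
      κC = component-at C ιC

      κf⇔κg : ∀ a a′ → κB (map f a) ≡ κB (map f a′) ⇔ κC (map g a) ≡ κC (map g a′)
      κf⇔κg a a′ = ⇔-sym (component-preserved ιA ιC g a a′) ⇔-∘ component-preserved ιA ιB f a a′

      kind-f≡g : ∀ a → kind (κB (map f a)) ≡ kind (κC (map g a))
      kind-f≡g a = trans (kind-preserved ιA ιB f a) (sym (kind-preserved ιA ιC g a))

      Meets : Carrier C → Carrier A → Set
      Meets z a = κC (map g a) ≡ κC z

      -- The colour of an element is settled by A, or else its label is free.
      present-in-B : ∀ z a → Meets z a →
                     ∃[ s ] Present (kind (κB (map f a))) (colour (κB (map f a))) s (label (valueC z))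
      present-in-B z a e = go (settled a)
        where
        κ  = component-at A ιA a
        κ₁ = κB (map f a)
        κ₂ = κC z
        kind₁ : kind κ₁ ≡ kind κ
        kind₁ = kind-preserved ιA ιB f a
        kind₂ : kind κ₂ ≡ kind κ
        kind₂ = trans (cong kind (sym e)) (kind-preserved ιA ιC g a)
        inC : Present (kind κ) (colour κ₂) (stage κ₂) (label (valueC z))
        inC = subst (λ q → Present q (colour κ₂) (stage κ₂) (label (valueC z))) kind₂ (proj₂ (map ιC z))
        go : SettledAt A ιA a → ∃[ s ] Present (kind κ₁) (colour κ₁) s (label (valueC z))
        go (inj₁ neutral) with neutral (colour κ₂) (stage κ₂) (label (valueC z)) inC (colour κ₁)
        ... | s , p = s , subst (λ q → Present q (colour κ₁) s (label (valueC z))) (sym kind₁) p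
        go (inj₂ (y , c , e′ , only)) = stage κ₂ , subst₂ (λ q c → Present q c (stage κ₂) (label (valueC z)))
            (sym kind₁) (trans colour₂ (sym colour₁)) inC
          where
          colour-by : ∀ {D} (ιD : Embedding D 𝕄) (h : Embedding A D) →
                      colour (component-at D ιD (map h a)) ≡ c
          colour-by {D} ιD h = only (colour κ′) (stage κ′)
            (subst₂ (λ q l → Present q (colour κ′) (stage κ′) l)
              (kind-preserved ιA ιD h a) (label-preserved ιA ιD h y)
              (subst (λ κ → InDomain κ (label (value D ιD (map h y))))
                     (from (component-preserved ιA ιD h y a) e′) (proj₂ (map ιD (map h y)))))
            where κ′ = component-at D ιD (map h a)
          colour₁ : colour κ₁ ≡ c
          colour₁ = colour-by ιB f
          colour₂ : colour κ₂ ≡ c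
          colour₂ = trans (cong colour (sym e)) (colour-by ιC g)

      Reached : Carrier C → ℕ → Set
      Reached z s = ∀ a → Meets z a → Present (kind (κB (map f a))) (colour (κB (map f a))) s (label (valueC z))

      reached : ∀ z → ∃[ s ] Reached z s
      reached z with em {P = ∃ (Meets z)}
      ... | no ¬m       = 0 , λ a e → ⊥-elim (¬m (a , e))
      ... | yes (a , e) with present-in-B z a e
      -- All `a′` that `z` meets have their images in the same component of `B`, so the stage found
      -- for one of them serves all.
      ... | s , p = s , λ a′ e′ → subst (λ κ → Present (kind κ) (colour κ) s (label (valueC z)))
                                    (from (κf⇔κg a a′) (trans e (sym e′))) p

      limit : ∃[ T ] (∀ z → Reached z T)
      limit with uniformly {P = Reached} (λ l r a e → present-mono l (r a e)) reached cs
      ... | T , h = T , λ z a e →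
        let (z′ , z′∈ , z′≈z) = generates⇒covers C (proj₂ (proj₁ mC)) z
            z′≡z = map-cong ιC z′≈z
        in subst (Present (kind (κB (map f a))) (colour (κB (map f a))) T) (cong label z′≡z)
             (h z′∈ a (trans e (sym (cong component z′≡z))))

      T : ℕ
      T = proj₁ limit

      moveB : Carrier B → ∃ 𝓓
      moveB y = element (label (valueB y)) (shift T double (κB y))
        (inDomain-shift T double (κB y) (present-mono (m≤m+n (stage (κB y)) T) (proj₂ (map ιB y))))

      -- The decision is an argument so that proofs can split on it; `move` supplies `em`. The
      -- target does not depend on which `a` the decision provides, by `κf⇔κg`.
      moveC : ∀ z → Dec (∃ (Meets z)) → ∃ 𝓓
      moveC z (yes (a , e)) = element (label (valueC z)) (shift T double (κB (map f a)))
        (inDomain-shift T double (κB (map f a)) (present-later {s = stage (κB (map f a))} (proj₂ limit z a e)))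
      moveC z (no _)        = element (label (valueC z)) (shift T odd (κC z))
        (inDomain-shift T odd (κC z) (present-mono (m≤m+n (stage (κC z)) T) (proj₂ (map ιC z))))

      shiftC : ∀ z → Dec (∃ (Meets z)) → ℕ
      shiftC z (yes (a , e)) = shift T double (κB (map f a))
      shiftC z (no _)        = shift T odd (κC z)

      component-moveC : ∀ z d → component (proj₁ (moveC z d)) ≡ shiftC z d
      component-moveC z (yes (a , e)) = π₂-⟨⟩ (label (valueC z)) (shift T double (κB (map f a)))
      component-moveC z (no _)        = π₂-⟨⟩ (label (valueC z)) (shift T odd (κC z))

      component-moveB : ∀ y → component (proj₁ (moveB y)) ≡ shift T double (κB y)
      component-moveB y = π₂-⟨⟩ (label (valueB y)) (shift T double (κB y))

      sort-moveB : ∀ y → sort (proj₁ (moveB y)) ≡ sort (valueB y)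
      sort-moveB y = sort-shift T double (label (valueB y)) (κB y)

      sort-moveC : ∀ z d → sort (proj₁ (moveC z d)) ≡ sort (valueC z)
      sort-moveC z (yes (a , e)) = trans (sort-shift T double (label (valueC z)) (κB (map f a)))
        (cong ⟨_, label (valueC z) ⟩ (trans (kind-f≡g a) (cong kind e)))
      sort-moveC z (no _) = sort-shift T odd (label (valueC z)) (κC z)

      shiftC-injective : ∀ z d z′ d′ → shiftC z d ≡ shiftC z′ d′ ⇔ κC z ≡ κC z′
      shiftC-injective z (yes (a , e)) z′ (yes (a′ , e′)) = mk⇔
        (λ h → trans (sym e) (trans (to (κf⇔κg a a′)
          (shift-injective T double double-injective (κB (map f a)) (κB (map f a′)) h)) e′))
        (λ h → cong (shift T double) (from (κf⇔κg a a′) (trans e (trans h (sym e′)))))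
      shiftC-injective z (yes (a , e)) z′ (no ¬m) = mk⇔
        (λ h → ⊥-elim (double≢odd T (κB (map f a)) (κC z′) h))
        (λ h → ⊥-elim (¬m (a , trans e h)))
      shiftC-injective z (no ¬m) z′ (yes (a , e)) = mk⇔
        (λ h → ⊥-elim (double≢odd T (κB (map f a)) (κC z) (sym h)))
        (λ h → ⊥-elim (¬m (a , trans e (sym h))))
      shiftC-injective z (no _) z′ (no _) = mk⇔ (shift-injective T odd odd-injective (κC z) (κC z′)) (cong (shift T odd))

      move : Carrier B ⊎ Carrier C → ∃ 𝓓
      move (inj₁ y) = moveB y
      move (inj₂ z) = moveC z em

      D : Structure 𝓛
      D = pull (Carrier B ⊎ Carrier C) move

      α : Embedding B D
      α = into-pull B ιB move inj₁ sort-moveB (λ y y′ → mk⇔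
        (λ e → shift-injective T double double-injective (κB y) (κB y′)
          (trans (sym (component-moveB y)) (trans e (component-moveB y′))))
        (λ e → trans (component-moveB y) (trans (cong (shift T double) e) (sym (component-moveB y′)))))

      β : Embedding C D
      β = into-pull C ιC move inj₂ (λ z → sort-moveC z em) (λ z z′ → mk⇔
        (λ e → to (shiftC-injective z em z′ em)
          (trans (sym (component-moveC z em)) (trans e (component-moveC z′ em))))
        (λ e → trans (component-moveC z em)
          (trans (from (shiftC-injective z em z′ em) e) (sym (component-moveC z′ em)))))

      member : Age.Member 𝓚 D
      member = pull-finitelyGenerated _ move (List.map inj₁ bs ++ List.map inj₂ cs) covers ,
               pull-embedding _ move
        where
        covers : ∀ x → ∃[ y ] y ∈ List.map inj₁ bs ++ List.map inj₂ cs × proj₁ (move y) ≡ proj₁ (move x)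
        covers (inj₁ y) with generates⇒covers B (proj₂ (proj₁ mB)) y
        ... | y′ , y′∈ , e = inj₁ y′ , ∈-++⁺ˡ (∈-map⁺ inj₁ y′∈) , map-cong α e
        covers (inj₂ z) with generates⇒covers C (proj₂ (proj₁ mC)) z
        ... | z′ , z′∈ , e = inj₂ z′ , ∈-++⁺ʳ (List.map inj₁ bs) (∈-map⁺ inj₂ z′∈) , map-cong β e

      commutes : ∀ a → proj₁ (moveB (map f a)) ≡ proj₁ (moveC (map g a) em)
      commutes a = element-≡
        (trans (component-moveB (map f a)) (trans (same em) (sym (component-moveC (map g a) em))))
        (trans (sort-moveB (map f a)) (trans (trans (sort-preserved ιA ιB f a) (sym (sort-preserved ιA ιC g a)))
          (sym (sort-moveC (map g a) em))))
        where
        same : ∀ d → shift T double (κB (map f a)) ≡ shiftC (map g a) d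
        same (yes (a′ , e)) = cong (shift T double) (from (κf⇔κg a a′) (sym e))
        same (no ¬m)        = ⊥-elim (¬m (a , refl))

    settled⇒base : ∀ A → FinitelyGenerated A → (ι : Embedding A 𝕄) → Settled A ι → AmalgamationBase 𝓚 A
    settled⇒base A fg ι settled = (fg , ι) , λ B C mB mC f g →
      let open Amalgam {A} {B} {C} ι settled mB mC f g in D , member , α , β , commutes

    module Completion (neutral-or-decisive : ∀ q → Neutral q ⊎ Decisive q)
                      (A : Structure 𝓛) (mA : Age.Member 𝓚 A) where

      as : List (Carrier A)
      as = proj₁ (proj₁ mA)

      ι : Embedding A 𝕄
      ι = proj₂ mA

      κ : Carrier A → ℕ
      κ = component-at A ι

      -- In a neutral kind nothing has to be added; repeating the label of `x` lets the carrier be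
      -- `A ⊎ A` in all cases.
      settling : ∀ x → Neutral (kind (component x)) ⊎ Decisive (kind (component x)) → ℕ
      settling x (inj₁ _) = label x
      settling x (inj₂ d) = proj₁ (d (colour (component x)))

      settler : ℕ → ℕ
      settler x = settling x (neutral-or-decisive (kind (component x)))

      SettledBy : ℕ → ℕ → Set
      SettledBy x s = Present (kind (component x)) (colour (component x)) s (settler x)

      settledBy : ∀ a → ∃[ s ] SettledBy (value A ι a) s
      settledBy a = go (neutral-or-decisive (kind (κ a)))
        where
        go : ∀ d → ∃[ s ] Present (kind (κ a)) (colour (κ a)) s (settling (value A ι a) d)
        go (inj₁ _) = stage (κ a) , proj₂ (map ι a)
        go (inj₂ d) = proj₁ (proj₂ (d (colour (κ a)))) , proj₁ (proj₂ (proj₂ (d (colour (κ a)))))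

      limit : ∃[ T ] (∀ a → SettledBy (value A ι a) T)
      limit with uniformly {P = λ a → SettledBy (value A ι a)} (λ l → present-mono l) settledBy as
      ... | T , h = T , λ a → let (a′ , a′∈ , e) = generates⇒covers A (proj₂ (proj₁ mA)) a in
        subst (λ x → SettledBy x T) (map-cong ι e) (h a′∈)

      T : ℕ
      T = proj₁ limit

      move : Carrier A ⊎ Carrier A → ∃ 𝓓
      move (inj₁ a) = element (label (value A ι a)) (shift T double (κ a))
        (inDomain-shift T double (κ a) (present-mono (m≤m+n (stage (κ a)) T) (proj₂ (map ι a))))
      move (inj₂ a) = element (settler (value A ι a)) (shift T double (κ a))
        (inDomain-shift T double (κ a) (present-later {s = stage (κ a)} (proj₂ limit a)))

      A⁺ : Structure 𝓛
      A⁺ = pull (Carrier A ⊎ Carrier A) move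

      ι⁺ : Embedding A⁺ 𝕄
      ι⁺ = pull-embedding _ move

      extend : Embedding A A⁺
      extend = into-pull A ι move inj₁
        (λ a → sort-shift T double (label (value A ι a)) (κ a))
        (λ a a′ → mk⇔
          (λ e → shift-injective T double double-injective (κ a) (κ a′)
            (trans (sym (component-move a)) (trans e (component-move a′))))
          (λ e → trans (component-move a) (trans (cong (shift T double) e) (sym (component-move a′)))))
        where
        component-move : ∀ a → component (proj₁ (move (inj₁ a))) ≡ shift T double (κ a)
        component-move a = π₂-⟨⟩ (label (value A ι a)) (shift T double (κ a))

      finitelyGenerated⁺ : FinitelyGenerated A⁺
      finitelyGenerated⁺ =
        pull-finitelyGenerated _ move (List.map inj₁ as ++ List.map inj₂ as) covers
        where
        covers : ∀ x → ∃[ y ] y ∈ List.map inj₁ as ++ List.map inj₂ as × proj₁ (move y) ≡ proj₁ (move x)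
        covers (inj₁ a) with generates⇒covers A (proj₂ (proj₁ mA)) a
        ... | a′ , a′∈ , e = inj₁ a′ , ∈-++⁺ˡ (∈-map⁺ inj₁ a′∈) , map-cong extend e
        covers (inj₂ a) with generates⇒covers A (proj₂ (proj₁ mA)) a
        ... | a′ , a′∈ , e = inj₂ a′ , ∈-++⁺ʳ (List.map inj₁ as) (∈-map⁺ inj₂ a′∈) ,
          cong (λ x → ⟨ settler x , shift T double (component x) ⟩) (map-cong ι e)

      settled⁺ : Settled A⁺ ι⁺
      settled⁺ = λ { (inj₁ a) → settle (inj₁ a) a (π₂-⟨⟩ (label (value A ι a)) (shift T double (κ a)))
                   ; (inj₂ a) → settle (inj₂ a) a (π₂-⟨⟩ (settler (value A ι a)) (shift T double (κ a))) }
        where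
        settle : ∀ x a → component-at A⁺ ι⁺ x ≡ shift T double (κ a) →
                 SettledAt A⁺ ι⁺ x
        settle x a e = go (neutral-or-decisive (kind (κ a))) refl
          where
          kind-x : kind (component-at A⁺ ι⁺ x) ≡ kind (κ a)
          kind-x = trans (cong kind e) (kind-mk (kind (κ a)) (colour (κ a)) (stage (κ a) + T) (double (copy (κ a))))
          go : ∀ d → neutral-or-decisive (kind (κ a)) ≡ d → SettledAt A⁺ ι⁺ x
          go (inj₁ n) _  = inj₁ (subst Neutral (sym kind-x) n)
          go (inj₂ d) eq = inj₂ (inj₂ a , colour (κ a) ,
            trans (π₂-⟨⟩ (settler (value A ι a)) (shift T double (κ a))) (sym e) ,
            subst₂ (λ q l → Only q (colour (κ a)) l) (sym kind-x)
              (sym (trans (π₁-⟨⟩ (settler (value A ι a)) (shift T double (κ a))) (cong (settling (value A ι a)) eq)))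
              (proj₂ (proj₂ (proj₂ (d (colour (κ a)))))))

    cofinal-amalgamation : (∀ q → Neutral q ⊎ Decisive q) → CAP 𝓚
    cofinal-amalgamation nd A mA = A⁺ , settled⇒base A⁺ finitelyGenerated⁺ ι⁺ settled⁺ , extend
      where open Completion nd A mA

    -- Otherwise the component of x could be completed in two different colours.
    module Reading (free-or-only : ∀ q l → Free q l ⊎ ∃[ c ] Only q c l)
      (A : Structure 𝓛) (base : AmalgamationBase 𝓚 A) (ι : Embedding A 𝕄) (x : Carrier A)
      (decisive : Decisive (kind (component-at A ι x)))
      (undecided : ∀ y c → component-at A ι y ≡ component-at A ι x →
                   ¬ Only (kind (component-at A ι x)) c (label (value A ι y))) where

      as : List (Carrier A)
      as = proj₁ (proj₁ (proj₁ base))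

      κ : Carrier A → ℕ
      κ = component-at A ι

      q : ℕ
      q = kind (κ x)

      free : ∀ y → κ y ≡ κ x → Free q (label (value A ι y))
      free y e with free-or-only q (label (value A ι y))
      ... | inj₁ free       = free
      ... | inj₂ (c , only) = ⊥-elim (undecided y c e only)

      -- The labels in the component of `x` are all free, so at a late stage they are present in
      -- colour `c`. The component is replaced by one of that colour, and the added label `l` makes
      -- the colour irrevocable.
      module Recoloured (c : ℕ) where

        l : ℕ
        l = proj₁ (decisive c)

        Recoloured : Carrier A → ℕ → Set
        Recoloured y s = κ y ≡ κ x → Present q c s (label (value A ι y))

        limit : ∃[ T ] (Present q c T l × ∀ y → Recoloured y T)
        limit with uniformly {P = Recoloured} (λ le h e → present-mono le (h e)) recoloured as
          where
          recoloured : ∀ y → ∃[ s ] Recoloured y s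
          recoloured y with κ y ≟ κ x
          ... | no ≢  = 0 , λ e → ⊥-elim (≢ e)
          ... | yes e = proj₁ (free y e c) , λ _ → proj₂ (free y e c)
        ... | T , h = proj₁ (proj₂ (decisive c)) ⊔ T ,
          present-mono (m≤m⊔n (proj₁ (proj₂ (decisive c))) T) (proj₁ (proj₂ (proj₂ (decisive c)))) ,
          λ y e → present-mono (m≤n⊔m (proj₁ (proj₂ (decisive c))) T)
            (let (y′ , y′∈ , y′≈y) = generates⇒covers A (proj₂ (proj₁ (proj₁ base))) y
                 y′≡y = map-cong ι y′≈y
             in subst (Present q c T) (cong label y′≡y) (h y′∈ (trans (cong component y′≡y) e)))

        T : ℕ
        T = proj₁ limit

        κ₀ : ℕ
        κ₀ = mkComponent q c 0 0

        new : ℕ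
        -- The odd copy number separates the new component from the remaining ones, which receive
        -- even copies.
        new = shift T odd κ₀

        new-domain : ∀ {l} → Present q c T l → InDomain new l
        new-domain {l} p = inDomain-shift T odd κ₀
          (subst₂ (λ q c → Present q c (stage κ₀ + T) l) (sym (kind-mk q c 0 0)) (sym (colour-mk q c 0 0))
                  (present-later {s = stage κ₀} p))

        kind-new : kind new ≡ q
        kind-new = trans (kind-mk (kind κ₀) (colour κ₀) (stage κ₀ + T) (odd (copy κ₀))) (kind-mk q c 0 0)

        target : ∀ y → Dec (κ y ≡ κ x) → ℕ
        target y (yes _) = new
        target y (no _)  = shift T double (κ y)

        target-domain : ∀ y d → InDomain (target y d) (label (value A ι y))
        target-domain y (yes e) = new-domain (proj₂ (proj₂ limit) y e)
        target-domain y (no _)  = inDomain-shift T double (κ y)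
          (present-mono (m≤m+n (stage (κ y)) T) (proj₂ (map ι y)))

        target-kind : ∀ y d → kind (target y d) ≡ kind (κ y)
        target-kind y (yes e) = trans kind-new (sym (cong kind e))
        target-kind y (no _)  = kind-mk (kind (κ y)) (colour (κ y)) (stage (κ y) + T) (double (copy (κ y)))

        target-≡ : ∀ y d y′ d′ → target y d ≡ target y′ d′ ⇔ κ y ≡ κ y′
        target-≡ y (yes e) y′ (yes e′) = mk⇔ (λ _ → trans e (sym e′)) (λ _ → refl)
        target-≡ y (yes e) y′ (no ≢)   = mk⇔
          (λ h → ⊥-elim (double≢odd T (κ y′) κ₀ (sym h)))
          (λ h → ⊥-elim (≢ (trans (sym h) e)))
        target-≡ y (no ≢)  y′ (yes e)  = mk⇔
          (λ h → ⊥-elim (double≢odd T (κ y) κ₀ h))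
          (λ h → ⊥-elim (≢ (trans h e)))
        target-≡ y (no _)  y′ (no _)   = mk⇔
          (shift-injective T double double-injective (κ y) (κ y′)) (cong (shift T double))

        move : Carrier A ⊎ ⊤ → ∃ 𝓓
        move (inj₁ y) = element (label (value A ι y)) (target y (κ y ≟ κ x)) (target-domain y (κ y ≟ κ x))
        move (inj₂ _) = element l new (new-domain (proj₁ (proj₂ limit)))

        B : Structure 𝓛
        B = pull (Carrier A ⊎ ⊤) move

        ιB : Embedding B 𝕄
        ιB = pull-embedding _ move

        component-move : ∀ y → component-at B ιB (inj₁ y) ≡ target y (κ y ≟ κ x)
        component-move y = π₂-⟨⟩ (label (value A ι y)) (target y (κ y ≟ κ x))

        f : Embedding A B
        f = into-pull A ι move inj₁
          (λ y → trans (sort-⟨⟩ (label (value A ι y)) (target y (κ y ≟ κ x)))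
                       (cong ⟨_, label (value A ι y) ⟩ (target-kind y (κ y ≟ κ x))))
          (λ y y′ → mk⇔
            (λ e → to (target-≡ y (κ y ≟ κ x) y′ (κ y′ ≟ κ x))
              (trans (sym (component-move y)) (trans e (component-move y′))))
            (λ e → trans (component-move y)
              (trans (from (target-≡ y (κ y ≟ κ x) y′ (κ y′ ≟ κ x)) e) (sym (component-move y′)))))

        member : Age.Member 𝓚 B
        member = pull-finitelyGenerated _ move (inj₂ tt ∷ List.map inj₁ as) covers , ιB
          where
          covers : ∀ z → ∃[ y ] y ∈ inj₂ tt ∷ List.map inj₁ as × proj₁ (move y) ≡ proj₁ (move z)
          covers (inj₂ tt) = inj₂ tt , here refl , refl
          covers (inj₁ y) with generates⇒covers A (proj₂ (proj₁ (proj₁ base))) y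
          ... | y′ , y′∈ , e = inj₁ y′ , there (∈-map⁺ inj₁ y′∈) , map-cong f e

        same-component : component-at B ιB (inj₁ x) ≡ component-at B ιB (inj₂ tt)
        same-component = trans (component-move x) (trans (go (κ x ≟ κ x)) (sym (π₂-⟨⟩ l new)))
          where
          go : ∀ d → target x d ≡ new
          go (yes _) = refl
          go (no ≢)  = ⊥-elim (≢ refl)

        colour-in : ∀ {D} (ιD : Embedding D 𝕄) (α : Embedding B D) →
                    colour (component-at D ιD (map α (inj₁ x))) ≡ c
        colour-in {D} ιD α = trans
          (cong colour (from (component-preserved ιB ιD α (inj₁ x) (inj₂ tt)) same-component))
          (proj₂ (proj₂ (proj₂ (decisive c))) (colour κ′) (stage κ′)
            (subst₂ (λ q l → Present q (colour κ′) (stage κ′) l) kind-z label-z (proj₂ (map ιD (map α (inj₂ tt))))))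
          where
          κ′ = component-at D ιD (map α (inj₂ tt))
          kind-z : kind κ′ ≡ q
          kind-z = trans (kind-preserved ιB ιD α (inj₂ tt)) (trans (cong kind (π₂-⟨⟩ l new)) kind-new)
          label-z : label (value D ιD (map α (inj₂ tt))) ≡ l
          label-z = trans (label-preserved ιB ιD α (inj₂ tt)) (π₁-⟨⟩ l new)

      contradiction : ⊥
      -- Any two colours would do. In an amalgam the image of `x` would have both.
      contradiction with proj₂ base R₀.B R₁.B R₀.member R₁.member R₀.f R₁.f
        where
        module R₀ = Recoloured 0
        module R₁ = Recoloured 1
      ... | D , (_ , ιD) , α , β , e = 0≢1+n (trans (sym (Recoloured.colour-in 0 ιD α))
        (trans (cong (λ z → colour (component z)) (map-cong ιD (e x))) (Recoloured.colour-in 1 ιD β)))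

    base⇒decided : (∀ q l → Free q l ⊎ ∃[ c ] Only q c l) →
      ∀ A → AmalgamationBase 𝓚 A → (ι : Embedding A 𝕄) → ∀ x → Decisive (kind (component-at A ι x)) →
      ∃[ y ] ∃[ c ] component-at A ι y ≡ component-at A ι x ×
                    Only (kind (component-at A ι x)) c (label (value A ι y))
    base⇒decided fo A base ι x decisive = decidable-stable em λ ¬d →
      Reading.contradiction fo A base ι x decisive (λ y c e o → ¬d (y , c , e , o))

-- Computability of the canonical age

open Semantics ⊥ (λ _ → 0)
open ListSemantics ⊥ (λ _ → 0)

-- The parameter `i` is built into the program, as in the s-m-n theorem. `specialiseᵗ` computes the
-- resulting code, which makes the indices of the structures computable from `i`.
specialise : ℕ → Program → Program → Program
specialise i p h = compᵖ p (pairᵖ h (pairᵖ (constᵖ i) zeroᵖ))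

-- These programs are opaque to keep their (enormous) codes from being evaluated.
opaque
  refuteᵖ checkᵖ : Fm ⊥ 2 → Program
  refuteᵖ φ = compile (test φ)
  checkᵖ φ  = compile (notᵗ (test φ))

  inputᵖ neverᵖ : Program
  inputᵖ = idᵖ
  neverᵖ = minᵖ (constᵖ 1)

  refute⇓ : ∀ {S : Pred ℕ 0ℓ} φ ρ → S ⊢ refuteᵖ φ [ encode ρ ]⇓ ⟦ test φ ⟧ ρ
  refute⇓ φ = compile⇓ (λ ()) (test φ)

  check⇓ : ∀ {S : Pred ℕ 0ℓ} φ ρ → S ⊢ checkᵖ φ [ encode ρ ]⇓ ⟦ notᵗ (test φ) ⟧ ρ
  check⇓ φ = compile⇓ (λ ()) (notᵗ (test φ))

  input⇓ : ∀ {S : Pred ℕ 0ℓ} x → S ⊢ inputᵖ [ x ]⇓ x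
  input⇓ = id⇓

  never : ∀ {S : Pred ℕ 0ℓ} {x y} → ¬ S ⊢ neverᵖ [ x ]⇓ y
  never (min⇓ d _) = 1+n≢0 (⇓-deterministic (const⇓ 1) d)

specialise⇓ : ∀ {S : Pred ℕ 0ℓ} i {p h x y z} → S ⊢ h [ z ]⇓ x → S ⊢ p [ encode (x ∷ i ∷ []) ]⇓ y →
              S ⊢ specialise i p h [ z ]⇓ y
specialise⇓ i d e = comp⇓ (pair⇓ d (pair⇓ (const⇓ i) zero⇓)) e

decideᵖ enumerateᵖ : Fm ⊥ 2 → ℕ → Program
decideᵖ φ i    = specialise i (checkᵖ φ) inputᵖ
-- The test discards the search variable by `leftᵖ`: the search stops at 0 if the formula holds and
-- never otherwise.
enumerateᵖ φ i = minᵖ (specialise i (refuteᵖ φ) leftᵖ)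

decides : ∀ {S : Pred ℕ 0ℓ} φ i x → (⟪ φ ⟫ (x ∷ i ∷ []) → S ⊢ decideᵖ φ i [ x ]⇓ 1) ×
                    (¬ ⟪ φ ⟫ (x ∷ i ∷ []) → S ⊢ decideᵖ φ i [ x ]⇓ 0)
decides {S} φ i x = (λ h → subst (S ⊢ decideᵖ φ i [ x ]⇓_) (true′ h) run) ,
                    (λ h → subst (S ⊢ decideᵖ φ i [ x ]⇓_) (false′ h) run)
  where
  run : S ⊢ decideᵖ φ i [ x ]⇓ ⟦ notᵗ (test φ) ⟧ (x ∷ i ∷ [])
  run = specialise⇓ i (input⇓ x) (check⇓ φ (x ∷ i ∷ []))
  true′ : ⟪ φ ⟫ (x ∷ i ∷ []) → ⟦ notᵗ (test φ) ⟧ (x ∷ i ∷ []) ≡ 1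
  true′ h = cong (iter 1 (λ _ _ → 0)) (test⇐ φ (x ∷ i ∷ []) h)
  false′ : ¬ ⟪ φ ⟫ (x ∷ i ∷ []) → ⟦ notᵗ (test φ) ⟧ (x ∷ i ∷ []) ≡ 0
  false′ h = test⇐ (neg φ) (x ∷ i ∷ []) h

enumerates : ∀ {S : Pred ℕ 0ℓ} φ i x →
             ⟪ φ ⟫ (x ∷ i ∷ []) ⇔ (∃[ y ] S ⊢ enumerateᵖ φ i [ x ]⇓ y)
enumerates {S} φ i x = mk⇔
  (λ h → 0 , min⇓ (subst (S ⊢ specialise i (refuteᵖ φ) leftᵖ [ ⟨ x , 0 ⟩ ]⇓_)
                         (test⇐ φ (x ∷ i ∷ []) h) (run 0)) (λ _ ()))
  (λ { (y , min⇓ d _) → test⇒ φ (x ∷ i ∷ []) (⇓-deterministic (run y) d) })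
  where
  run : ∀ y → S ⊢ specialise i (refuteᵖ φ) leftᵖ [ ⟨ x , y ⟩ ]⇓ ⟦ test φ ⟧ (x ∷ i ∷ [])
  run y = specialise⇓ i (left⇓ {x = x} {y}) (refute⇓ φ (x ∷ i ∷ []))

constᵗ : ∀ {n} → Tm ⊥ n → Tm ⊥ n
constᵗ t = call (natrec (lit 0) (pair (lit 6) (pair (lit ⌜ succᵖ ⌝) v0)) v0) (t ∷ [])

constᵗ-spec : ∀ i → ⟦ constᵗ v0 ⟧ (i ∷ []) ≡ ⌜ constᵖ i ⌝
constᵗ-spec zero    = refl
constᵗ-spec (suc i) = cong (λ c → ⟨ 6 , ⟨ ⌜ succᵖ ⌝ , c ⟩ ⟩) (constᵗ-spec i)

-- The tags 6 and 5 are those of `compᵖ` and `pairᵖ` in `⌜_⌝`, and the final 0 is the code of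
-- `zeroᵖ`.
specialiseᵗ : ℕ → ℕ → Tm ⊥ 1
specialiseᵗ p h =
  pair (lit 6) (pair (lit p) (pair (lit 5) (pair (lit h) (pair (lit 5) (pair (constᵗ v0) (lit 0))))))

specialiseᵗ-spec : ∀ i p h → ⟦ specialiseᵗ ⌜ p ⌝ ⌜ h ⌝ ⟧ (i ∷ []) ≡ ⌜ specialise i p h ⌝
specialiseᵗ-spec i p h =
  cong (λ c → ⟨ 6 , ⟨ ⌜ p ⌝ , ⟨ 5 , ⟨ ⌜ h ⌝ , ⟨ 5 , ⟨ c , 0 ⟩ ⟩ ⟩ ⟩ ⟩ ⟩) (constᵗ-spec i)

relF : Fm ⊥ 3
relF = snd v1 ≐ᶠ snd v2 ∧ pair (fst (snd v1)) (fst v1) ≐ᶠ v0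

-- δ defines a family of subsets of ω, indexed by variable 1.
module Diagrams (δ : Fm ⊥ 2) where

  -- Both arguments of a coded atom are smaller than its code, hence the bounds.
  diagramF : Fm ⊥ 3 → Fm ⊥ 2
  diagramF ρ = ex v0 (ex v1 (v2 ≐ᶠ pair (fst v2) (sucᵗ (pair v1 (sucᵗ (pair v0 (lit 0))))) ∧
    at δ (v1 ∷ v3 ∷ []) ∧ at δ (v0 ∷ v3 ∷ []) ∧ at ρ (fst v2 ∷ v1 ∷ v0 ∷ [])))

  opaque
    index : ℕ → ℕ
    index i = ⟨ ⌜ decideᵖ δ i ⌝ , ⟨ ⌜ enumerateᵖ (diagramF relF) i ⌝ ,
              ⟨ ⌜ enumerateᵖ (diagramF (neg relF)) i ⌝ , ⌜ neverᵖ ⌝ ⟩ ⟩ ⟩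

    indexᵗ : Tm ⊥ 1
    indexᵗ = pair (specialiseᵗ ⌜ checkᵖ δ ⌝ ⌜ inputᵖ ⌝)
            (pair (pair (lit 8) (specialiseᵗ ⌜ refuteᵖ (diagramF relF) ⌝ ⌜ leftᵖ ⌝))
            (pair (pair (lit 8) (specialiseᵗ ⌜ refuteᵖ (diagramF (neg relF)) ⌝ ⌜ leftᵖ ⌝))
                  (lit ⌜ neverᵖ ⌝)))

    indexᵗ-spec : ∀ i → ⟦ indexᵗ ⟧ (i ∷ []) ≡ index i
    indexᵗ-spec i = combine
      (specialiseᵗ-spec i (checkᵖ δ) inputᵖ)
      (specialiseᵗ-spec i (refuteᵖ (diagramF relF)) leftᵖ)
      (specialiseᵗ-spec i (refuteᵖ (diagramF (neg relF))) leftᵖ)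
      where
      combine : ∀ {a b c a′ b′ c′ d} → a ≡ a′ → b ≡ b′ → c ≡ c′ →
                ⟨ a , ⟨ ⟨ 8 , b ⟩ , ⟨ ⟨ 8 , c ⟩ , d ⟩ ⟩ ⟩ ≡ ⟨ a′ , ⟨ ⟨ 8 , b′ ⟩ , ⟨ ⟨ 8 , c′ ⟩ , d ⟩ ⟩ ⟩
      combine refl refl refl = refl

    index-≡ : ∀ i → index i ≡ ⟨ ⌜ decideᵖ δ i ⌝ , ⟨ ⌜ enumerateᵖ (diagramF relF) i ⌝ ,
                              ⟨ ⌜ enumerateᵖ (diagramF (neg relF)) i ⌝ , ⌜ neverᵖ ⌝ ⟩ ⟩ ⟩
    index-≡ i = refl

  module _ (N : ωStructure 𝓛) (i : ℕ)
    (dom⇔ : ∀ x → ⟪ δ ⟫ (x ∷ i ∷ []) ⇔ ωStructure.Dom N x)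
    (rel⇔ : ∀ k x y → pairRel (ωStructure.structure N) k x y ⇔ Rel k (proj₁ x) (proj₁ y)) where

    private
      pairs : ∀ {z} k x y → z ≡ ⟨ k , ⌈ x ∷ y ∷ [] ⌉ ⟩ →
              z ≡ ⟨ π₁ z , ⌈ x ∷ y ∷ [] ⌉ ⟩ × x < z × y < z × π₁ z ≡ k
      pairs k x y refl = cong ⟨_, ⌈ x ∷ y ∷ [] ⌉ ⟩ (sym (π₁-⟨⟩ k _)) ,
        ≤-trans (∈⇒<⌈⌉ {x} {x ∷ y ∷ []} (here refl)) (proj₂≤⟨⟩ k _) ,
        ≤-trans (∈⇒<⌈⌉ {y} {x ∷ y ∷ []} (there (here refl))) (proj₂≤⟨⟩ k _) , π₁-⟨⟩ k _

    positive⇔ : ∀ z → PosDiagram N z ⇔ ⟪ diagramF relF ⟫ (z ∷ i ∷ [])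
    positive⇔ z = mk⇔ there′ back
      where
      there′ : PosDiagram N z → ⟪ diagramF relF ⟫ (z ∷ i ∷ [])
      there′ ((k , tt) , x ∷ y ∷ [] , e , r) with pairs k (proj₁ x) (proj₁ y) e
      ... | e′ , x< , y< , k≡ = proj₁ x , x< , proj₁ y , y< , e′ ,
        from (dom⇔ (proj₁ x)) (proj₂ x) , from (dom⇔ (proj₁ y)) (proj₂ y) ,
        subst (λ k → Rel k (proj₁ x) (proj₁ y)) (sym k≡) (to (rel⇔ k x y) r)
      back : ⟪ diagramF relF ⟫ (z ∷ i ∷ []) → PosDiagram N z
      back (x , _ , y , _ , e , dx , dy , r) = (π₁ z , tt) , x′ ∷ y′ ∷ [] , e , from (rel⇔ (π₁ z) x′ y′) r
        where
        x′ = x , to (dom⇔ x) dx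
        y′ = y , to (dom⇔ y) dy

    negative⇔ : ∀ z → NegDiagram N z ⇔ ⟪ diagramF (neg relF) ⟫ (z ∷ i ∷ [])
    negative⇔ z = mk⇔ there′ back
      where
      there′ : NegDiagram N z → ⟪ diagramF (neg relF) ⟫ (z ∷ i ∷ [])
      there′ ((k , tt) , x ∷ y ∷ [] , e , ¬r) with pairs k (proj₁ x) (proj₁ y) e
      ... | e′ , x< , y< , k≡ = proj₁ x , x< , proj₁ y , y< , e′ ,
        from (dom⇔ (proj₁ x)) (proj₂ x) , from (dom⇔ (proj₁ y)) (proj₂ y) ,
        λ r → ¬r (from (rel⇔ k x y) (subst (λ k → Rel k (proj₁ x) (proj₁ y)) k≡ r))
      back : ⟪ diagramF (neg relF) ⟫ (z ∷ i ∷ []) → NegDiagram N z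
      back (x , _ , y , _ , e , dx , dy , ¬r) =
        (π₁ z , tt) , x′ ∷ y′ ∷ [] , e , λ r → ¬r (to (rel⇔ (π₁ z) x′ y′) r)
        where
        x′ = x , to (dom⇔ x) dx
        y′ = y , to (dom⇔ y) dy

    isIndex : IsIndex N (index i)
    isIndex = decideᵖ δ i , enumerateᵖ (diagramF relF) i , enumerateᵖ (diagramF (neg relF)) i , neverᵖ , index-≡ i ,
      (λ x → (λ d → proj₁ (decides δ i x) (from (dom⇔ x) d)) ,
             (λ ¬d → proj₂ (decides δ i x) (λ h → ¬d (to (dom⇔ x) h)))) ,
      (λ z → enumerates (diagramF relF) i z ⇔-∘ positive⇔ z) ,
      (λ z → enumerates (diagramF (neg relF)) i z ⇔-∘ negative⇔ z) ,
      (λ z → mk⇔ (λ { ((_ , ()) , _) }) (λ (_ , d) → ⊥-elim (never d)))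

-- The canonical age and its indices

attach : {D : Pred ℕ 0ℓ} (xs : List ℕ) → (∀ {x} → x ∈ xs → D x) → List (∃ D)
attach []       h = []
attach (x ∷ xs) h = (x , h (here refl)) ∷ attach xs (λ m → h (there m))

values-attach : ∀ {D : Pred ℕ 0ℓ} xs (h : ∀ {x} → x ∈ xs → D x) → values (attach {D} xs h) ≡ xs
values-attach []       h = refl
values-attach (x ∷ xs) h = cong (x ∷_) (values-attach xs (λ m → h (there m)))

module CanonicalAge
  (Present : ℕ → ℕ → ℕ → ℕ → Set)
  (present-monotone : ∀ q c l {s s′} → s ≤ s′ → Present q c s l → Present q c s′ l)
  (domF : Fm ⊥ 1) (dom⇔ : ∀ x → ⟪ domF ⟫ (x ∷ []) ⇔ Components.𝓓 Present present-monotone x) where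
  open Components Present present-monotone

  tuplesF : Fm ⊥ 1
  tuplesF = tails (at domF (v0 ∷ [])) (fst v0)

  -- The second component of `i` is a dummy, which makes every tuple recur. Lists with entries
  -- outside `𝓓` default to the empty tuple.
  valuesᵗ : Tm ⊥ 1
  valuesᵗ = if tuplesF then fst v0 else lit 0

  tupleCode : ℕ → ℕ
  tupleCode i = ⟦ valuesᵗ ⟧ (i ∷ [])

  Tails⇔ : ∀ xs → Tails (at domF (v0 ∷ [])) xs ⇔ (∀ {x} → x ∈ xs → 𝓓 x)
  Tails⇔ xs = mk⇔ (⇒ xs) (⇐ xs)
    where
    ⇒ : ∀ xs → Tails (at domF (v0 ∷ [])) xs → ∀ {x} → x ∈ xs → 𝓓 x
    ⇒ (x ∷ xs) (d , _) (here refl) = to (dom⇔ x) d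
    ⇒ (x ∷ xs) (_ , h) (there m)   = ⇒ xs h m
    ⇐ : ∀ xs → (∀ {x} → x ∈ xs → 𝓓 x) → Tails (at domF (v0 ∷ [])) xs
    ⇐ []       h = tt
    ⇐ (x ∷ xs) h = from (dom⇔ x) (h (here refl)) , ⇐ xs (λ m → h (there m))

  -- Together with `∈⇒<⌈⌉` this bounds the elements of a structure by its number, which the
  -- reduction exploits.
  tupleCode≤ : ∀ i → tupleCode i ≤ i
  tupleCode≤ i = go (holds? tuplesF (i ∷ []))
    where
    go : Dec (⟪ tuplesF ⟫ (i ∷ [])) → tupleCode i ≤ i
    go (yes h) = subst (_≤ i) (sym (if-true tuplesF (fst v0) (lit 0) (i ∷ []) h)) (π₁≤ i)
    go (no ¬h) = subst (_≤ i) (sym (if-false tuplesF (fst v0) (lit 0) (i ∷ []) ¬h)) z≤n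

  tuple : ℕ → List ℕ
  tuple i = decode (tupleCode i)

  tuple⊆𝓓 : ∀ i {x} → x ∈ tuple i → 𝓓 x
  tuple⊆𝓓 i = go (holds? tuplesF (i ∷ []))
    where
    go : Dec (⟪ tuplesF ⟫ (i ∷ [])) → ∀ {x} → x ∈ tuple i → 𝓓 x
    go (yes h) {x} m = to (Tails⇔ (decode (π₁ i)))
      (⟪tails⟫⇒ (at domF (v0 ∷ [])) (decode (π₁ i))
        (subst (λ v → ⟪ tails (at domF (v0 ∷ [])) v0 ⟫ (v ∷ [])) (sym (⌈decode⌉ (π₁ i))) h))
      (subst (λ v → x ∈ decode v) (if-true tuplesF (fst v0) (lit 0) (i ∷ []) h) m)
    go (no ¬h) {x} m with subst (λ v → x ∈ decode v) (if-false tuplesF (fst v0) (lit 0) (i ∷ []) ¬h) m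
    ... | ()

  enum : ℕ → List (∃ 𝓓)
  enum i = attach (tuple i) (tuple⊆𝓓 i)

  values-enum : ∀ i → values (enum i) ≡ tuple i
  values-enum i = values-attach (tuple i) (tuple⊆𝓓 i)

  index-of : List (∃ 𝓓) → ℕ → ℕ
  index-of t n = ⟨ ⌈ values t ⌉ , n ⟩

  values-index-of : ∀ t n → values (enum (index-of t n)) ≡ values t
  values-index-of t n = trans (values-enum i) (trans (cong decode code≡) (decode-⌈⌉ (values t)))
    where
    i = index-of t n
    all∈𝓓 : ∀ t {x} → x ∈ values t → 𝓓 x
    all∈𝓓 ((_ , d) ∷ t) (here refl) = d
    all∈𝓓 (_ ∷ t)       (there m)   = all∈𝓓 t m
    code≡ : tupleCode i ≡ ⌈ values t ⌉
    code≡ = trans (if-true tuplesF (fst v0) (lit 0) (i ∷ [])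
      (subst (λ v → ⟪ tails (at domF (v0 ∷ [])) v0 ⟫ (v ∷ [])) (sym (π₁-⟨⟩ ⌈ values t ⌉ n))
        (⟪tails⟫⇐ (at domF (v0 ∷ [])) (values t) (from (Tails⇔ (values t)) (all∈𝓓 t)))))
      (π₁-⟨⟩ ⌈ values t ⌉ n)

  𝓐 : ℕ → ωStructure 𝓛
  𝓐 i = cl 𝓜 (enum i)

  str : ℕ → Structure 𝓛
  str i = ωStructure.structure (𝓐 i)

  Dom⇔ : ∀ i x → x ∈ tuple i ⇔ ωStructure.Dom (𝓐 i) x
  Dom⇔ i x = mk⇔ ⇒ ⇐
    where
    ⇒ : x ∈ tuple i → ωStructure.Dom (𝓐 i) x
    ⇒ m with ∈-map⁻ proj₁ (subst (x ∈_) (sym (values-enum i)) m)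
    ... | y , y∈ , refl = proj₂ y , ≈∈⇒Cl 𝕄 y∈ refl
    ⇐ : ωStructure.Dom (𝓐 i) x → x ∈ tuple i
    ⇐ (d , c) with Cl⇒≈∈ 𝕄 c
    ... | y , y∈ , refl = subst (proj₁ y ∈_) (values-enum i) (∈-map⁺ proj₁ y∈)

  inclusion : ∀ i → Embedding (str i) 𝕄
  inclusion i = embedding (str i) 𝕄 (λ (x , d , _) → x , d) (λ e → e) (λ e → e)
    (λ k x y → mk⇔ (λ r → r) (λ r → r))

  generators : ∀ i → List (Carrier (str i))
  generators i = attach (tuple i) (λ {x} → to (Dom⇔ i x))

  values-generators : ∀ i → values (generators i) ≡ tuple i
  values-generators i = values-attach (tuple i) (λ {x} → to (Dom⇔ i x))

  generators-generate : ∀ i → Generates (str i) (generators i)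
  generators-generate i = covers⇒generates (str i) λ (x , d) →
    let (y , y∈ , e) = ∈-map⁻ proj₁ (subst (x ∈_) (sym (values-generators i)) (from (Dom⇔ i x) d))
    in y , y∈ , sym e

  substructureF : Fm ⊥ 2
  substructureF = v0 ∈ᶠ call valuesᵗ (v1 ∷ [])

  open Diagrams substructureF

  isIndex-𝓐 : ∀ i → IsIndex (𝓐 i) (index i)
  isIndex-𝓐 i = isIndex (𝓐 i) i
    (λ x → Dom⇔ i x ⇔-∘ mk⇔ (λ m → ∈ᶜ⇒∈ (tuple i) (subst (x ∈ᶜ_) (sym (⌈decode⌉ (tupleCode i))) m))
                            (λ m → subst (x ∈ᶜ_) (⌈decode⌉ (tupleCode i)) (∈⇒∈ᶜ m)))
    (λ k x y → mk⇔ (λ r → r) (λ r → r))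

  computable-𝓜 : ComputableStructure 𝓜
  computable-𝓜 = Diagrams.index (at domF (v0 ∷ [])) 0 ,
    Diagrams.isIndex (at domF (v0 ∷ [])) 𝓜 0 dom⇔ (λ k x y → mk⇔ (λ r → r) (λ r → r))

  -- The number `i` is read off the triple and determines the other entries, so no search is
  -- involved.
  ageF : Fm ⊥ 2
  ageF = fst v0 ≐ᶠ call valuesᵗ (snd (snd v0) ∷ []) ∧ fst (snd v0) ≐ᶠ call indexᵗ (snd (snd v0) ∷ [])

  𝕂ᶜ : ComputableAge 𝓚
  𝕂ᶜ = record
    { 𝒜          = 𝓐
    ; index      = index
    ; 𝐚          = generators
    ; isIndex    = isIndex-𝓐
    ; generated  = generators-generate
    ; enumerable = enumerateᵖ ageF 0 , λ z → enumerates ageF 0 z ⇔-∘ mk⇔ (⇒ z) (⇐ z)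
    ; member     = λ i → (generators i , generators-generate i) , inclusion i
    ; complete   = complete
    }
    where
    codes : ∀ i → ⌈ values (generators i) ⌉ ≡ tupleCode i
    codes i = trans (cong ⌈_⌉ (values-generators i)) (⌈decode⌉ (tupleCode i))
    ⇒ : ∀ z → ∃[ i ] z ≡ ⟨ ⌈ values (generators i) ⌉ , ⟨ index i , i ⟩ ⟩ → ⟪ ageF ⟫ (z ∷ 0 ∷ [])
    ⇒ z (i , refl) =
      trans (π₁-⟨⟩ a b) (trans (codes i) (cong tupleCode (sym i≡))) ,
      trans (cong π₁ (π₂-⟨⟩ a b)) (trans (π₁-⟨⟩ (index i) i)
        (trans (sym (indexᵗ-spec i)) (cong (λ i → ⟦ indexᵗ ⟧ (i ∷ [])) (sym i≡))))
      where
      a = ⌈ values (generators i) ⌉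
      b = ⟨ index i , i ⟩
      i≡ : π₂ (π₂ ⟨ a , b ⟩) ≡ i
      i≡ = trans (cong π₂ (π₂-⟨⟩ a b)) (π₂-⟨⟩ (index i) i)
    ⇐ : ∀ z → ⟪ ageF ⟫ (z ∷ 0 ∷ []) → ∃[ i ] z ≡ ⟨ ⌈ values (generators i) ⌉ , ⟨ index i , i ⟩ ⟩
    ⇐ z (e , e′) = i , trans (sym (⟨⟩-reassemble z)) (cong₂ (λ a b → ⟨ a , ⟨ b , i ⟩ ⟩)
        (trans e (sym (codes i))) (trans e′ (indexᵗ-spec i)))
      where i = π₂ (π₂ z)
    complete : ∀ B → Age.Member 𝓚 B → ∃[ i ] B ≅ str i
    complete B ((xs , g) , ι) = i , h , surjective
      where
      t = List.map (map ι) xs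
      i = index-of t 0
      tuple≡ : tuple i ≡ values t
      tuple≡ = trans (sym (values-enum i)) (values-index-of t 0)
      inStr : ∀ x → ωStructure.Dom (𝓐 i) (proj₁ (map ι x))
      inStr x with generates⇒covers B g x
      ... | y , y∈ , e = to (Dom⇔ i (proj₁ (map ι x))) (subst₂ _∈_ (map-cong ι e) (sym tuple≡)
                           (∈-map⁺ proj₁ (∈-map⁺ (map ι) y∈)))
      h : Embedding B (str i)
      h = embedding B (str i) (λ x → proj₁ (map ι x) , inStr x) (map-cong ι) (map-injective ι) (pairRel⇔ B ι)
      surjective : Surjective h
      surjective (x , d) with ∈-map⁻ proj₁ (subst (x ∈_) tuple≡ (from (Dom⇔ i x) d))
      ... | y , y∈ , e with ∈-map⁻ (map ι) y∈
      ... | z , _ , e′ = z , sym (trans e (cong proj₁ e′))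

  canonical : IsCanonicalAge 𝓜 𝕂ᶜ
  canonical = record
    { enum            = enum
    ; enum-computable = compᵖ (compile valuesᵗ) (pairᵖ idᵖ zeroᵖ) , λ i →
        subst (∅ ⊢ compᵖ (compile valuesᵗ) (pairᵖ idᵖ zeroᵖ) [ i ]⇓_)
          (sym (trans (cong ⌈_⌉ (values-enum i)) (⌈decode⌉ (tupleCode i))))
          (comp⇓ (pair⇓ (id⇓ i) zero⇓) (compile⇓ (λ ()) valuesᵗ (i ∷ [])))
    ; recurrent       = λ t n → index-of t n , proj₂≤⟨⟩ ⌈ values t ⌉ n , values-index-of t n
    ; tuples          = λ i → trans (values-generators i) (sym (values-enum i))
    ; structures      = isIndex-𝓐
    }

-- Coding the double jump

χ∅ : Tm ⊥ 1
χ∅ = lit 0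

Refuted : ℕ → ℕ → ℕ → Set
Refuted n t d = ⟪ refuteF χ∅ ⟫ (n ∷ t ∷ d ∷ [])

opaque
  hitF : Fm ⊥ 3
  hitF = all (sucᵗ v1) (ex v3 (at (refuteF χ∅) (v2 ∷ v1 ∷ v0 ∷ [])))

-- By stage s, all candidates t′ ≤ t for a witness of n ∈ ∅ ′ ′ are refuted.
Hit : ℕ → ℕ → ℕ → Set
Hit n t s = ⟪ hitF ⟫ (n ∷ t ∷ s ∷ [])

opaque
  unfolding hitF

  hit-elim : ∀ {n t s t′} → Hit n t s → t′ ≤ t → ∃[ d ] Refuted n t′ d
  hit-elim h l with h _ (s≤s l)
  ... | d , _ , r = d , r

  hit-mono : ∀ {n t s s′} → s ≤ s′ → Hit n t s → Hit n t s′
  hit-mono l h t′ t′≤t with h t′ t′≤t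
  ... | d , d<s , r = d , ≤-trans d<s l , r

  -- So every number above a good one is good, and a mere upper bound on a good number can replace
  -- it.
  hit-anti : ∀ {n t t′ s} → t′ ≤ t → Hit n t s → Hit n t′ s
  hit-anti l h t″ t″≤t′ = h t″ (≤-trans t″≤t′ (s≤s l))

  hit-intro : ∀ {n} → (∀ t → ∃[ d ] Refuted n t d) → ∀ t → ∃[ s ] Hit n t s
  hit-intro r zero with r 0
  ... | d , ref = suc d , λ { zero _ → d , ≤-refl , ref ; (suc _) (s≤s ()) }
  hit-intro {n} r (suc t) with hit-intro r t | r (suc t)
  ... | s , h | d , ref = s ⊔ suc d , both
    where
    both : Hit n (suc t) (s ⊔ suc d)
    both t′ l with m≤n⇒m<n∨m≡n (≤-pred l)
    ... | inj₂ refl = d , m≤n⊔m s (suc d) , ref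
    ... | inj₁ t′≤t with h t′ t′≤t
    ... | d′ , d′<s , ref′ = d′ , ≤-trans d′<s (m≤m⊔n s (suc d)) , ref′

Good : ℕ → ℕ → Set
Good n t = ∀ s → ¬ Hit n t s

-- Labels are ⟨0, t⟩ without a colour and ⟨suc c, t⟩ for the colour c.  In a
-- component of kind ⟨n, 0⟩, the labels of other colours occur if t is not
-- good for n; in a component of kind ⟨n, suc k⟩, there are coloured labels
-- only if k is not good for n.
presentF : Fm ⊥ 4
presentF = fst v3 ≐ᶠ lit 0
  ∨ (snd v0 ≐ᶠ lit 0 ∧ (fst v3 ≐ᶠ sucᵗ v1 ∨ at hitF (fst v0 ∷ snd v3 ∷ v2 ∷ [])))
  ∨ ex v0 (snd v1 ≐ᶠ sucᵗ v0 ∧ fst v4 ≐ᶠ sucᵗ v2 ∧ at hitF (fst v1 ∷ v0 ∷ v3 ∷ []))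

Present : ℕ → ℕ → ℕ → ℕ → Set
Present q c s l = ⟪ presentF ⟫ (q ∷ c ∷ s ∷ l ∷ [])

pattern colourless e    = inj₁ e
pattern same-colour k e = inj₂ (inj₁ (k , inj₁ e))
pattern both-colours k h = inj₂ (inj₁ (k , inj₂ h))
pattern revealed k k<q e e′ h = inj₂ (inj₂ (k , k<q , e , e′ , h))

present-monotone : ∀ q c l {s s′} → s ≤ s′ → Present q c s l → Present q c s′ l
present-monotone q c l le (colourless e)     = colourless e
present-monotone q c l le (same-colour k e)  = same-colour k e
present-monotone q c l le (both-colours k h) = both-colours k (hit-mono le h)
present-monotone q c l le (revealed k k<q e e′ h) = revealed k k<q e e′ (hit-mono le h)

domF : Fm ⊥ 1
domF = at presentF (fst (snd v0) ∷ fst (snd (snd v0)) ∷ fst (snd (snd (snd v0))) ∷ fst v0 ∷ [])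

open Components Present present-monotone
open CanonicalAge Present present-monotone domF (λ x → mk⇔ (λ d → d) (λ d → d))

-- The number 0 unpairs to zeros throughout: this element has the colourless label 0 and lies in the
-- component of kind `q` with colour, stage and copy 0.
root : ℕ → ℕ
root q = ⟨ 0 , ⟨ q , 0 ⟩ ⟩

module _ (q : ℕ) where
  root-kind : kind (component (root q)) ≡ q
  root-kind = trans (cong π₁ (π₂-⟨⟩ 0 ⟨ q , 0 ⟩)) (π₁-⟨⟩ q 0)

  root∈𝓓 : 𝓓 (root q)
  root∈𝓓 = colourless (cong π₁ (π₁-⟨⟩ 0 ⟨ q , 0 ⟩))

  rootIndex : ℕ
  rootIndex = index-of ((root q , root∈𝓓) ∷ []) 0

  rootIn : Carrier (str rootIndex)
  rootIn = root q , to (Dom⇔ rootIndex (root q)) (subst (root q ∈_)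
    (trans (sym (values-index-of ((root q , root∈𝓓) ∷ []) 0)) (values-enum rootIndex)) (here refl))

rootIndexᵗ : Tm ⊥ 1 → Tm ⊥ 1
rootIndexᵗ t = pair (sucᵗ (pair (pair (lit 0) (pair t (lit 0))) (lit 0))) (lit 0)

onInput : Tm ⊥ 1 → Program
onInput t = compᵖ (compile t) (pairᵖ idᵖ zeroᵖ)

onInput⇓ : ∀ {S : Pred ℕ 0ℓ} t x → S ⊢ onInput t [ x ]⇓ ⟦ t ⟧ (x ∷ [])
onInput⇓ t x = comp⇓ (pair⇓ (id⇓ x) zero⇓) (compile⇓ (λ ()) t (x ∷ []))

only-one-colour : ∀ q c l → Only q c l → ¬ Free q l
only-one-colour q c l only free =
  let (s , p) = free (suc c) in 1+n≢n (only (suc c) s p)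

module _ (em : ExcludedMiddle 0ℓ) where

  free-or-only : ∀ q l → Free q l ⊎ ∃[ c ] Only q c l
  free-or-only q l with π₁ l in i≡ | π₂ q in k≡
  ... | zero  | _ = inj₁ (λ c → 0 , colourless refl)
  ... | suc j | zero = by-cases em
    where
    by-cases : Dec (∃[ s ] Hit (π₁ q) (π₂ l) s) → _
    by-cases (yes (s , h)) = inj₁ λ c → s , both-colours refl h
    by-cases (no ¬h)       = inj₂ (j , λ { c s (same-colour _ e) → suc-injective (sym e)
                                         ; c s (both-colours _ h) → ⊥-elim (¬h (s , h)) })
  ... | suc j | suc k = inj₂ (j , λ { c s (revealed _ _ _ e _) → suc-injective (sym e) })

  label-of : ∀ c t → π₁ ⟨ suc c , t ⟩ ≡ suc c
  label-of c t = π₁-⟨⟩ (suc c) t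

  -- A label with number `t` reaches a foreign colour only through a hit of `t`, which goodness
  -- excludes.
  good⇒decisive : ∀ q t → π₂ q ≡ 0 → Good (π₁ q) t → Decisive q
  good⇒decisive q t k≡ good c = ⟨ suc c , t ⟩ , 0 , same-colour k≡ (label-of c t) , λ
    { c′ s (colourless e)       → ⊥-elim (1+n≢0 (trans (sym (label-of c t)) e))
    ; c′ s (same-colour _ e)    → suc-injective (trans (sym e) (label-of c t))
    ; c′ s (both-colours _ h)   → ⊥-elim (good s (subst (λ t → Hit (π₁ q) t s) (π₂-⟨⟩ (suc c) t) h))
    ; c′ s (revealed _ _ e _ _) → ⊥-elim (0≢1+n (trans (sym k≡) e)) }

  hit⇒decisive : ∀ q k s → π₂ q ≡ suc k → Hit (π₁ q) k s → Decisive q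
  hit⇒decisive q k s k≡ h c =
    -- In this kind the second component of a label is immaterial; 0 is an arbitrary choice.
    ⟨ suc c , 0 ⟩ , s , revealed k (subst (_≤ q) k≡ (π₂≤ q)) k≡ (label-of c 0) h , λ
    { c′ s (colourless e)       → ⊥-elim (1+n≢0 (trans (sym (label-of c 0)) e))
    ; c′ s (same-colour e _)    → ⊥-elim (0≢1+n (trans (sym e) k≡))
    ; c′ s (both-colours e _)   → ⊥-elim (0≢1+n (trans (sym e) k≡))
    ; c′ s (revealed _ _ _ e _) → suc-injective (trans (sym e) (label-of c 0)) }

  -- If no number is good for `n`, each label of kind `⟨ n , 0 ⟩` is hit at some stage and then
  -- occurs in all colours. If `k` is never hit, kind `⟨ n , suc k ⟩` has only colourless labels.
  neutral-or-decisive : ∀ q → Neutral q ⊎ Decisive q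
  neutral-or-decisive q = go (π₂ q) refl
    where
    n = π₁ q
    go : ∀ k → π₂ q ≡ k → Neutral q ⊎ Decisive q
    go zero k≡ = by-cases em
      where
      by-cases : Dec (∃[ t ] Good n t) → Neutral q ⊎ Decisive q
      by-cases (yes (t , good)) = inj₂ (good⇒decisive q t k≡ good)
      by-cases (no ¬good)       = inj₁ λ _ _ l _ c →
        let (s , h) = decidable-stable em (λ ¬h → ¬good (π₂ l , λ s h → ¬h (s , h)))
        in s , both-colours k≡ h
    go (suc k) k≡ = by-cases em
      where
      by-cases : Dec (∃[ s ] Hit n k s) → Neutral q ⊎ Decisive q
      by-cases (yes (s , h)) = inj₂ (hit⇒decisive q k s k≡ h)
      by-cases (no ¬h)       = inj₁ λ
        { _ _ _ (colourless e) c   → 0 , colourless e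
        ; _ _ _ (same-colour e _)  → ⊥-elim (0≢1+n (trans (sym e) k≡))
        ; _ _ _ (both-colours e _) → ⊥-elim (0≢1+n (trans (sym e) k≡))
        ; _ s _ (revealed _ _ e _ h) →
            ⊥-elim (¬h (s , subst (λ k → Hit n k s) (suc-injective (trans (sym e) k≡)) h)) }

  -- Deciding the double jump from an enumeration of distinguished extensions

  module Reduction {S : Pred ℕ 0ℓ} (w : CAPWitness 𝕂ᶜ) (ce : S -CE CAPWitness.AB w) where
    open CAPWitness w
    open IsDistinguished distinguished

    module Find = Search em ce

    baseᵖ : Program
    baseᵖ = compᵖ leftᵖ (compᵖ rightᵖ Find.findᵖ)

    -- Members of `AB` are numbers, so domain and codomain of the coded embedding are known only up
    -- to equations; `relocate` transports the embedding to the indices computed from `z`.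
    extract : ∀ i z → AB z → π₁ z ≡ i →
              Σ[ F ∈ PotentialEmbedding 𝕂ᶜ i (π₁ (π₂ z)) ] AB (code 𝕂ᶜ F) × IsEmbedding 𝕂ᶜ F
    extract i z ab i≡ = relocate i≡
      (trans (cong (λ z → π₁ (π₂ z)) e) (trans (cong π₁ (π₂-⟨⟩ i′ ⟨ j′ , c ⟩)) (π₁-⟨⟩ j′ c)))
      (trans (cong π₁ e) (π₁-⟨⟩ i′ ⟨ j′ , c ⟩)) F (subst AB e ab) emb
      where
      i′  = proj₁ (embeddings ab)
      j′  = proj₁ (proj₂ (embeddings ab))
      F   = proj₁ (proj₂ (proj₂ (embeddings ab)))
      e   = proj₁ (proj₂ (proj₂ (proj₂ (embeddings ab))))
      emb = proj₂ (proj₂ (proj₂ (proj₂ (embeddings ab))))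
      c   = ⌈ values (PotentialEmbedding.tuple F) ⌉
      relocate : ∀ {i j i″ i′ j′} → i″ ≡ i → j ≡ j′ → i″ ≡ i′ → (F : PotentialEmbedding 𝕂ᶜ i′ j′) →
                 AB (code 𝕂ᶜ F) → IsEmbedding 𝕂ᶜ F →
                 Σ[ F ∈ PotentialEmbedding 𝕂ᶜ i j ] AB (code 𝕂ᶜ F) × IsEmbedding 𝕂ᶜ F
      relocate refl refl refl F ab emb = F , ab , emb

    find-base : ∀ i → ∃[ j ] S ⊢ baseᵖ [ i ]⇓ j ×
                (Σ[ F ∈ PotentialEmbedding 𝕂ᶜ i j ] AB (code 𝕂ᶜ F) × IsEmbedding 𝕂ᶜ F)
    find-base i =
      let (j₀ , F₀ , ab₀)          = total i
          (z , (ab , i≡) , run) = Find.find i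
            (code 𝕂ᶜ F₀ , ab₀ , π₁-⟨⟩ i ⟨ j₀ , ⌈ values (PotentialEmbedding.tuple F₀) ⌉ ⟩)
      in π₁ (π₂ z) , comp⇓ (comp⇓ run (right⇓′ z)) (left⇓′ (π₂ z)) , extract i z ab i≡

    Settles : ℕ → ℕ → Set
    Settles q v = kind (component v) ≡ q × 𝓓 v × ∃[ c ] Only q c (label v)

    settled : ∀ q j (F : PotentialEmbedding 𝕂ᶜ (rootIndex q) j) → AB (code 𝕂ᶜ F) → IsEmbedding 𝕂ᶜ F →
              Decisive q → ∃[ v ] v ≤ j × Settles q v
    settled q j F ab emb d =
      let ((v , v∈) , c , e , only) =
            base⇒decided em free-or-only (str j) (bases {F = F} ab) (inclusion j) x (subst Decisive (sym kind-x) d)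
      in v ,
      <⇒≤ (≤-trans (∈⇒<⌈⌉ (from (Dom⇔ j v) v∈)) (subst (_≤ j) (sym (⌈decode⌉ (tupleCode j))) (tupleCode≤ j))) ,
      trans (cong kind e) kind-x , proj₁ v∈ , c , subst (λ q → Only q c (label v)) kind-x only
      where
      h : Embedding (str (rootIndex q)) (str j)
      h = encoded 𝕂ᶜ {F = F} emb
      x : Carrier (str j)
      x = map h (rootIn q)
      kind-x : kind (component-at (str j) (inclusion j) x) ≡ q
      kind-x = trans (kind-preserved (inclusion (rootIndex q)) (inclusion j) h (rootIn q)) (root-kind q)

    -- The elements of 𝓐 j are bounded by j, so that j bounds the information
    -- which an amalgamation base 𝓐 j has to contain.
    base-bound : ∀ q → ∃[ j ] S ⊢ baseᵖ [ rootIndex q ]⇓ j × (Decisive q → ∃[ v ] v ≤ j × Settles q v)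
    base-bound q = let (j , run , F , ab , emb) = find-base (rootIndex q) in j , run , settled q j F ab emb

    kind₁ : ℕ → ℕ
    kind₁ n = ⟨ n , 0 ⟩

    kind₂ : ℕ → ℕ
    kind₂ z = ⟨ π₁ z , suc (π₂ z) ⟩

    bound₁ bound₂ : ℕ → ℕ
    bound₁ n = proj₁ (base-bound (kind₁ n))
    bound₂ z = proj₁ (base-bound (kind₂ z))

    bound₁⇓ : ∀ n → S ⊢ compᵖ baseᵖ (onInput (rootIndexᵗ (pair v0 (lit 0)))) [ n ]⇓ bound₁ n
    bound₁⇓ n = comp⇓ (onInput⇓ (rootIndexᵗ (pair v0 (lit 0))) n) (proj₁ (proj₂ (base-bound (kind₁ n))))

    bound₂⇓ : ∀ z → S ⊢ compᵖ baseᵖ (onInput (rootIndexᵗ (pair (fst v0) (sucᵗ (snd v0))))) [ z ]⇓ bound₂ z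
    bound₂⇓ z = comp⇓ (onInput⇓ (rootIndexᵗ (pair (fst v0) (sucᵗ (snd v0)))) z)
                      (proj₁ (proj₂ (base-bound (kind₂ z))))

    -- The base contains a label that occurs in one colour only. Were the bound hit, so would be the
    -- number of that label, which is at most the bound, and the label would be free.
    good-bound₁ : ∀ n t → Good n t → Good n (bound₁ n)
    good-bound₁ n t good s h =
      let (v , v≤ , k≡ , _ , c , only) = proj₂ (proj₂ (base-bound (kind₁ n)))
            (good⇒decisive (kind₁ n) t (π₂-⟨⟩ n 0) (subst (λ n → Good n t) (sym (π₁-⟨⟩ n 0)) good))
      in only-one-colour (kind₁ n) c (label v) only λ c → s , both-colours (π₂-⟨⟩ n 0)
           (hit-anti (≤-trans (π₂≤ (label v)) (≤-trans (π₁≤ v) v≤))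
             (subst (λ m → Hit m (bound₁ n) s) (sym (π₁-⟨⟩ n 0)) h))

    -- The settling label in the base is not colourless, since colourless labels are free. It was
    -- therefore revealed by a hit at the stage of its component, and that stage is at most the
    -- number of the base.
    hit-bound₂ : ∀ z s → Hit (π₁ z) (π₂ z) s → Hit (π₁ z) (π₂ z) (bound₂ z)
    hit-bound₂ z s h =
      let q = kind₂ z
          q₁ = π₁-⟨⟩ (π₁ z) (suc (π₂ z))
          q₂ = π₂-⟨⟩ (π₁ z) (suc (π₂ z))
          (v , v≤ , k≡ , v∈ , c , only) = proj₂ (proj₂ (base-bound q))
            (hit⇒decisive q (π₂ z) s q₂ (subst (λ n → Hit n (π₂ z) s) (sym q₁) h))
          κ = component v
      in go q c (colour κ) (stage κ) (label v) q₁ q₂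
           (≤-trans (≤-trans (π₁≤ (π₂ (π₂ κ))) (≤-trans (π₂≤ (π₂ κ)) (π₂≤ κ))) (≤-trans (π₂≤ v) v≤)) only
           (subst (λ q → Present q (colour κ) (stage κ) (label v)) k≡ v∈)
      where
      go : ∀ q c c′ s l {n k b} → π₁ q ≡ n → π₂ q ≡ suc k → s ≤ b → Only q c l → Present q c′ s l → Hit n k b
      go q c c′ s l e₁ e₂ s≤b only (colourless e)     = ⊥-elim (only-one-colour q c l only (λ _ → 0 , colourless e))
      go q c c′ s l e₁ e₂ s≤b only (same-colour e _)  = ⊥-elim (0≢1+n (trans (sym e) e₂))
      go q c c′ s l e₁ e₂ s≤b only (both-colours e _) = ⊥-elim (0≢1+n (trans (sym e) e₂))
      go q c c′ s l {b = b} e₁ e₂ s≤b only (revealed _ _ e _ h) =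
        subst₂ (λ n k → Hit n k b) e₁ (suc-injective (trans (sym e) e₂)) (hit-mono s≤b h)

    module ∅″ = NormalForm ⊥ (λ _ → 0) χ∅ ∅ (λ ()) (λ _ → refl) em

    jump⇒good : ∀ n → (∅ ′ ′) n → ∃[ t ] Good n t
    jump⇒good n h =
      let (t , unrefuted) = ∅″.jump⇒ h
      in t , λ s hit → let (d , r) = hit-elim hit ≤-refl in unrefuted d r

    ¬jump⇒hit : ∀ n → ¬ (∅ ′ ′) n → ∀ t → ∃[ s ] Hit n t s
    ¬jump⇒hit n ¬h = hit-intro λ t →
      decidable-stable em λ ¬r → ¬h (∅″.jump⇐ t (λ d r → ¬r (d , r)))

    unhitF : Fm ⊥ 2
    unhitF = neg (at hitF (fst (fst v0) ∷ snd (fst v0) ∷ snd v0 ∷ []))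

    decideJump : Program
    decideJump = compᵖ (decideᵖ unhitF 0)
      (compᵖ (pairᵖ idᵖ (compᵖ baseᵖ (onInput (rootIndexᵗ (pair (fst v0) (sucᵗ (snd v0)))))))
             (pairᵖ idᵖ (compᵖ baseᵖ (onInput (rootIndexᵗ (pair v0 (lit 0)))))))

    reduction : ∅ ′ ′ ≤ᵀ S
    reduction = decideJump , λ n →
      let z  = ⟨ n , bound₁ n ⟩
          z₁ = π₁-⟨⟩ n (bound₁ n)
          z₂ = π₂-⟨⟩ n (bound₁ n)
          x  = ⟨ z , bound₂ z ⟩
          x₁ = π₁-⟨⟩ z (bound₂ z)
          x₂ = π₂-⟨⟩ z (bound₂ z)
          run : ∀ {y} → S ⊢ decideᵖ unhitF 0 [ x ]⇓ y → S ⊢ decideJump [ n ]⇓ y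
          run d = comp⇓ (comp⇓ (pair⇓ (id⇓ n) (bound₁⇓ n)) (pair⇓ (id⇓ z) (bound₂⇓ z))) d
          hit-at-x : ⟪ at hitF (fst (fst v0) ∷ snd (fst v0) ∷ snd v0 ∷ []) ⟫ (x ∷ 0 ∷ []) ≡
                     Hit n (bound₁ n) (bound₂ z)
          hit-at-x = trans (cong₂ (λ z b → Hit (π₁ z) (π₂ z) b) x₁ x₂) (cong₂ (λ n t → Hit n t (bound₂ z)) z₁ z₂)
      in (λ h → let (t , good) = jump⇒good n h in run (proj₁ (decides unhitF 0 x) λ hit →
                  good-bound₁ n t good (bound₂ z) (subst (λ X → X) hit-at-x hit))) ,
         (λ ¬h → let (s , hit) = ¬jump⇒hit n ¬h (bound₁ n) in run (proj₂ (decides unhitF 0 x) λ ¬hit →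
                  ¬hit (subst (λ X → X) (sym hit-at-x)
                    (subst₂ (λ n t → Hit n t (bound₂ z)) z₁ z₂ (hit-bound₂ z s
                      (subst₂ (λ n t → Hit n t s) (sym z₁) (sym z₂) hit))))))

theorem7p5 : ExcludedMiddle 0ℓ →
    Σ[ L ∈ Language ] Σ[ 𝒦 ∈ Age L ] Σ[ K ∈ ComputableAge 𝒦 ]
    (Σ[ M ∈ ωStructure L ] (ComputableStructure M × IsCanonicalAge M K))
    × CAP 𝒦
    × ((S : Pred ℕ 0ℓ) → cCAP K S → ∅ ′ ′ ≤ᵀ S)
theorem7p5 em = 𝓛 , 𝓚 , 𝕂ᶜ , (𝓜 , computable-𝓜 , canonical) ,
  cofinal-amalgamation em (neutral-or-decisive em) ,
  λ S (w , ce , _) → Reduction.reduction em w ce
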